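{- There exists an absolute constant $c>0$ such that the following holds. Let $\mathcal{C}=\{r_1 \bmod q_1,\dots,r_k \bmod q_k\}$ be a minimal covering system with distinct moduli $q_1<q_2<\cdots<q_k$. Then for every $j\in\{1,\dots,k\}$, the $j$-th smallest modulus satisfies $q_j\le \exp\!\big(c j^2/\log(j+1)\big)$.
   Context: A covering system is a finite set of arithmetic progressions (congruence classes $r \bmod q$ with $q\ge 1$) whose union is $\mathbb{Z}$. A covering system is minimal if no proper subset of its arithmetic progressions covers $\mathbb{Z}$. -}

module Defs where

open import Data.Nat using (ℕ; _≥_)
open import Data.Integer using (ℤ; +_; _-_)
open import Data.Integer.Divisibility using (_∣_)
open import Data.Fin using (Fin)
open import Data.Fin.Subset using (Subset; _∈_; _⊂_; ⊤)
open import Data.Product using (∃; _×_)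
open import Relation.Nullary using (¬_)

_∈AP_mod_ : ℤ → ℤ → ℕ → Set
x ∈AP r mod q = (+ q) ∣ (x - r)

CoversBy : {k : ℕ} → (Fin k → ℤ) → (Fin k → ℕ) → Subset k → Set
CoversBy r q S = ∀ (x : ℤ) → ∃ λ i → i ∈ S × (x ∈AP r i mod q i)

IsCoveringSystem : {k : ℕ} → (Fin k → ℤ) → (Fin k → ℕ) → Set
IsCoveringSystem r q = (∀ i → q i ≥ 1) × CoversBy r q ⊤

IsMinimalCoveringSystem : {k : ℕ} → (Fin k → ℤ) → (Fin k → ℕ) → Set
IsMinimalCoveringSystem r q =
  IsCoveringSystem r q × (∀ (S : Subset _) → S ⊂ ⊤ → ¬ CoversBy r q S)

{-# OPTIONS --safe #-}

-- The first j - 1 progressions leave some x₀ uncovered, and x₀ avoids each of them because of a single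
-- prime power.  If the remaining moduli were all huge, the distortion method of Balister, Bollobás,
-- Morris, Sahasrabudhe and Tiba would produce an integer outside all progressions.  Measures are
-- replaced by finite lists of integers: going through the primes p in increasing order, every point is
-- replaced by about half of its lifts modulo a high power of p, chosen among those that meet neither the
-- prime powers forbidden by the first progressions nor the progressions whose largest prime is p; points
-- with too few such lifts are dropped.
--
-- * Only the few primes p occurring in more than p / 4 of the first progressions need special care: there
--   all points are kept congruent to x₀ modulo p ^ h p, where no forbidden exponent lies just above h p.
-- * A large modulus all of whose primes are at most 4 ^ k₁ has many prime factors, so Rankin's trick bounds
--   the total weight of these moduli.
-- * For larger primes the number of dropped points is bounded by a second moment, which is summable by a
--   Chebyshev bound for the primes in a dyadic block.

module Submission where

open import Defs
open import Data.Bool using (true; false)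
open import Data.Empty using (⊥; ⊥-elim)
open import Data.Fin using (Fin; toℕ)
import Data.Fin.Properties as Fin
open import Data.Fin.Subset using (Subset; _⊂_; ⊤) renaming (_∈_ to _∈ₛ_)
open import Data.Fin.Subset.Properties using (∈⊤)
open import Data.Integer as ℤ using (ℤ)
import Data.Integer.Divisibility.Signed as ℤ
import Data.Integer.Properties as ℤ
open import Data.Integer.Tactic.RingSolver using () renaming (solve-∀ to solve-∀ᶻ)
open import Data.List using (List; []; _∷_; _++_; length; map; filter; concatMap; take; downFrom; applyDownFrom; allFin)
open import Data.List.Membership.Propositional using (_∈_; lose; find)
open import Data.List.Membership.Propositional.Properties
  using (∈-filter⁺; ∈-filter⁻; ∈-map⁺; ∈-map⁻; ∈-++⁺ˡ; ∈-++⁺ʳ; ∈-++⁻; ∈-∃++; ∈-allFin;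
         ∈-downFrom⁺; ∈-downFrom⁻; ∈-applyDownFrom⁺; ∈-applyDownFrom⁻)
open import Data.List.Properties using (length-++; length-map; length-take; length-downFrom; filter-++)
open import Data.List.Relation.Unary.All as All using (All)
open import Data.List.Relation.Unary.AllPairs as AllPairs using ()
open import Data.List.Relation.Unary.Any as Any using (Any; here; there; any?)
open import Data.List.Relation.Unary.Unique.Propositional using (Unique)
open import Data.List.Relation.Unary.Unique.Propositional.Properties using (filter⁺; allFin⁺; applyDownFrom⁺₁)
open import Data.Nat
open import Data.Nat.Combinatorics using (_C_; nCk+nC[k+1]≡[n+1]C[k+1]; nCk≡n!/k![n-k]!; k![n∸k]!∣n!; k>n⇒nCk≡0)
open import Data.Nat.Divisibility
open import Data.Nat.DivMod using (m/n*n≡m)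
open import Data.Nat.Logarithm
  using (⌊log₂_⌋; ⌈log₂_⌉; ⌊log₂⌋-mono-≤; ⌈log₂⌉-mono-≤; ⌊log₂[2^n]⌋≡n; ⌈log₂2^n⌉≡n)
open import Data.Nat.Primality
open import Data.Nat.Primality.Factorisation using (factorise; PrimeFactorisation)
open import Data.Nat.Properties
open import Data.Nat.Tactic.RingSolver using (solve-∀)
open import Data.Product using (∃; _×_; _,_; proj₁; proj₂)
open import Data.Sum using (_⊎_; inj₁; inj₂)
open import Data.Vec using (tabulate)
open import Data.Vec.Properties using (lookup⇒[]=; []=⇒lookup; lookup∘tabulate)
open import Function using (_∘_; id)
open import Relation.Binary using (tri<; tri≈; tri>)
open import Relation.Binary.PropositionalEquality hiding (J)
open import Relation.Nullary using (Dec; yes; no; ¬_; does)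
open import Relation.Nullary.Decidable using (_×-dec_; _⊎-dec_; ¬?; decidable-stable; dec-true; dec-false)

-- Keeping exactly `H p` lifts of a point, or none, bounds the lists from both sides: lengths are
-- compared with `T n`, the product of the `H p`, and the points in a class modulo `p ^ c` with
-- `u p c`. No fractions are needed.
--
-- The obstacle is the small primes, where the first progressions could forbid all lifts of a point.
-- Agreement with x₀ modulo `p ^ h p` settles the exponents up to `h p`, and a gap of length `g`,
-- about `log₂ (4 * J)`, above `h p` makes the remaining classes so thin that together they take at
-- most a quarter of the lifts. The price is that these primes no longer thin out the late
-- progressions: each costs a factor of order `h p` squared in the second moment and `128 ^ h p` in
-- Rankin's sum. Special primes satisfy `p < 4 * N p`, where the `N p` add up to at most `J`; so
-- there are only O(√J) of them, and the `h p` add up to at most `J * g`.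
--
-- Balancing gives `k₁` of order √J log J and `T₀` of order J log J. Hence the logarithm of the
-- modulus is O(`k₁ * T₀`), that is O(J^(3/2) (log J)^2), with room to spare below J^2 / log J.

𝟙 : {P : Set} → Dec P → ℕ
𝟙 (yes _) = 1
𝟙 (no _)  = 0

𝟙≤1 : {P : Set} (P? : Dec P) → 𝟙 P? ≤ 1
𝟙≤1 (yes _) = ≤-refl
𝟙≤1 (no _)  = z≤n

𝟙-true : {P : Set} (P? : Dec P) → P → 𝟙 P? ≡ 1
𝟙-true (yes _) _ = refl
𝟙-true (no ¬p) p = ⊥-elim (¬p p)

𝟙-false : {P : Set} (P? : Dec P) → ¬ P → 𝟙 P? ≡ 0
𝟙-false (yes p) ¬p = ⊥-elim (¬p p)
𝟙-false (no _)  _  = refl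

𝟙-mono : {P Q : Set} (P? : Dec P) (Q? : Dec Q) → (P → Q) → 𝟙 P? ≤ 𝟙 Q?
𝟙-mono (yes p) Q? f = ≤-reflexive (sym (𝟙-true Q? (f p)))
𝟙-mono (no _)  Q? f = z≤n

𝟙-× : {P Q : Set} (P? : Dec P) (Q? : Dec Q) → 𝟙 P? * 𝟙 Q? ≡ 𝟙 (P? ×-dec Q?)
𝟙-× (yes _) (yes _) = refl
𝟙-× (yes _) (no _)  = refl
𝟙-× (no _)  _       = refl

-- Finite sums and products over lists.

∑ : {A : Set} → List A → (A → ℕ) → ℕ
∑ []       f = 0
∑ (x ∷ xs) f = f x + ∑ xs f

∏ : {A : Set} → List A → (A → ℕ) → ℕ
∏ []       f = 1
∏ (x ∷ xs) f = f x * ∏ xs f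

module _ {A : Set} where

  ∑-mono∈ : (xs : List A) {f g : A → ℕ} → (∀ {x} → x ∈ xs → f x ≤ g x) → ∑ xs f ≤ ∑ xs g
  ∑-mono∈ []       h = z≤n
  ∑-mono∈ (x ∷ xs) h = +-mono-≤ (h (here refl)) (∑-mono∈ xs (h ∘ there))

  ∑-mono : (xs : List A) {f g : A → ℕ} → (∀ x → f x ≤ g x) → ∑ xs f ≤ ∑ xs g
  ∑-mono xs h = ∑-mono∈ xs (λ {x} _ → h x)

  ∑-cong : (xs : List A) {f g : A → ℕ} → (∀ x → f x ≡ g x) → ∑ xs f ≡ ∑ xs g
  ∑-cong []       h = refl
  ∑-cong (x ∷ xs) h = cong₂ _+_ (h x) (∑-cong xs h)

  ∑-zero : (xs : List A) → ∑ xs (λ _ → 0) ≡ 0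
  ∑-zero []       = refl
  ∑-zero (x ∷ xs) = ∑-zero xs

  ∑-one : (xs : List A) → ∑ xs (λ _ → 1) ≡ length xs
  ∑-one []       = refl
  ∑-one (x ∷ xs) = cong suc (∑-one xs)

  ∑-+ : (xs : List A) (f g : A → ℕ) → ∑ xs (λ x → f x + g x) ≡ ∑ xs f + ∑ xs g
  ∑-+ []       f g = refl
  ∑-+ (x ∷ xs) f g rewrite ∑-+ xs f g = lem (f x) (g x) (∑ xs f) (∑ xs g)
    where
    lem : ∀ a b c d → a + b + (c + d) ≡ a + c + (b + d)
    lem = solve-∀

  ∑-*ˡ : (xs : List A) (c : ℕ) (f : A → ℕ) → ∑ xs (λ x → c * f x) ≡ c * ∑ xs f
  ∑-*ˡ []       c f = sym (*-zeroʳ c)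
  ∑-*ˡ (x ∷ xs) c f rewrite ∑-*ˡ xs c f = sym (*-distribˡ-+ c (f x) (∑ xs f))

  ∑-*ʳ : (xs : List A) (c : ℕ) (f : A → ℕ) → ∑ xs (λ x → f x * c) ≡ ∑ xs f * c
  ∑-*ʳ xs c f = trans (∑-cong xs (λ x → *-comm (f x) c)) (trans (∑-*ˡ xs c f) (*-comm c _))

  ∑-++ : (xs ys : List A) (f : A → ℕ) → ∑ (xs ++ ys) f ≡ ∑ xs f + ∑ ys f
  ∑-++ []       ys f = refl
  ∑-++ (x ∷ xs) ys f rewrite ∑-++ xs ys f = sym (+-assoc (f x) _ _)

  ∑-filter : {P : A → Set} (P? : ∀ x → Dec (P x)) (xs : List A) (f : A → ℕ) →
             ∑ (filter P? xs) f ≡ ∑ xs (λ x → 𝟙 (P? x) * f x)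
  ∑-filter P? []       f = refl
  ∑-filter P? (x ∷ xs) f with P? x
  ... | yes _ = cong₂ _+_ (sym (*-identityˡ (f x))) (∑-filter P? xs f)
  ... | no  _ = ∑-filter P? xs f

  length-filter≡ : {P : A → Set} (P? : ∀ x → Dec (P x)) (xs : List A) →
                   length (filter P? xs) ≡ ∑ xs (λ x → 𝟙 (P? x))
  length-filter≡ P? xs = trans (sym (∑-one (filter P? xs)))
    (trans (∑-filter P? xs _) (∑-cong xs (λ x → *-identityʳ (𝟙 (P? x)))))

  ∑-filter≤ : {P : A → Set} (P? : ∀ x → Dec (P x)) (xs : List A) (f : A → ℕ) →
             ∑ (filter P? xs) f ≤ ∑ xs f
  ∑-filter≤ P? xs f = ≤-trans (≤-reflexive (∑-filter P? xs f))
    (∑-mono xs (λ x → ≤-trans (*-monoˡ-≤ (f x) (𝟙≤1 (P? x))) (≤-reflexive (*-identityˡ _))))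

  ∑-take≤ : (n : ℕ) (xs : List A) (f : A → ℕ) → ∑ (take n xs) f ≤ ∑ xs f
  ∑-take≤ zero    xs       f = z≤n
  ∑-take≤ (suc n) []       f = z≤n
  ∑-take≤ (suc n) (x ∷ xs) f = +-monoʳ-≤ (f x) (∑-take≤ n xs f)

  ∑-member : {xs : List A} {x : A} (f : A → ℕ) → x ∈ xs → f x ≤ ∑ xs f
  ∑-member f (here refl) = m≤m+n _ _
  ∑-member f (there x∈)  = ≤-trans (∑-member f x∈) (m≤n+m _ _)

  ∑-bound : (xs : List A) {c : ℕ} {f : A → ℕ} → (∀ {x} → x ∈ xs → f x ≤ c) → ∑ xs f ≤ length xs * c
  ∑-bound []       h = z≤n
  ∑-bound (x ∷ xs) h = +-mono-≤ (h (here refl)) (∑-bound xs (h ∘ there))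

  ∏-cong∈ : (xs : List A) {f g : A → ℕ} → (∀ {x} → x ∈ xs → f x ≡ g x) → ∏ xs f ≡ ∏ xs g
  ∏-cong∈ []       h = refl
  ∏-cong∈ (x ∷ xs) h = cong₂ _*_ (h (here refl)) (∏-cong∈ xs (h ∘ there))

  ∏-mono∈ : (xs : List A) {f g : A → ℕ} → (∀ {x} → x ∈ xs → f x ≤ g x) → ∏ xs f ≤ ∏ xs g
  ∏-mono∈ []       h = ≤-refl
  ∏-mono∈ (x ∷ xs) h = *-mono-≤ (h (here refl)) (∏-mono∈ xs (h ∘ there))

  ∏-* : (xs : List A) (f g : A → ℕ) → ∏ xs (λ x → f x * g x) ≡ ∏ xs f * ∏ xs g
  ∏-* []       f g = refl
  ∏-* (x ∷ xs) f g rewrite ∏-* xs f g = lem (f x) (g x) (∏ xs f) (∏ xs g)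
    where
    lem : ∀ a b c d → a * b * (c * d) ≡ a * c * (b * d)
    lem = solve-∀

  ∏-^ : (xs : List A) (c : ℕ) (f : A → ℕ) → ∏ xs (λ x → c ^ f x) ≡ c ^ ∑ xs f
  ∏-^ []       c f = refl
  ∏-^ (x ∷ xs) c f rewrite ∏-^ xs c f = sym (^-distribˡ-+-* c (f x) _)

  ∏-++ : (xs ys : List A) (f : A → ℕ) → ∏ (xs ++ ys) f ≡ ∏ xs f * ∏ ys f
  ∏-++ []       ys f = sym (*-identityˡ _)
  ∏-++ (x ∷ xs) ys f rewrite ∏-++ xs ys f = sym (*-assoc (f x) _ _)

  ∏-positive : (xs : List A) {f : A → ℕ} → (∀ {x} → x ∈ xs → 0 < f x) → 0 < ∏ xs f
  ∏-positive []       h = s≤s z≤n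
  ∏-positive (x ∷ xs) h = *-mono-< (h (here refl)) (∏-positive xs (h ∘ there))

module _ {A B : Set} where

  ∑-swap : (xs : List A) (ys : List B) (f : A → B → ℕ) →
           ∑ xs (λ x → ∑ ys (f x)) ≡ ∑ ys (λ y → ∑ xs (λ x → f x y))
  ∑-swap []       ys f = sym (∑-zero ys)
  ∑-swap (x ∷ xs) ys f rewrite ∑-swap xs ys f = sym (∑-+ ys (f x) _)

  ∑-map : (g : A → B) (xs : List A) (f : B → ℕ) → ∑ (map g xs) f ≡ ∑ xs (f ∘ g)
  ∑-map g []       f = refl
  ∑-map g (x ∷ xs) f = cong (f (g x) +_) (∑-map g xs f)

  ∑-concatMap : (g : A → List B) (xs : List A) (f : B → ℕ) →
                ∑ (concatMap g xs) f ≡ ∑ xs (λ x → ∑ (g x) f)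
  ∑-concatMap g []       f = refl
  ∑-concatMap g (x ∷ xs) f = trans (∑-++ (g x) _ f) (cong (∑ (g x) f +_) (∑-concatMap g xs f))

∑-*-∑ : {A : Set} (xs : List A) (f : A → ℕ) →
        ∑ xs f * ∑ xs f ≡ ∑ xs (λ x → ∑ xs (λ y → f x * f y))
∑-*-∑ xs f = trans (sym (∑-*ʳ xs (∑ xs f) f)) (∑-cong xs (λ x → sym (∑-*ˡ xs (f x) f)))

-- Sums and counts over initial segments.

∑-downFrom-+ : ∀ a b (f : ℕ → ℕ) → ∑ (downFrom (a + b)) f ≡ ∑ (downFrom a) f + ∑ (downFrom b) (λ t → f (a + t))
∑-downFrom-+ a zero    f rewrite +-identityʳ a = sym (+-identityʳ _)
∑-downFrom-+ a (suc b) f rewrite +-suc a b | ∑-downFrom-+ a b f =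
  lem (f (a + b)) (∑ (downFrom a) f) (∑ (downFrom b) (λ t → f (a + t)))
  where
  lem : ∀ a b c → a + (b + c) ≡ b + (a + c)
  lem = solve-∀

-- Exactly `2 * c + 1` pairs have maximum `c`. This reduces the double sums of the second moment to
-- single ones.
∑-⊔ : ∀ m (g : ℕ → ℕ) → ∑ (downFrom m) (λ a → ∑ (downFrom m) (λ b → g (a ⊔ b))) ≡
                        ∑ (downFrom m) (λ c → (2 * c + 1) * g c)
∑-⊔ zero    g = refl
∑-⊔ (suc m) g = begin
  (g (m ⊔ m) + ∑ (downFrom m) (λ b → g (m ⊔ b))) + ∑ (downFrom m) (λ a → g (a ⊔ m) + ∑ (downFrom m) (λ b → g (a ⊔ b)))
    ≡⟨ cong₂ _+_ (cong₂ _+_ (cong g (⊔-idem m)) (row m ≤-refl)) (∑-+ (downFrom m) _ _) ⟩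
  (g m + m * g m) + (∑ (downFrom m) (λ a → g (a ⊔ m)) + ∑ (downFrom m) (λ a → ∑ (downFrom m) (λ b → g (a ⊔ b))))
    ≡⟨ cong ((g m + m * g m) +_) (cong₂ _+_ (trans (∑-cong (downFrom m) (λ a → cong g (⊔-comm a m))) (row m ≤-refl)) (∑-⊔ m g)) ⟩
  (g m + m * g m) + (m * g m + ∑ (downFrom m) (λ c → (2 * c + 1) * g c))
    ≡⟨ lem m (g m) _ ⟩
  (2 * m + 1) * g m + ∑ (downFrom m) (λ c → (2 * c + 1) * g c) ∎
  where
  open ≡-Reasoning
  row : ∀ n → n ≤ m → ∑ (downFrom n) (λ b → g (m ⊔ b)) ≡ n * g m
  row zero    _   = refl
  row (suc n) n<m = cong₂ _+_ (cong g (m≥n⇒m⊔n≡m (<⇒≤ n<m))) (row n (<⇒≤ n<m))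
  lem : ∀ m x y → (x + m * x) + (m * x + y) ≡ (2 * m + 1) * x + y
  lem = solve-∀

count-subsingleton : {P : ℕ → Set} (P? : ∀ t → Dec (P t)) (n : ℕ) →
  (∀ {s t} → s < n → t < n → P s → P t → s ≡ t) → ∑ (downFrom n) (λ t → 𝟙 (P? t)) ≤ 1
count-subsingleton P? zero    h = z≤n
count-subsingleton P? (suc n) h with P? n
... | no  _ = count-subsingleton P? n (λ s< t< → h (m<n⇒m<1+n s<) (m<n⇒m<1+n t<))
... | yes p = s≤s (≤-reflexive (none n ≤-refl))
  where
  none : ∀ m → m ≤ n → ∑ (downFrom m) (λ t → 𝟙 (P? t)) ≡ 0
  none zero    _   = refl
  none (suc m) m<n = cong₂ _+_
    (𝟙-false (P? m) (λ q → <⇒≢ m<n (h (m<n⇒m<1+n m<n) ≤-refl q p))) (none m (<⇒≤ m<n))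

-- Each of the `k` runs of `m` consecutive integers contains at most one solution.
count-class : {P : ℕ → Set} (P? : ∀ t → Dec (P t)) (m k : ℕ) → 0 < m →
  (∀ {s t} → P s → P t → m ∣ ∣ s - t ∣) → ∑ (downFrom (m * k)) (λ t → 𝟙 (P? t)) ≤ k
count-class P? m zero    0<m h rewrite *-zeroʳ m = z≤n
count-class {P} P? m (suc k) 0<m h rewrite *-suc m k | ∑-downFrom-+ m (m * k) (λ t → 𝟙 (P? t)) =
  +-mono-≤ (count-subsingleton P? m close)
    (count-class (λ t → P? (m + t)) m k 0<m (λ {s} {t} p q → subst (m ∣_) (∣m+n-m+o∣≡∣n-o∣ m s t) (h p q)))
  where
  close : ∀ {s t} → s < m → t < m → P s → P t → s ≡ t
  close {s} {t} s<m t<m p q with ∣ s - t ∣ in eq | h p q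
  ... | zero  | _ = ∣m-n∣≡0⇒m≡n eq
  ... | suc d | m∣d = ⊥-elim (<⇒≱ (≤-<-trans (≤-trans (≤-reflexive (sym eq)) (∣m-n∣≤m⊔n s t)) (⊔-lub s<m t<m)) (∣⇒≤ m∣d))

-- The induction splits the items by their exponent at the first index.
∑∏-distinct : {A : Set} (γ : ℕ) (ν : A → ℕ → ℕ) → (∀ i p → ν i p ≤ γ) →
  (f : ℕ → ℕ → ℕ) (ps : List ℕ) (I : List A) → Unique I →
  (∀ {i j} → i ∈ I → j ∈ I → (∀ {p} → p ∈ ps → ν i p ≡ ν j p) → i ≡ j) →
  ∑ I (λ i → ∏ ps (λ p → f p (ν i p))) ≤ ∏ ps (λ p → ∑ (downFrom (suc γ)) (f p))
∑∏-distinct γ ν ν≤γ f [] [] u inj = z≤n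
∑∏-distinct γ ν ν≤γ f [] (i ∷ []) u inj = ≤-refl
∑∏-distinct γ ν ν≤γ f [] (i ∷ j ∷ I) ((i≢j All.∷ _) AllPairs.∷ _) inj =
  ⊥-elim (i≢j (inj (here refl) (there (here refl)) (λ ())))
∑∏-distinct γ ν ν≤γ f (p ∷ ps) I u inj = begin
  ∑ I (λ i → f p (ν i p) * R i)
    ≤⟨ ∑-mono I (λ i → *-monoˡ-≤ (R i) (select i)) ⟩
  ∑ I (λ i → ∑ E (λ a → 𝟙 (ν i p ≟ a) * f p a) * R i)
    ≡⟨ ∑-cong I (λ i → trans (sym (∑-*ʳ E (R i) (λ a → 𝟙 (ν i p ≟ a) * f p a))) (∑-cong E (λ a → lem (𝟙 (ν i p ≟ a)) (f p a) (R i)))) ⟩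
  ∑ I (λ i → ∑ E (λ a → f p a * (𝟙 (ν i p ≟ a) * R i)))
    ≡⟨ ∑-swap I E _ ⟩
  ∑ E (λ a → ∑ I (λ i → f p a * (𝟙 (ν i p ≟ a) * R i)))
    ≡⟨ ∑-cong E (λ a → trans (∑-*ˡ I (f p a) _) (cong (f p a *_) (sym (∑-filter (λ i → ν i p ≟ a) I R)))) ⟩
  ∑ E (λ a → f p a * ∑ (filter (λ i → ν i p ≟ a) I) R)
    ≤⟨ ∑-mono E (λ a → *-monoʳ-≤ (f p a) (rec a)) ⟩
  ∑ E (λ a → f p a * S)
    ≡⟨ ∑-*ʳ E S (f p) ⟩
  ∑ E (f p) * S ∎
  where
  open ≤-Reasoning
  E = downFrom (suc γ)
  R = λ i → ∏ ps (λ p → f p (ν i p))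
  S = ∏ ps (λ p → ∑ E (f p))
  lem : ∀ a b c → a * b * c ≡ b * (a * c)
  lem = solve-∀
  select : ∀ i → f p (ν i p) ≤ ∑ E (λ a → 𝟙 (ν i p ≟ a) * f p a)
  select i = ≤-trans (≤-reflexive (trans (sym (*-identityˡ _)) (cong (_* f p (ν i p)) (sym (𝟙-true (ν i p ≟ ν i p) refl)))))
    (∑-member (λ a → 𝟙 (ν i p ≟ a) * f p a) (∈-downFrom⁺ (s≤s (ν≤γ i p))))
  rec : ∀ a → ∑ (filter (λ i → ν i p ≟ a) I) R ≤ S
  rec a = ∑∏-distinct γ ν ν≤γ f ps _ (filter⁺ (λ i → ν i p ≟ a) u) inj′
    where
    inj′ : ∀ {i j} → i ∈ filter (λ i → ν i p ≟ a) I → j ∈ filter (λ i → ν i p ≟ a) I → (∀ {q} → q ∈ ps → ν i q ≡ ν j q) → i ≡ j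
    inj′ i∈ j∈ h with ∈-filter⁻ (λ i → ν i p ≟ a) i∈ | ∈-filter⁻ (λ i → ν i p ≟ a) j∈
    ... | i∈I , refl | j∈I , eq = inj i∈I j∈I λ { (here refl) → sym eq ; (there q∈) → h q∈ }

-- With ratio `3 / 4` the tail after `f c` is at most `3 * f c`. The induction carries the extra
-- term `3 * f (c + n)`, which is room for everything not yet summed.
∑-geometric : (f : ℕ → ℕ) (c : ℕ) (n : ℕ) → (∀ i → i < n → 4 * f (suc (c + i)) ≤ 3 * f (c + i)) →
              ∑ (downFrom (suc (c + n))) f ≤ ∑ (downFrom (suc c)) f + 3 * f c
∑-geometric f c n h = ≤-trans (m≤m+n _ (3 * f (c + n))) (go n h)
  where
  open ≤-Reasoning
  lem : ∀ a b → a + b + 3 * a ≡ 4 * a + b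
  lem = solve-∀
  go : ∀ n → (∀ i → i < n → 4 * f (suc (c + i)) ≤ 3 * f (c + i)) →
       ∑ (downFrom (suc (c + n))) f + 3 * f (c + n) ≤ ∑ (downFrom (suc c)) f + 3 * f c
  go zero    h rewrite +-identityʳ c = ≤-refl
  go (suc n) h rewrite +-suc c n = begin
    f (suc (c + n)) + ∑ (downFrom (suc (c + n))) f + 3 * f (suc (c + n))
      ≡⟨ lem (f (suc (c + n))) _ ⟩
    4 * f (suc (c + n)) + ∑ (downFrom (suc (c + n))) f
      ≤⟨ +-monoˡ-≤ _ (h n ≤-refl) ⟩
    3 * f (c + n) + ∑ (downFrom (suc (c + n))) f
      ≡⟨ +-comm (3 * f (c + n)) _ ⟩
    ∑ (downFrom (suc (c + n))) f + 3 * f (c + n)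
      ≤⟨ go n (λ i i<n → h i (m<n⇒m<1+n i<n)) ⟩
    ∑ (downFrom (suc c)) f + 3 * f c ∎

-- Primes in intervals and divisibility by prime powers.

-- The interval is `(a, a + n]`, in decreasing order, so that a new largest prime is consed at the
-- front.
primesIn : ℕ → ℕ → List ℕ
primesIn a n = filter prime? (applyDownFrom (λ i → suc (a + i)) n)

primes : ℕ → List ℕ
primes = primesIn 0

∈-primesIn⁻ : ∀ a n {p} → p ∈ primesIn a n → Prime p × a < p × p ≤ a + n
∈-primesIn⁻ a n p∈ with ∈-filter⁻ prime? {xs = applyDownFrom (λ i → suc (a + i)) n} p∈
... | p∈′ , pr with ∈-applyDownFrom⁻ (λ i → suc (a + i)) p∈′
...   | i , i<n , refl = pr , s≤s (m≤m+n a i) , +-monoʳ-< a i<n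

∈-primesIn⁺ : ∀ a n {p} → Prime p → a < p → p ≤ a + n → p ∈ primesIn a n
∈-primesIn⁺ a n {suc p} pr (s≤s a≤p) p≤ =
  ∈-filter⁺ prime? (subst (λ x → suc x ∈ applyDownFrom (λ i → suc (a + i)) n) (m+[n∸m]≡n a≤p)
    (∈-applyDownFrom⁺ (λ i → suc (a + i)) (+-cancelˡ-< a _ _ (subst (_< a + n) (sym (m+[n∸m]≡n a≤p)) p≤)))) pr

∈-primes⁻ : ∀ n {p} → p ∈ primes n → Prime p × p ≤ n
∈-primes⁻ n p∈ with ∈-primesIn⁻ 0 n p∈
... | pr , _ , p≤n = pr , p≤n

∈-primes⁺ : ∀ n {p} → Prime p → p ≤ n → p ∈ primes n
∈-primes⁺ n pr p≤n = ∈-primesIn⁺ 0 n pr (>-nonZero⁻¹ _ {{prime⇒nonZero pr}}) p≤n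

primesIn-+ : ∀ a b c → primesIn a (b + c) ≡ primesIn (a + b) c ++ primesIn a b
primesIn-+ a b c = trans (cong (filter prime?) (apply-+ c)) (filter-++ prime? (applyDownFrom (λ i → suc (a + b + i)) c) _)
  where
  apply-+ : ∀ c → applyDownFrom (λ i → suc (a + i)) (b + c) ≡
                  applyDownFrom (λ i → suc (a + b + i)) c ++ applyDownFrom (λ i → suc (a + i)) b
  apply-+ zero    rewrite +-identityʳ b = refl
  apply-+ (suc c) rewrite +-suc b c = cong₂ _∷_ (cong suc (sym (+-assoc a b c))) (apply-+ c)

prime⇒≥2 : ∀ {p} → Prime p → 2 ≤ p
prime⇒≥2 pr = nonTrivial⇒n>1 _ {{prime⇒nonTrivial pr}}

prime⇒>0 : ∀ {p} → Prime p → 0 < p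
prime⇒>0 pr = <⇒≤ (prime⇒≥2 pr)

prime∤1 : ∀ {p} → Prime p → ¬ p ∣ 1
prime∤1 pr p∣1 = <⇒≱ (prime⇒≥2 pr) (∣⇒≤ p∣1)

prime∤∏ : ∀ {p} → Prime p → (ps : List ℕ) (f : ℕ → ℕ) → (∀ {q} → q ∈ ps → ¬ p ∣ f q) → ¬ p ∣ ∏ ps f
prime∤∏ pr []       f h p∣ = prime∤1 pr p∣
prime∤∏ pr (q ∷ ps) f h p∣ with euclidsLemma (f q) (∏ ps f) pr p∣
... | inj₁ p∣f = h (here refl) p∣f
... | inj₂ p∣∏ = prime∤∏ pr ps f (h ∘ there) p∣∏

prime∣^⇒∣ : ∀ {p} → Prime p → ∀ m e → p ∣ m ^ e → p ∣ m
prime∣^⇒∣ pr m zero    p∣ = ⊥-elim (prime∤1 pr p∣)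
prime∣^⇒∣ pr m (suc e) p∣ with euclidsLemma m (m ^ e) pr p∣
... | inj₁ p∣m = p∣m
... | inj₂ p∣  = prime∣^⇒∣ pr m e p∣

prime∣prime⇒≡ : ∀ {p q} → Prime p → Prime q → p ∣ q → p ≡ q
prime∣prime⇒≡ pr qr p∣q with prime⇒irreducible qr p∣q
... | inj₁ refl = ⊥-elim (¬prime[1] pr)
... | inj₂ p≡q = p≡q

prime^∣*⇒∣ : ∀ {p} → Prime p → ∀ m e x → ¬ p ∣ m → p ^ e ∣ m * x → p ^ e ∣ x
prime^∣*⇒∣ pr m zero    x p∤m h = 1∣ x
prime^∣*⇒∣ {p} pr m (suc e) x p∤m h with euclidsLemma m x pr (m*n∣⇒m∣ p (p ^ e) h)
... | inj₁ p∣m = ⊥-elim (p∤m p∣m)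
... | inj₂ (divides y refl) rewrite *-comm y p =
  *-monoʳ-∣ p (prime^∣*⇒∣ pr m e y p∤m
    (*-cancelˡ-∣ p {{prime⇒nonZero pr}} (subst (p * p ^ e ∣_) (lem m p y) h)))
  where
  lem : ∀ a b c → a * (b * c) ≡ b * (a * c)
  lem = solve-∀

^-∸-split : ∀ p {a b} → a ≤ b → p ^ b ≡ p ^ a * p ^ (b ∸ a)
^-∸-split p {a} {b} a≤b = trans (cong (p ^_) (sym (m+[n∸m]≡n a≤b))) (^-distribˡ-+-* p a (b ∸ a))

^>0 : ∀ {p} e → 0 < p → 0 < p ^ e
^>0 {p} e 0<p = m^n>0 p {{>-nonZero 0<p}} e

^-distribʳ-* : ∀ a b k → (a * b) ^ k ≡ a ^ k * b ^ k
^-distribʳ-* a b zero    = refl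
^-distribʳ-* a b (suc k) = trans (cong (a * b *_) (^-distribʳ-* a b k)) (lem a b (a ^ k) (b ^ k))
  where
  lem : ∀ a b c d → a * b * (c * d) ≡ a * c * (b * d)
  lem = solve-∀

prime∣!⇒≤ : ∀ {p} → Prime p → ∀ n → p ∣ n ! → p ≤ n
prime∣!⇒≤ pr zero    p∣ = ⊥-elim (prime∤1 pr p∣)
prime∣!⇒≤ pr (suc n) p∣ with euclidsLemma (suc n) (n !) pr p∣
... | inj₁ p∣n = ∣⇒≤ p∣n
... | inj₂ p∣! = m≤n⇒m≤1+n (prime∣!⇒≤ pr n p∣!)

-- The power of the new prime divides `c * Π` and is coprime to `Π`, so it divides the cofactor `c`.
∏-primesIn-∣ : ∀ a n X (e : ℕ → ℕ) → (∀ {p} → p ∈ primesIn a n → p ^ e p ∣ X) → ∏ (primesIn a n) (λ p → p ^ e p) ∣ X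
∏-primesIn-∣ a zero    X e h = 1∣ X
∏-primesIn-∣ a (suc n) X e h with prime? (suc (a + n))
... | no  _  = ∏-primesIn-∣ a n X e h
... | yes pr with ∏-primesIn-∣ a n X e (h ∘ there)
...   | divides c refl = *-monoˡ-∣ Π (prime^∣*⇒∣ pr Π (e p) c p∤Π (subst (p ^ e p ∣_) (*-comm c Π) (h (here refl))))
  where
  p = suc (a + n)
  Π = ∏ (primesIn a n) (λ q → q ^ e q)
  p∤Π : ¬ p ∣ Π
  p∤Π = prime∤∏ pr (primesIn a n) (λ q → q ^ e q) λ {q} q∈ p∣q^e → let qr , _ , q≤ = ∈-primesIn⁻ a n q∈ in
    <⇒≱ (s≤s q≤) (∣⇒≤ {{prime⇒nonZero qr}} (prime∣^⇒∣ pr q (e q) p∣q^e))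

-- Chebyshev's bound and products over primes.

nCk≤2^n : ∀ n k → n C k ≤ 2 ^ n
nCk≤2^n zero    zero    = ≤-refl
nCk≤2^n zero    (suc k) rewrite k>n⇒nCk≡0 {0} {suc k} (s≤s z≤n) = z≤n
nCk≤2^n (suc n) zero    = ^>0 (suc n) (s≤s z≤n)
nCk≤2^n (suc n) (suc k) = begin
  suc n C suc k         ≡⟨ nCk+nC[k+1]≡[n+1]C[k+1] n k ⟨
  n C k + n C suc k     ≤⟨ +-mono-≤ (nCk≤2^n n k) (nCk≤2^n n (suc k)) ⟩
  2 ^ n + 2 ^ n         ≡⟨ cong (2 ^ n +_) (+-identityʳ (2 ^ n)) ⟨
  2 ^ suc n             ∎
  where open ≤-Reasoning

nCn*!*! : ∀ n → ((n + n) C n) * (n ! * n !) ≡ (n + n) !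
nCn*!*! n = begin
  ((n + n) C n) * (n ! * n !)           ≡⟨ cong (λ k → ((n + n) C n) * (n ! * k !)) (m+n∸n≡m n n) ⟨
  ((n + n) C n) * (n ! * (n + n ∸ n) !) ≡⟨ cong (_* (n ! * (n + n ∸ n) !)) (nCk≡n!/k![n-k]! (m≤m+n n n)) ⟩
  _                                   ≡⟨ m/n*n≡m {{n !* (n + n ∸ n) !≢0}} (k![n∸k]!∣n! (m≤m+n n n)) ⟩
  (n + n) !                           ∎
  where open ≡-Reasoning

-- `p` divides `(n + n) !` but, exceeding `n`, neither factor `n !` in `nCn*!*!`.
prime∣central : ∀ n {p} → Prime p → n < p → p ≤ n + n → p ∣ (n + n) C n
prime∣central n {p} pr n<p p≤2n
  with euclidsLemma ((n + n) C n) (n ! * n !) pr (subst (p ∣_) (sym (nCn*!*! n)) (∣-trans (p∣p! pr) (m≤n⇒m!∣n! p≤2n)))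
  where
  p∣p! : ∀ {p} → Prime p → p ∣ p !
  p∣p! {zero}  pr = ⊥-elim (¬prime[0] pr)
  p∣p! {suc p} pr = m∣m*n (p !)
... | inj₁ p∣C = p∣C
... | inj₂ p∣  with euclidsLemma (n !) (n !) pr p∣
...   | inj₁ p∣! = ⊥-elim (<⇒≱ n<p (prime∣!⇒≤ pr n p∣!))
...   | inj₂ p∣! = ⊥-elim (<⇒≱ n<p (prime∣!⇒≤ pr n p∣!))

-- The primes in `(n, 2 * n]`, with `n = 2 ^ e`, have a product dividing the central binomial
-- coefficient, which is at most `2 ^ (n + n)`. Each of them exceeds `2 ^ e`, so comparing exponents
-- of `2` counts them without logarithms.
chebyshev : ∀ e → e * length (primesIn (2 ^ e) (2 ^ e)) ≤ 2 ^ e + 2 ^ e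
chebyshev e = ≮⇒≥ λ lt → <⇒≱ (^-monoʳ-< 2 (s≤s (s≤s z≤n)) lt) (begin
  2 ^ (e * c)            ≡⟨ ^-*-assoc 2 e c ⟨
  n ^ c                  ≤⟨ pow (primesIn n n) (λ q∈ → <⇒≤ (proj₁ (proj₂ (∈-primesIn⁻ n n q∈)))) ⟩
  ∏ (primesIn n n) id    ≡⟨ ∏-cong∈ (primesIn n n) (λ {q} _ → sym (*-identityʳ q)) ⟩
  ∏ (primesIn n n) (_^ 1) ≤⟨ ∣⇒≤ {{>-nonZero C>0}} (∏-primesIn-∣ n n _ (λ _ → 1) (λ {q} q∈ → let pr , l , u = ∈-primesIn⁻ n n q∈ in
                              subst (_∣ (n + n) C n) (sym (*-identityʳ q)) (prime∣central n pr l u))) ⟩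
  (n + n) C n            ≤⟨ nCk≤2^n (n + n) n ⟩
  2 ^ (n + n)            ∎)
  where
  open ≤-Reasoning
  n = 2 ^ e
  c = length (primesIn n n)
  pow : ∀ ps → (∀ {q} → q ∈ ps → n ≤ q) → n ^ length ps ≤ ∏ ps id
  pow []       h = ≤-refl
  pow (q ∷ ps) h = *-mono-≤ (h (here refl)) (pow ps (h ∘ there))
  C>0 : 0 < (n + n) C n
  C>0 = n≢0⇒n>0 λ C≡0 → <⇒≢ (1≤n! (n + n)) (trans (cong (_* (n ! * n !)) (sym C≡0)) (nCn*!*! n))

primes-blocks : ∀ k → primes (4 ^ suc k) ≡ primesIn (4 ^ k) (3 * 4 ^ k) ++ primes (4 ^ k)
primes-blocks k = trans (cong primes (lem (4 ^ k))) (primesIn-+ 0 (4 ^ k) (3 * 4 ^ k))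
  where
  lem : ∀ n → 4 * n ≡ n + 3 * n
  lem = solve-∀

-- The block `(4 ^ k, 4 ^ suc k]` consists of the dyadic blocks with exponents `2 * k` and
-- `2 * k + 1`.
primes-block-length : ∀ k → k * length (primesIn (4 ^ k) (3 * 4 ^ k)) ≤ 3 * 4 ^ k
primes-block-length k = begin
  k * length (primesIn n (3 * n))  ≡⟨ cong (λ ps → k * length ps) (trans (cong (primesIn n) (lem₀ n)) (primesIn-+ n n (2 * n))) ⟩
  k * length (primesIn (n + n) (2 * n) ++ primesIn n n) ≡⟨ cong (k *_) (length-++ (primesIn (n + n) (2 * n))) ⟩
  k * (length (primesIn (n + n) (2 * n)) + length (primesIn n n)) ≡⟨ cong₂ (λ x y → k * (length (primesIn x (2 * n)) + length (primesIn y y))) (cong (n +_) (sym (+-identityʳ n))) n≡ ⟩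
  k * (length (primesIn (2 * n) (2 * n)) + c₁) ≡⟨ cong (λ x → k * (length (primesIn (2 * x) (2 * x)) + c₁)) n≡ ⟩
  k * (c₂ + c₁) ≤⟨ *-cancelˡ-≤ 2 main ⟩
  3 * n ∎
  where
  open ≤-Reasoning
  n = 4 ^ k
  n≡ : 4 ^ k ≡ 2 ^ (2 * k)
  n≡ = ^-*-assoc 2 2 k
  c₁ = length (primesIn (2 ^ (2 * k)) (2 ^ (2 * k)))
  c₂ = length (primesIn (2 ^ suc (2 * k)) (2 ^ suc (2 * k)))
  lem₀ : ∀ n → 3 * n ≡ n + 2 * n
  lem₀ = solve-∀
  lem₁ : ∀ k a b → 2 * (k * (a + b)) + a ≡ suc (2 * k) * a + (2 * k) * b
  lem₁ = solve-∀
  lem₂ : ∀ n → (2 * n + 2 * n) + (n + n) ≡ 2 * (3 * n)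
  lem₂ = solve-∀
  main : 2 * (k * (c₂ + c₁)) ≤ 2 * (3 * n)
  main = begin
    2 * (k * (c₂ + c₁))             ≤⟨ m≤m+n _ c₂ ⟩
    2 * (k * (c₂ + c₁)) + c₂        ≡⟨ lem₁ k c₂ c₁ ⟩
    suc (2 * k) * c₂ + (2 * k) * c₁ ≤⟨ +-mono-≤ (chebyshev (suc (2 * k))) (chebyshev (2 * k)) ⟩
    (2 * 2 ^ (2 * k) + 2 * 2 ^ (2 * k)) + (2 ^ (2 * k) + 2 ^ (2 * k)) ≡⟨ lem₂ (2 ^ (2 * k)) ⟩
    2 * (3 * 2 ^ (2 * k))           ≡⟨ cong (λ x → 2 * (3 * x)) n≡ ⟨
    2 * (3 * n)                     ∎

-- Weierstrass' inequality ∏ (1 - b / (q + b)) ≥ 1 - ∑ b / (q + b), with denominators cleared.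
weierstrass : ∀ n b (qs : List ℕ) → (∀ {q} → q ∈ qs → n ≤ q) →
  n * ∏ qs (_+ b) ≤ n * ∏ qs id + length qs * b * ∏ qs (_+ b)
weierstrass n b []       h = m≤m+n _ _
weierstrass n b (q ∷ qs) h = begin
  n * ((q + b) * P′)                                      ≡⟨ lem₁ n q b P′ ⟩
  q * (n * P′) + n * (b * P′)                             ≤⟨ +-mono-≤ (*-monoʳ-≤ q (weierstrass n b qs (h ∘ there))) (*-monoˡ-≤ (b * P′) (h (here refl))) ⟩
  q * (n * P + ℓ * b * P′) + q * (b * P′)                 ≤⟨ m≤m+n _ _ ⟩
  q * (n * P + ℓ * b * P′) + q * (b * P′) + (1 + ℓ) * b * (b * P′) ≡⟨ lem₂ n q b P P′ ℓ ⟩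
  n * (q * P) + (1 + ℓ) * b * ((q + b) * P′)              ∎
  where
  open ≤-Reasoning
  P = ∏ qs id
  P′ = ∏ qs (_+ b)
  ℓ = length qs
  lem₁ : ∀ n q b P → n * ((q + b) * P) ≡ q * (n * P) + n * (b * P)
  lem₁ = solve-∀
  lem₂ : ∀ n q b P P′ ℓ → q * (n * P + ℓ * b * P′) + q * (b * P′) + (1 + ℓ) * b * (b * P′) ≡
                          n * (q * P) + (1 + ℓ) * b * ((q + b) * P′)
  lem₂ = solve-∀

-- The product of the `1 + 28 / q` is at most `2` once the sum of the `28 / (q + 28)` is at most
-- `1 / 2`. With at most `3 * 4 ^ k / k` primes, all above `4 ^ k`, that sum is at most `84 / k`,
-- whence the threshold `168`.
block-doubling : ∀ k → 168 ≤ k →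
  ∏ (primesIn (4 ^ k) (3 * 4 ^ k)) (_+ 28) ≤ 2 * ∏ (primesIn (4 ^ k) (3 * 4 ^ k)) id
block-doubling k 168≤k = *-cancelˡ-≤ n {{>-nonZero (^>0 k (s≤s z≤n))}} (+-cancelʳ-≤ (n * P′) _ _ (begin
  n * P′ + n * P′                        ≡⟨ lem₁ (n * P′) ⟩
  2 * (n * P′)                           ≤⟨ *-monoʳ-≤ 2 (weierstrass n 28 qs (λ q∈ → <⇒≤ (proj₁ (proj₂ (∈-primesIn⁻ n (3 * n) q∈))))) ⟩
  2 * (n * P + c * 28 * P′)              ≡⟨ lem₂ n P c 28 P′ ⟩
  n * (2 * P) + (56 * c) * P′            ≤⟨ +-monoʳ-≤ (n * (2 * P)) (*-monoˡ-≤ P′ 56c≤n) ⟩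
  n * (2 * P) + n * P′                   ∎))
  where
  open ≤-Reasoning
  n = 4 ^ k
  qs = primesIn n (3 * n)
  c = length qs
  P = ∏ qs id
  P′ = ∏ qs (_+ 28)
  lem₁ : ∀ x → x + x ≡ 2 * x
  lem₁ = solve-∀
  lem₂ : ∀ n P c b P′ → 2 * (n * P + c * b * P′) ≡ n * (2 * P) + ((2 * b) * c) * P′
  lem₂ = solve-∀
  56c≤n : 56 * c ≤ n
  56c≤n = *-cancelˡ-≤ 3 (begin
    3 * (56 * c) ≡⟨ *-assoc 3 56 c ⟨
    168 * c      ≤⟨ *-monoˡ-≤ c 168≤k ⟩
    k * c        ≤⟨ primes-block-length k ⟩
    3 * n        ∎)

-- The true growth is a power of `k`, but doubling once per block is easier to prove, and `2 ^ k`,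
-- the square root of the range, still loses against the sum of `1 / p ^ 2`. `k₀` stays a variable,
-- and its instance below is abstract, because the constant is a product over all primes up to
-- `4 ^ k₀`, which must never be evaluated.
∏-primes-bound-from : ∀ k₀ → 168 ≤ k₀ → ∃ λ A → ∀ k → ∏ (primes (4 ^ k)) (_+ 28) ≤ A * 2 ^ k * ∏ (primes (4 ^ k)) id
∏-primes-bound-from k₀ 168≤k₀ = A , bound
  where
  open ≤-Reasoning
  Π₁ : ℕ → ℕ
  Π₁ k = ∏ (primes (4 ^ k)) (_+ 28)
  Π₀ : ℕ → ℕ
  Π₀ k = ∏ (primes (4 ^ k)) id
  A : ℕ
  A = Π₁ k₀
  Π₀>0 : ∀ k → 0 < Π₀ k
  Π₀>0 k = ∏-positive (primes (4 ^ k)) (λ q∈ → prime⇒>0 (proj₁ (∈-primes⁻ (4 ^ k) q∈)))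
  Π₁-suc : ∀ k → Π₁ k ≤ Π₁ (suc k)
  Π₁-suc k = begin
    Π₁ k ≡⟨ *-identityˡ _ ⟨
    1 * Π₁ k ≤⟨ *-monoˡ-≤ (Π₁ k) (∏-positive (primesIn (4 ^ k) (3 * 4 ^ k)) (λ {q} _ → ≤-trans (s≤s z≤n) (m≤n+m 28 q))) ⟩
    ∏ (primesIn (4 ^ k) (3 * 4 ^ k)) (_+ 28) * Π₁ k ≡⟨ ∏-++ (primesIn (4 ^ k) (3 * 4 ^ k)) (primes (4 ^ k)) (_+ 28) ⟨
    ∏ (primesIn (4 ^ k) (3 * 4 ^ k) ++ primes (4 ^ k)) (_+ 28) ≡⟨ cong (λ ps → ∏ ps (_+ 28)) (primes-blocks k) ⟨
    Π₁ (suc k) ∎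
  Π₁-mono : ∀ k d → Π₁ k ≤ Π₁ (d + k)
  Π₁-mono k zero    = ≤-refl
  Π₁-mono k (suc d) = ≤-trans (Π₁-mono k d) (Π₁-suc (d + k))
  small : ∀ k → k ≤ k₀ → Π₁ k ≤ A * 2 ^ k * Π₀ k
  small k k≤ = begin
    Π₁ k ≤⟨ Π₁-mono k (k₀ ∸ k) ⟩
    Π₁ (k₀ ∸ k + k) ≡⟨ cong Π₁ (m∸n+n≡m k≤) ⟩
    A ≡⟨ trans (*-identityʳ _) (*-identityʳ A) ⟨
    A * 1 * 1 ≤⟨ *-mono-≤ (*-monoʳ-≤ A (^>0 k (s≤s z≤n))) (Π₀>0 k) ⟩
    A * 2 ^ k * Π₀ k ∎
  large : ∀ i → Π₁ (i + k₀) ≤ A * 2 ^ (i + k₀) * Π₀ (i + k₀)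
  large zero    = small k₀ ≤-refl
  large (suc i) = begin
    Π₁ (suc k) ≡⟨ cong (λ ps → ∏ ps (_+ 28)) (primes-blocks k) ⟩
    ∏ (B ++ primes (4 ^ k)) (_+ 28) ≡⟨ ∏-++ B (primes (4 ^ k)) (_+ 28) ⟩
    ∏ B (_+ 28) * Π₁ k ≤⟨ *-mono-≤ (block-doubling k (≤-trans 168≤k₀ (m≤n+m k₀ i))) (large i) ⟩
    2 * ∏ B id * (A * 2 ^ k * Π₀ k) ≡⟨ lem₁ (∏ B id) A (2 ^ k) (Π₀ k) ⟩
    A * 2 ^ suc k * (∏ B id * Π₀ k) ≡⟨ cong (A * 2 ^ suc k *_) (∏-++ B (primes (4 ^ k)) id) ⟨
    A * 2 ^ suc k * ∏ (B ++ primes (4 ^ k)) id ≡⟨ cong (λ ps → A * 2 ^ suc k * ∏ ps id) (primes-blocks k) ⟨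
    A * 2 ^ suc k * Π₀ (suc k) ∎
    where
    k = i + k₀
    B = primesIn (4 ^ k) (3 * 4 ^ k)
    lem₁ : ∀ b a x c → 2 * b * (a * x * c) ≡ a * (2 * x) * (b * c)
    lem₁ = solve-∀
  bound : ∀ k → Π₁ k ≤ A * 2 ^ k * Π₀ k
  bound k with ≤-total k k₀
  ... | inj₁ k≤ = small k k≤
  ... | inj₂ ≤k = subst (λ k → Π₁ k ≤ A * 2 ^ k * Π₀ k) (m∸n+n≡m ≤k) (large (k ∸ k₀))

abstract

  ∏-primes-bound : ∃ λ A → ∀ k → ∏ (primes (4 ^ k)) (_+ 28) ≤ A * 2 ^ k * ∏ (primes (4 ^ k)) id
  ∏-primes-bound = ∏-primes-bound-from 168 ≤-refl

-- Truncated valuations and congruences.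

-- The exponent of p in q, truncated at γ.
ν : ℕ → ℕ → ℕ → ℕ
ν zero    q p = 0
ν (suc γ) q p with p ^ suc γ ∣? q
... | yes _ = suc γ
... | no  _ = ν γ q p

ν≤ : ∀ γ q p → ν γ q p ≤ γ
ν≤ zero    q p = z≤n
ν≤ (suc γ) q p with p ^ suc γ ∣? q
... | yes _ = ≤-refl
... | no  _ = m≤n⇒m≤1+n (ν≤ γ q p)

^ν∣ : ∀ γ q p → p ^ ν γ q p ∣ q
^ν∣ zero    q p = 1∣ q
^ν∣ (suc γ) q p with p ^ suc γ ∣? q
... | yes p∣q = p∣q
... | no  _   = ^ν∣ γ q p

ν-max : ∀ γ q p {a} → a ≤ γ → p ^ a ∣ q → a ≤ ν γ q p
ν-max zero    q p a≤ p∣ = a≤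
ν-max (suc γ) q p a≤ p∣ with p ^ suc γ ∣? q
... | yes _ = a≤
... | no ∤  = ν-max γ q p (s≤s⁻¹ (≤∧≢⇒< a≤ λ { refl → ∤ p∣ })) p∣

∃-prime-divisor : ∀ n → 2 ≤ n → ∃ λ p → Prime p × p ∣ n
∃-prime-divisor n 2≤n = go (factorise n {{>-nonZero (<⇒≤ 2≤n)}})
  where
  go : PrimeFactorisation n → ∃ λ p → Prime p × p ∣ n
  go record { factors = [] ; isFactorisation = refl } = ⊥-elim (<⇒≱ 2≤n ≤-refl)
  go record { factors = p ∷ ps ; isFactorisation = refl ; factorsPrime = pr All.∷ _ } = p , pr , m∣m*n _

∣∏ : ∀ {A : Set} {x : A} {xs} (f : A → ℕ) → x ∈ xs → f x ∣ ∏ xs f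
∣∏ {xs = x ∷ xs} f (here refl) = m∣m*n (∏ xs f)
∣∏ {xs = x ∷ xs} f (there x∈)  = ∣n⇒∣m*n (f x) (∣∏ f x∈)

val : List ℕ → (ℕ → ℕ) → ℕ
val ps e = ∏ ps (λ p → p ^ e p)

-- A prime `p` of a cofactor `c ≥ 2` would give `p ^ suc a ∣ q` for `a = ν γ q p`, against the
-- maximality of `a`. The truncation is harmless, since `q < 2 ^ γ` keeps all exponents below `γ`.
val-ν : ∀ γ n q → 0 < q → q ≤ n → q < 2 ^ γ → val (primes n) (ν γ q) ≡ q
val-ν γ n q 0<q q≤n q<2^γ with ∏-primesIn-∣ 0 n q (ν γ q) (λ {p} _ → ^ν∣ γ q p)
... | divides 0 refl = ⊥-elim (<-irrefl refl 0<q)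
... | divides 1 eq = sym (trans eq (*-identityˡ _))
... | divides c@(suc (suc c-2)) eq = ⊥-elim (<⇒≱ ≤-refl (ν-max γ q p (<⇒≤ (^-cancelʳ-< (≤-<-trans (^-monoˡ-≤ (suc a) (prime⇒≥2 pr)) (≤-<-trans (∣⇒≤ {{>-nonZero 0<q}} p^∣q) q<2^γ)))) p^∣q))
  where
  p = proj₁ (∃-prime-divisor c (s≤s (s≤s z≤n)))
  pr = proj₁ (proj₂ (∃-prime-divisor c (s≤s (s≤s z≤n))))
  p∣c = proj₂ (proj₂ (∃-prime-divisor c (s≤s (s≤s z≤n))))
  a = ν γ q p
  ^-cancelʳ-< : ∀ {x y} → 2 ^ x < 2 ^ y → x < y
  ^-cancelʳ-< lt = ≰⇒> λ y≤x → <⇒≱ lt (^-monoʳ-≤ 2 y≤x)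
  p∣q : p ∣ q
  p∣q = subst (p ∣_) (sym eq) (∣m⇒∣m*n (val (primes n) (ν γ q)) p∣c)
  p^∣q : p ^ suc a ∣ q
  p^∣q = subst (p ^ suc a ∣_) (sym eq)
    (*-pres-∣ p∣c (∣∏ (λ p → p ^ ν γ q p) (∈-primes⁺ n pr (≤-trans (∣⇒≤ {{>-nonZero 0<q}} p∣q) q≤n))))

∈AP? : ∀ x r q → Dec (x ∈AP r mod q)
∈AP? x r q = q ∣? ℤ.∣ x ℤ.- r ∣

∈AP-∣ : ∀ {m n} x r → m ∣ n → x ∈AP r mod n → x ∈AP r mod m
∈AP-∣ x r m∣n x∈ = ∣-trans m∣n x∈

∈AP-+⁻ : ∀ {m} x r d → m ∣ d → (x ℤ.+ ℤ.+ d) ∈AP r mod m → x ∈AP r mod m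
∈AP-+⁻ {m} x r d m∣d x∈ = ℤ.∣⇒∣ᵤ (subst (ℤ._∣_ (ℤ.+ m)) (lem x (ℤ.+ d) r)
  (ℤ.∣m∣n⇒∣m-n (ℤ.∣ᵤ⇒∣ {k = ℤ.+ m} {i = (x ℤ.+ ℤ.+ d) ℤ.- r} x∈) (ℤ.∣ᵤ⇒∣ {k = ℤ.+ m} {i = ℤ.+ d} m∣d)))
  where
  lem : ∀ x d r → (x ℤ.+ d) ℤ.- r ℤ.- d ≡ x ℤ.- r
  lem = solve-∀ᶻ

∈AP-difference : ∀ {m} x r s t → (x ℤ.+ ℤ.+ s) ∈AP r mod m → (x ℤ.+ ℤ.+ t) ∈AP r mod m → m ∣ ∣ s - t ∣
∈AP-difference {m} x r s t s∈ t∈ = subst (m ∣_) (trans (cong ℤ.∣_∣ (ℤ.[+m]-[+n]≡m⊖n s t)) (abs-⊖ s t))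
  (ℤ.∣⇒∣ᵤ (subst (ℤ._∣_ (ℤ.+ m)) (lem x (ℤ.+ s) (ℤ.+ t) r)
    (ℤ.∣m∣n⇒∣m-n (ℤ.∣ᵤ⇒∣ {k = ℤ.+ m} {i = (x ℤ.+ ℤ.+ s) ℤ.- r} s∈) (ℤ.∣ᵤ⇒∣ {k = ℤ.+ m} {i = (x ℤ.+ ℤ.+ t) ℤ.- r} t∈))))
  where
  lem : ∀ x s t r → ((x ℤ.+ s) ℤ.- r) ℤ.- ((x ℤ.+ t) ℤ.- r) ≡ s ℤ.- t
  lem = solve-∀ᶻ
  abs-⊖ : ∀ s t → ℤ.∣ s ℤ.⊖ t ∣ ≡ ∣ s - t ∣
  abs-⊖ zero    zero    = refl
  abs-⊖ zero    (suc t) = refl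
  abs-⊖ (suc s) zero    = refl
  abs-⊖ (suc s) (suc t) = trans (cong ℤ.∣_∣ (ℤ.[1+m]⊖[1+n]≡m⊖n s t)) (abs-⊖ s t)

half : ∀ n → n ≤ 2 * ⌈ n /2⌉
half n = begin
  n                    ≡⟨ ⌊n/2⌋+⌈n/2⌉≡n n ⟨
  ⌊ n /2⌋ + ⌈ n /2⌉   ≤⟨ +-mono-≤ (⌊n/2⌋≤⌈n/2⌉ n) (m≤m+n ⌈ n /2⌉ 0) ⟩
  2 * ⌈ n /2⌉          ∎
  where open ≤-Reasoning

half′ : ∀ n → 2 * ⌈ n /2⌉ ≤ suc n
half′ zero          = z≤n
half′ (suc zero)    = ≤-refl
half′ (suc (suc n)) = begin
  2 * suc ⌈ n /2⌉  ≡⟨ *-suc 2 ⌈ n /2⌉ ⟩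
  2 + 2 * ⌈ n /2⌉  ≤⟨ +-monoʳ-≤ 2 (half′ n) ⟩
  suc (suc (suc n)) ∎
  where open ≤-Reasoning

∑-odd : ∀ m → ∑ (downFrom m) (λ c → 2 * c + 1) ≡ m * m
∑-odd zero    = refl
∑-odd (suc m) rewrite ∑-odd m = lem m
  where
  lem : ∀ m → 2 * m + 1 + m * m ≡ suc m * suc m
  lem = solve-∀

-- Local weights at a single prime.

module Weights (γ : ℕ) (h : ℕ → ℕ) where

  open ≤-Reasoning

  H : ℕ → ℕ
  H p = ⌈ p ^ γ /2⌉

  -- At the stage of p the points have been kept in one class mod p ^ h p, and H p of the p ^ γ lifts of
  -- a point survive; u p c bounds how many of them lie in a given class mod p ^ c.
  u : ℕ → ℕ → ℕ
  u p zero    = H p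
  u p (suc c) = p ^ (γ ∸ (suc c ∸ h p))

  H>0 : ∀ {p} → 0 < p → 0 < H p
  H>0 {p} 0<p = n≢0⇒n>0 λ H≡0 → <⇒≱ (^>0 γ 0<p) (≤-trans (half (p ^ γ)) (≤-reflexive (cong (2 *_) H≡0)))

  u≤ : ∀ {p} → 0 < p → ∀ c → u p c ≤ p ^ γ
  u≤ 0<p zero    = ⌈n/2⌉≤n _
  u≤ 0<p (suc c) = ^-monoʳ-≤ _ {{>-nonZero 0<p}} (m∸n≤m γ (suc c ∸ h _))

  p^γ≤2H : ∀ p → p ^ γ ≤ 2 * H p
  p^γ≤2H p = half (p ^ γ)

  -- Beyond `h p` every further power of `p` thins the lifts by a factor `p`; up to `h p` the class
  -- of a lift is already decided and nothing decays. The case `c = 0` is excluded because `u p 0`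
  -- is `H p` and not `p ^ γ`.
  u-decay : ∀ {p} → 0 < p → ∀ c → 1 ≤ c → h p ≤ c → c < γ → p * u p (suc c) ≡ u p c
  u-decay {p} 0<p c@(suc _) _ h≤c c<γ = cong (p ^_) (begin-equality
    suc (γ ∸ (suc c ∸ h p))   ≡⟨ cong (λ x → suc (γ ∸ x)) (+-∸-assoc 1 h≤c) ⟩
    suc (γ ∸ suc (c ∸ h p))   ≡⟨ +-∸-assoc 1 (≤-trans (s≤s (m∸n≤m c (h p))) c<γ) ⟨
    γ ∸ (c ∸ h p)             ∎)

  -- The local factor of the second moment: two progressions with exponents `a` and `b` at `p` meet
  -- in a class modulo `p ^ (a ⊔ b)`, if at all.
  V : ℕ → ℕ
  V p = ∑ (downFrom (suc γ)) (λ a → ∑ (downFrom (suc γ)) (λ b → u p (a ⊔ b)))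

  -- Rankin's weight (3/2) ^ c, scaled by 2 ^ γ.
  rankin : ℕ → ℕ → ℕ
  rankin p c = 3 ^ c * 2 ^ (γ ∸ c) * u p c

  rankin-sum : ℕ → ℕ
  rankin-sum p = ∑ (downFrom (suc γ)) (rankin p)

  module _ {p : ℕ} (2≤p : 2 ≤ p) where

    private
      0<p : 0 < p
      0<p = <⇒≤ 2≤p

      f : ℕ → ℕ
      f c = (2 * c + 1) * u p c

    2u≤u : ∀ c → 1 ≤ c → h p ≤ c → c < γ → 2 * u p (suc c) ≤ u p c
    2u≤u c 1≤c h≤c c<γ = ≤-trans (*-monoˡ-≤ (u p (suc c)) 2≤p) (≤-reflexive (u-decay 0<p c 1≤c h≤c c<γ))

    -- From `c = 2` on, `(2 * c + 3) / (2 * c + 1)` is below `3 / 2`; together with the halving of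
    -- `u` this gives the ratio `3 / 4`. At `c = 1` it fails.
    odd-decay : ∀ c → 2 ≤ c → h p ≤ c → c < γ → 4 * f (suc c) ≤ 3 * f c
    odd-decay c 2≤c h≤c c<γ = begin
      4 * ((2 * suc c + 1) * u p (suc c))       ≡⟨ lem₁ c (u p (suc c)) ⟩
      (8 * c + 3 * 2 + 6) * u p (suc c)         ≤⟨ *-monoˡ-≤ (u p (suc c)) (+-monoˡ-≤ 6 (+-monoʳ-≤ (8 * c) (*-monoʳ-≤ 3 2≤c))) ⟩
      (8 * c + 3 * c + 6) * u p (suc c)         ≤⟨ *-monoˡ-≤ (u p (suc c)) (+-monoˡ-≤ 6 (m≤m+n (8 * c + 3 * c) c)) ⟩
      (8 * c + 3 * c + c + 6) * u p (suc c)     ≡⟨ lem₂ c (u p (suc c)) ⟩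
      3 * ((2 * c + 1) * (2 * u p (suc c)))     ≤⟨ *-monoʳ-≤ 3 (*-monoʳ-≤ (2 * c + 1) (2u≤u c (<⇒≤ 2≤c) h≤c c<γ)) ⟩
      3 * f c ∎
      where
      lem₁ : ∀ c x → 4 * ((2 * suc c + 1) * x) ≡ (8 * c + 3 * 2 + 6) * x
      lem₁ = solve-∀
      lem₂ : ∀ c x → (8 * c + 3 * c + c + 6) * x ≡ 3 * ((2 * c + 1) * (2 * x))
      lem₂ = solve-∀

    V-tail : ∀ c → 2 ≤ c → h p ≤ c → c ≤ γ → V p ≤ ∑ (downFrom (suc c)) f + 3 * f c
    V-tail c 2≤c h≤c c≤γ = begin
      V p                                  ≡⟨ ∑-⊔ (suc γ) (u p) ⟩
      ∑ (downFrom (suc γ)) f               ≡⟨ cong (λ m → ∑ (downFrom (suc m)) f) (m+[n∸m]≡n c≤γ) ⟨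
      ∑ (downFrom (suc (c + (γ ∸ c)))) f   ≤⟨ ∑-geometric f c (γ ∸ c) (λ i i< → odd-decay (c + i) (m≤n⇒m≤n+o i 2≤c) (m≤n⇒m≤n+o i h≤c)
                                                (subst (c + i <_) (m+[n∸m]≡n c≤γ) (+-monoʳ-< c i<))) ⟩
      ∑ (downFrom (suc c)) f + 3 * f c     ∎

    -- The weights are flat up to `h p`, and the odd numbers up to there sum to a square; geometric
    -- decay is available from `2 + h p` on.
    V-bound : 2 + h p ≤ γ → V p ≤ 2 * ((h p + 6) * (h p + 6)) * H p
    V-bound c≤γ = begin
      V p ≤⟨ V-tail c (m≤m+n 2 (h p)) (m≤n+m (h p) 2) c≤γ ⟩
      ∑ (downFrom (suc c)) f + 3 * f c ≤⟨ +-mono-≤ (∑-mono (downFrom (suc c)) (λ i → *-monoʳ-≤ (2 * i + 1) (u≤ 0<p i))) (*-monoʳ-≤ 3 (*-monoʳ-≤ (2 * c + 1) (u≤ 0<p c))) ⟩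
      ∑ (downFrom (suc c)) (λ i → (2 * i + 1) * n) + 3 * ((2 * c + 1) * n) ≡⟨ cong (_+ 3 * ((2 * c + 1) * n)) (trans (∑-*ʳ (downFrom (suc c)) n (λ i → 2 * i + 1)) (cong (_* n) (∑-odd (suc c)))) ⟩
      suc c * suc c * n + 3 * ((2 * c + 1) * n) ≤⟨ m≤m+n _ (12 * n) ⟩
      suc c * suc c * n + 3 * ((2 * c + 1) * n) + 12 * n ≡⟨ lem (h p) n ⟩
      (h p + 6) * (h p + 6) * n ≤⟨ *-monoʳ-≤ ((h p + 6) * (h p + 6)) (p^γ≤2H p) ⟩
      (h p + 6) * (h p + 6) * (2 * H p) ≡⟨ lem₂ ((h p + 6) * (h p + 6)) (H p) ⟩
      2 * ((h p + 6) * (h p + 6)) * H p ∎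
      where
      c = 2 + h p
      n = p ^ γ
      lem : ∀ h n → suc (2 + h) * suc (2 + h) * n + 3 * ((2 * (2 + h) + 1) * n) + 12 * n ≡ (h + 6) * (h + 6) * n
      lem = solve-∀
      lem₂ : ∀ a b → a * (2 * b) ≡ 2 * a * b
      lem₂ = solve-∀

    p*u1 : h p ≡ 0 → 1 ≤ γ → p * u p 1 ≡ p ^ γ
    p*u1 h≡0 1≤γ rewrite h≡0 = cong (p ^_) (m+[n∸m]≡n 1≤γ)

    -- Here `V p` is `H p + 3 * u p 1 + 5 * u p 2 + ...`, and all terms but the first are of order
    -- `H p / p`. Multiplied by `p` they come to at most `26 * H p`.
    V-bound₀ : h p ≡ 0 → 2 ≤ γ → p * V p ≤ (p + 28) * H p
    V-bound₀ h≡0 2≤γ = begin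
      p * V p ≤⟨ *-monoʳ-≤ p (V-tail 2 ≤-refl (≤-trans (≤-reflexive h≡0) z≤n) 2≤γ) ⟩
      p * (5 * u p 2 + (3 * u p 1 + (1 * H p + 0)) + 3 * (5 * u p 2)) ≡⟨ lem₁ p (u p 2) (u p 1) (H p) ⟩
      p * H p + (10 * (2 * (p * u p 2)) + 3 * (p * u p 1)) ≡⟨ cong (λ x → p * H p + (10 * (2 * x) + 3 * (p * u p 1))) (u-decay 0<p 1 ≤-refl (≤-trans (≤-reflexive h≡0) z≤n) 2≤γ) ⟩
      p * H p + (10 * (2 * u p 1) + 3 * (p * u p 1)) ≤⟨ +-monoʳ-≤ (p * H p) (+-monoˡ-≤ (3 * (p * u p 1)) (*-monoʳ-≤ 10 (*-monoˡ-≤ (u p 1) 2≤p))) ⟩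
      p * H p + (10 * (p * u p 1) + 3 * (p * u p 1)) ≡⟨ cong (λ x → p * H p + (10 * x + 3 * x)) (p*u1 h≡0 (<⇒≤ 2≤γ)) ⟩
      p * H p + (10 * p ^ γ + 3 * p ^ γ) ≤⟨ +-monoʳ-≤ (p * H p) (+-mono-≤ (*-monoʳ-≤ 10 (p^γ≤2H p)) (*-monoʳ-≤ 3 (p^γ≤2H p))) ⟩
      p * H p + (10 * (2 * H p) + 3 * (2 * H p)) ≤⟨ m≤m+n _ (2 * H p) ⟩
      p * H p + (10 * (2 * H p) + 3 * (2 * H p)) + 2 * H p ≡⟨ lem₂ p (H p) ⟩
      (p + 28) * H p ∎
      where
      lem₁ : ∀ p a b c → p * (5 * a + (3 * b + (1 * c + 0)) + 3 * (5 * a)) ≡ p * c + (10 * (2 * (p * a)) + 3 * (p * b))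
      lem₁ = solve-∀
      lem₂ : ∀ p a → p * a + (10 * (2 * a) + 3 * (2 * a)) + 2 * a ≡ (p + 28) * a
      lem₂ = solve-∀

    -- The growth `3 / 2` of Rankin's weight against a decay of at least `2` leaves `3 / 4`, even at
    -- `p = 2`; this is why the base has to stay below `2`.
    rankin-decay : ∀ c → 1 ≤ c → h p ≤ c → c < γ → 4 * rankin p (suc c) ≤ 3 * rankin p c
    rankin-decay c 1≤c h≤c c<γ = begin
      4 * (3 * 3 ^ c * 2 ^ (γ ∸ suc c) * u p (suc c))  ≡⟨ lem (3 ^ c) (2 ^ (γ ∸ suc c)) (u p (suc c)) ⟩
      3 * (3 ^ c * (2 ^ suc (γ ∸ suc c)) * (2 * u p (suc c))) ≤⟨ *-monoʳ-≤ 3 (*-monoʳ-≤ (3 ^ c * (2 ^ suc (γ ∸ suc c))) (2u≤u c 1≤c h≤c c<γ)) ⟩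
      3 * (3 ^ c * (2 ^ suc (γ ∸ suc c)) * u p c) ≡⟨ cong (λ x → 3 * (3 ^ c * 2 ^ x * u p c)) (+-∸-assoc 1 c<γ) ⟨
      3 * rankin p c ∎
      where
      lem : ∀ a b x → 4 * (3 * a * b * x) ≡ 3 * (a * (2 * b) * (2 * x))
      lem = solve-∀

    rankin-tail : ∀ c → 1 ≤ c → h p ≤ c → c ≤ γ → rankin-sum p ≤ ∑ (downFrom (suc c)) (rankin p) + 3 * rankin p c
    rankin-tail c 1≤c h≤c c≤γ = begin
      ∑ (downFrom (suc γ)) (rankin p)               ≡⟨ cong (λ m → ∑ (downFrom (suc m)) (rankin p)) (m+[n∸m]≡n c≤γ) ⟨
      ∑ (downFrom (suc (c + (γ ∸ c)))) (rankin p)   ≤⟨ ∑-geometric (rankin p) c (γ ∸ c) (λ i i< → rankin-decay (c + i) (m≤n⇒m≤n+o i 1≤c) (m≤n⇒m≤n+o i h≤c)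
                                                (subst (c + i <_) (m+[n∸m]≡n c≤γ) (+-monoʳ-< c i<))) ⟩
      ∑ (downFrom (suc c)) (rankin p) + 3 * rankin p c     ∎

    rankin-bound₀ : h p ≡ 0 → 1 ≤ γ → p * rankin-sum p ≤ (p + 28) * (2 ^ γ * H p)
    rankin-bound₀ h≡0 1≤γ = begin
      p * rankin-sum p ≤⟨ *-monoʳ-≤ p (rankin-tail 1 ≤-refl (≤-trans (≤-reflexive h≡0) z≤n) 1≤γ) ⟩
      p * (3 * 2 ^ (γ ∸ 1) * u p 1 + (1 * 2 ^ γ * H p + 0) + 3 * (3 * 2 ^ (γ ∸ 1) * u p 1)) ≡⟨ lem₁ p (2 ^ (γ ∸ 1)) (2 ^ γ) (u p 1) (H p) ⟩
      p * (2 ^ γ * H p) + 6 * (2 ^ suc (γ ∸ 1) * (p * u p 1)) ≡⟨ cong₂ (λ x y → p * (2 ^ γ * H p) + 6 * (2 ^ x * y)) (m+[n∸m]≡n 1≤γ) (p*u1 h≡0 1≤γ) ⟩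
      p * (2 ^ γ * H p) + 6 * (2 ^ γ * p ^ γ) ≤⟨ +-monoʳ-≤ (p * (2 ^ γ * H p)) (*-monoʳ-≤ 6 (*-monoʳ-≤ (2 ^ γ) (p^γ≤2H p))) ⟩
      p * (2 ^ γ * H p) + 6 * (2 ^ γ * (2 * H p)) ≤⟨ m≤m+n _ (16 * (2 ^ γ * H p)) ⟩
      p * (2 ^ γ * H p) + 6 * (2 ^ γ * (2 * H p)) + 16 * (2 ^ γ * H p) ≡⟨ lem₂ p (2 ^ γ) (H p) ⟩
      (p + 28) * (2 ^ γ * H p) ∎
      where
      lem₁ : ∀ p a b x y → p * (3 * a * x + (1 * b * y + 0) + 3 * (3 * a * x)) ≡ p * (b * y) + 6 * ((2 * a) * (p * x))
      lem₁ = solve-∀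
      lem₂ : ∀ p b y → p * (b * y) + 6 * (b * (2 * y)) + 16 * (b * y) ≡ (p + 28) * (b * y)
      lem₂ = solve-∀

    -- The left side starts at `108` and grows by a factor of at most `12` per step. The power of
    -- two `128 = 2 ^ 7` is convenient for the choice of parameters.
    rankin-constant : ∀ k → 2 * (6 + k) * 3 ^ (2 + k) ≤ 128 ^ suc k
    rankin-constant zero    = ≤ᵇ⇒≤ 108 128 _
    rankin-constant (suc k) = begin
      2 * (6 + suc k) * (3 * 3 ^ (2 + k)) ≤⟨ m≤m+n _ (6 * (3 ^ (2 + k) * (17 + 3 * k))) ⟩
      2 * (6 + suc k) * (3 * 3 ^ (2 + k)) + 6 * (3 ^ (2 + k) * (17 + 3 * k)) ≡⟨ lem k (3 ^ (2 + k)) ⟩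
      12 * (2 * (6 + k) * 3 ^ (2 + k)) ≤⟨ *-mono-≤ (≤ᵇ⇒≤ 12 128 _) (rankin-constant k) ⟩
      128 * 128 ^ suc k ∎
      where
      lem : ∀ k x → 2 * (6 + suc k) * (3 * x) + 6 * (x * (17 + 3 * k)) ≡ 12 * (2 * (6 + k) * x)
      lem = solve-∀

    rankin-bound₊ : 0 < h p → 1 + h p ≤ γ → rankin-sum p ≤ 128 ^ h p * (2 ^ γ * H p)
    rankin-bound₊ 0<h c≤γ = begin
      rankin-sum p ≤⟨ rankin-tail c (s≤s z≤n) (n≤1+n _) c≤γ ⟩
      ∑ (downFrom (suc c)) (rankin p) + 3 * rankin p c ≤⟨ +-mono-≤ (∑-bound (downFrom (suc c)) (λ {i} i∈ → g≤ i (s≤s⁻¹ (∈-downFrom⁻ i∈)))) (*-monoʳ-≤ 3 (g≤ c ≤-refl)) ⟩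
      length (downFrom (suc c)) * B + 3 * B ≡⟨ cong (λ x → x * B + 3 * B) (length-downFrom (suc c)) ⟩
      suc c * B + 3 * B ≡⟨ lem₁ (h p) (3 ^ c) (2 ^ γ) (p ^ γ) ⟩
      (5 + h p) * 3 ^ c * (2 ^ γ * p ^ γ) ≤⟨ *-monoʳ-≤ ((5 + h p) * 3 ^ c) (*-monoʳ-≤ (2 ^ γ) (p^γ≤2H p)) ⟩
      (5 + h p) * 3 ^ c * (2 ^ γ * (2 * H p)) ≡⟨ lem₂ (5 + h p) (3 ^ c) (2 ^ γ) (H p) ⟩
      2 * (5 + h p) * 3 ^ c * (2 ^ γ * H p) ≤⟨ *-monoˡ-≤ (2 ^ γ * H p) (constant (h p) 0<h) ⟩
      128 ^ h p * (2 ^ γ * H p) ∎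
      where
      c = 1 + h p
      B = 3 ^ c * 2 ^ γ * p ^ γ
      constant : ∀ h → 0 < h → 2 * (5 + h) * 3 ^ (1 + h) ≤ 128 ^ h
      constant (suc k) _ = subst (λ x → 2 * x * 3 ^ (2 + k) ≤ 128 ^ suc k) (sym (+-suc 5 k)) (rankin-constant k)
      g≤ : ∀ i → i ≤ c → rankin p i ≤ B
      g≤ i i≤c = *-mono-≤ (*-mono-≤ (^-monoʳ-≤ 3 i≤c) (^-monoʳ-≤ 2 (m∸n≤m γ i))) (u≤ 0<p i)
      lem₁ : ∀ h a b x → suc (1 + h) * (a * b * x) + 3 * (a * b * x) ≡ (5 + h) * a * (b * x)
      lem₁ = solve-∀
      lem₂ : ∀ k a b y → k * a * (b * (2 * y)) ≡ 2 * k * a * (b * y)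
      lem₂ = solve-∀

-- Lifting a list of points through one prime.

∈-take : {A : Set} {x : A} (n : ℕ) (xs : List A) → x ∈ take n xs → x ∈ xs
∈-take (suc n) (y ∷ xs) (here eq)  = here eq
∈-take (suc n) (y ∷ xs) (there x∈) = there (∈-take n xs x∈)

module Points (γ : ℕ) (h : ℕ → ℕ) where

  open Weights γ h

  Bounded : (ℕ → ℕ) → Set
  Bounded v = ∀ p → v p ≤ γ

  InClasses : List ℕ → (v w : ℕ → ℕ) → (r s : ℤ) → ℤ → Set
  InClasses ps v w r s x = (x ∈AP r mod val ps v) × (x ∈AP s mod val ps w)

  inClasses? : ∀ ps v w r s x → Dec (InClasses ps v w r s x)
  inClasses? ps v w r s x = ∈AP? x r (val ps v) ×-dec ∈AP? x s (val ps w)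

  -- Pairs of classes are needed for the second moment.
  Spread : List ℕ → List ℤ → Set
  Spread ps L = ∀ v w → Bounded v → Bounded w → ∀ r s →
    ∑ L (λ x → 𝟙 (inClasses? ps v w r s x)) ≤ ∏ ps (λ p → u p (v p ⊔ w p))

  module Step {p : ℕ} (pr : Prime p) (ps : List ℕ) {Q Q′ : ℕ} (Q≡ : Q ≡ p ^ h p * Q′) (p∤Q′ : ¬ p ∣ Q′)
    (val∣Q : ∀ v → Bounded v → val ps v ∣ Q) where

    -- Since `Q` contains `p` exactly `h p` times, the lifts agree modulo `p ^ h p` and run once
    -- through all extensions modulo `p ^ (h p + γ)`. At the earlier primes they look like `x`.
    lift : ℤ → ℕ → ℤ
    lift x t = x ℤ.+ ℤ.+ (Q * t)

    n : ℕ
    n = p ^ γ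

    p^∣Q*⇒∣ : ∀ c d → p ^ c ∣ Q * d → p ^ (c ∸ h p) ∣ d
    p^∣Q*⇒∣ c d p^∣ with ≤-total c (h p)
    ... | inj₁ c≤h rewrite m≤n⇒m∸n≡0 c≤h = 1∣ d
    ... | inj₂ h≤c = prime^∣*⇒∣ pr Q′ (c ∸ h p) d p∤Q′ (*-cancelˡ-∣ (p ^ h p) {{>-nonZero (^>0 (h p) (prime⇒>0 pr))}}
          (subst₂ _∣_ (^-∸-split p h≤c) (trans (cong (_* d) Q≡) (*-assoc (p ^ h p) Q′ d)) p^∣))

    count-lifts : ∀ {P : ℕ → Set} (P? : ∀ t → Dec (P t)) c → c ≤ γ →
      (∀ {s t} → P s → P t → p ^ c ∣ Q * ∣ s - t ∣) → ∑ (downFrom n) (λ t → 𝟙 (P? t)) ≤ p ^ (γ ∸ (c ∸ h p))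
    count-lifts P? c c≤γ close = subst (λ m → ∑ (downFrom m) (λ t → 𝟙 (P? t)) ≤ p ^ (γ ∸ (c ∸ h p)))
      (sym (^-∸-split p (≤-trans (m∸n≤m c (h p)) c≤γ)))
      (count-class P? (p ^ (c ∸ h p)) (p ^ (γ ∸ (c ∸ h p))) (^>0 (c ∸ h p) (prime⇒>0 pr))
        (λ {s} {t} a b → p^∣Q*⇒∣ c ∣ s - t ∣ (close a b)))

    lifts-close : ∀ {m} x r {s t} → lift x s ∈AP r mod m → lift x t ∈AP r mod m → m ∣ Q * ∣ s - t ∣
    lifts-close {m} x r {s} {t} s∈ t∈ = subst (m ∣_) (sym (*-distribˡ-∣-∣ Q s t)) (∈AP-difference x r (Q * s) (Q * t) s∈ t∈)

    lift-∈AP⁻ : ∀ {m} x r t → m ∣ Q → lift x t ∈AP r mod m → x ∈AP r mod m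
    lift-∈AP⁻ {m} x r t m∣Q = ∈AP-+⁻ {m} x r (Q * t) (∣m⇒∣m*n t m∣Q)

    -- As `val ps v` and `val ps w` divide `Q`, a lift can lie in the two classes only if `x` lies
    -- in their coarser versions. At `p` the larger exponent then fixes `t` modulo a power of `p`.
    lift-spread : ∀ v w → Bounded v → Bounded w → ∀ r s x →
      ∑ (downFrom n) (λ t → 𝟙 (inClasses? (p ∷ ps) v w r s (lift x t))) ≤
      𝟙 (inClasses? ps v w r s x) * p ^ (γ ∸ ((v p ⊔ w p) ∸ h p))
    lift-spread v w v≤ w≤ r s x with inClasses? ps v w r s x
    ... | yes _ = ≤-trans (count-lifts (λ t → inClasses? (p ∷ ps) v w r s (lift x t)) (v p ⊔ w p) (⊔-lub (v≤ p) (w≤ p)) close)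
                          (≤-reflexive (sym (*-identityˡ _)))
      where
      close : ∀ {t t′} → InClasses (p ∷ ps) v w r s (lift x t) → InClasses (p ∷ ps) v w r s (lift x t′) → p ^ (v p ⊔ w p) ∣ Q * ∣ t - t′ ∣
      close {t} {t′} (a , b) (a′ , b′) with ⊔-sel (v p) (w p)
      ... | inj₁ eq rewrite eq = m*n∣⇒m∣ (p ^ v p) (val ps v) (lifts-close x r {t} {t′} a a′)
      ... | inj₂ eq rewrite eq = m*n∣⇒m∣ (p ^ w p) (val ps w) (lifts-close x s {t} {t′} b b′)
    ... | no ¬c = ≤-reflexive (trans (∑-cong (downFrom n) (λ t → 𝟙-false (inClasses? (p ∷ ps) v w r s (lift x t)) (¬c ∘ descend t)))
                                     (∑-zero (downFrom n)))
      where
      descend : ∀ t → InClasses (p ∷ ps) v w r s (lift x t) → InClasses ps v w r s x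
      descend t (a , b) = lift-∈AP⁻ x r t (val∣Q v v≤) (m*n∣⇒n∣ (p ^ v p) (val ps v) a)
                        , lift-∈AP⁻ x s t (val∣Q w w≤) (m*n∣⇒n∣ (p ^ w p) (val ps w) b)

    module Select {Bad : ℤ → Set} (Bad? : ∀ x → Dec (Bad x)) where

      good : ℤ → List ℕ
      good x = filter (λ t → ¬? (Bad? (lift x t))) (downFrom n)

      -- Truncating to `H p` lifts yields the upper bound `u p 0`; dropping points with fewer leaves
      -- exactly `H p` lifts of every other point.
      select : ℤ → List ℤ
      select x with H p ≤? length (good x)
      ... | yes _ = map (lift x) (take (H p) (good x))
      ... | no  _ = []

      next : List ℤ → List ℤ
      next = concatMap select

      ∑-select≤ : ∀ x (f : ℤ → ℕ) → ∑ (select x) f ≤ ∑ (downFrom n) (f ∘ lift x)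
      ∑-select≤ x f with H p ≤? length (good x)
      ... | yes _ = ≤-trans (≤-reflexive (∑-map (lift x) (take (H p) (good x)) f))
                      (≤-trans (∑-take≤ (H p) (good x) _) (∑-filter≤ (λ t → ¬? (Bad? (lift x t))) (downFrom n) _))
      ... | no  _ = z≤n

      length-select≤ : ∀ x → length (select x) ≤ H p
      length-select≤ x with H p ≤? length (good x)
      ... | yes _ = ≤-trans (≤-reflexive (trans (length-map (lift x) (take (H p) (good x))) (length-take (H p) (good x)))) (m⊓n≤m _ _)
      ... | no  _ = z≤n

      ∈-select⁻ : ∀ {x y} → y ∈ select x → ∃ λ t → y ≡ lift x t × ¬ Bad y
      ∈-select⁻ {x} y∈ with H p ≤? length (good x)
      ... | yes _ with ∈-map⁻ (lift x) y∈
      ...   | t , t∈ , refl = t , refl , proj₂ (∈-filter⁻ (λ t → ¬? (Bad? (lift x t))) {xs = downFrom n} (∈-take (H p) (good x) t∈))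

      ∈-next⁻ : ∀ {L y} → y ∈ next L → ∃ λ x → ∃ λ t → x ∈ L × y ≡ lift x t × ¬ Bad y
      ∈-next⁻ {x ∷ L} y∈ with ∈-++⁻ (select x) y∈
      ... | inj₁ y∈x = let t , eq , ¬b = ∈-select⁻ y∈x in x , t , here refl , eq , ¬b
      ... | inj₂ y∈L = let x , t , x∈ , eq , ¬b = ∈-next⁻ {L} y∈L in x , t , there x∈ , eq , ¬b

      spread-next : ∀ {L} → Spread ps L → Spread (p ∷ ps) (next L)
      spread-next {L} sp v w v≤ w≤ r s = begin
        ∑ (next L) F
          ≡⟨ ∑-concatMap select L F ⟩
        ∑ L (λ x → ∑ (select x) F)
          ≤⟨ ∑-mono L point ⟩
        ∑ L (λ x → 𝟙 (inClasses? ps v w r s x) * u p (v p ⊔ w p))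
          ≡⟨ ∑-*ʳ L (u p (v p ⊔ w p)) _ ⟩
        ∑ L (λ x → 𝟙 (inClasses? ps v w r s x)) * u p (v p ⊔ w p)
          ≤⟨ *-monoˡ-≤ (u p (v p ⊔ w p)) (sp v w v≤ w≤ r s) ⟩
        ∏ ps (λ p → u p (v p ⊔ w p)) * u p (v p ⊔ w p)
          ≡⟨ *-comm (∏ ps (λ p → u p (v p ⊔ w p))) _ ⟩
        u p (v p ⊔ w p) * ∏ ps (λ p → u p (v p ⊔ w p)) ∎
        where
        open ≤-Reasoning
        F : ℤ → ℕ
        F y = 𝟙 (inClasses? (p ∷ ps) v w r s y)
        point : ∀ x → ∑ (select x) F ≤ 𝟙 (inClasses? ps v w r s x) * u p (v p ⊔ w p)
        point x with v p ⊔ w p | lift-spread v w v≤ w≤ r s x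
        ... | suc c | bound = ≤-trans (∑-select≤ x F) bound
        -- Without a condition at `p`, counting all `p ^ γ` lifts would lose a factor `2` at every
        -- such prime; only the number of selected lifts gives `H p`.
        ... | zero  | _ with inClasses? ps v w r s x
        ...   | yes _ = ≤-trans (∑-mono (select x) (λ y → 𝟙≤1 (inClasses? (p ∷ ps) v w r s y)))
                          (≤-trans (≤-reflexive (∑-one (select x))) (≤-trans (length-select≤ x) (≤-reflexive (sym (*-identityˡ (H p))))))
        ...   | no ¬c = ≤-reflexive (vanish (select x) (λ y∈ → let t , eq , _ = ∈-select⁻ y∈ in λ c → ¬c (descend t (subst (InClasses (p ∷ ps) v w r s) eq c))))
          where
          descend : ∀ t → InClasses (p ∷ ps) v w r s (lift x t) → InClasses ps v w r s x
          descend t (a , b) = lift-∈AP⁻ x r t (val∣Q v v≤) (m*n∣⇒n∣ (p ^ v p) (val ps v) a)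
                            , lift-∈AP⁻ x s t (val∣Q w w≤) (m*n∣⇒n∣ (p ^ w p) (val ps w) b)
          vanish : ∀ ys → (∀ {y} → y ∈ ys → ¬ InClasses (p ∷ ps) v w r s y) → ∑ ys F ≡ 0
          vanish []       h = refl
          vanish (y ∷ ys) h = cong₂ _+_ (𝟙-false (inClasses? (p ∷ ps) v w r s y) (h (here refl))) (vanish ys (h ∘ there))

      -- A dropped point has β x ≥ n / 4, so the loss is controlled by the second moment of β.
      next-length : ∀ L (β : ℤ → ℕ) → (∀ {x} → x ∈ L → 4 * ∑ (downFrom n) (λ t → 𝟙 (Bad? (lift x t))) ≤ n + 4 * β x) →
        H p * (n * n) * length L ≤ n * n * length (next L) + 16 * H p * ∑ L (λ x → β x * β x)
      next-length []      β hyp = ≤-trans (≤-reflexive (*-zeroʳ (H p * (n * n)))) z≤n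
      next-length (x ∷ L) β hyp = begin
        H p * (n * n) * suc (length L)
          ≡⟨ *-suc (H p * (n * n)) (length L) ⟩
        H p * (n * n) + H p * (n * n) * length L
          ≤⟨ +-mono-≤ point (next-length L β (hyp ∘ there)) ⟩
        n * n * length (select x) + 16 * H p * (β x * β x) + (n * n * length (next L) + 16 * H p * ∑ L (λ x → β x * β x))
          ≡⟨ lem (n * n) (length (select x)) (16 * H p) (β x * β x) (length (next L)) (∑ L (λ x → β x * β x)) ⟩
        n * n * (length (select x) + length (next L)) + 16 * H p * (β x * β x + ∑ L (λ x → β x * β x))
          ≡⟨ cong (λ l → n * n * l + 16 * H p * (β x * β x + ∑ L (λ x → β x * β x))) (length-++ (select x)) ⟨
        n * n * length (next (x ∷ L)) + 16 * H p * ∑ (x ∷ L) (λ x → β x * β x) ∎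
        where
        open ≤-Reasoning
        lem : ∀ m a c b a′ b′ → m * a + c * b + (m * a′ + c * b′) ≡ m * (a + a′) + c * (b + b′)
        lem = solve-∀
        total : n ≡ ∑ (downFrom n) (λ t → 𝟙 (Bad? (lift x t))) + length (good x)
        total = begin-equality
          n ≡⟨ length-downFrom n ⟨
          length (downFrom n) ≡⟨ ∑-one (downFrom n) ⟨
          ∑ (downFrom n) (λ _ → 1) ≡⟨ ∑-cong (downFrom n) (λ t → split (Bad? (lift x t))) ⟩
          ∑ (downFrom n) (λ t → 𝟙 (Bad? (lift x t)) + 𝟙 (¬? (Bad? (lift x t)))) ≡⟨ ∑-+ (downFrom n) _ _ ⟩
          ∑ (downFrom n) (λ t → 𝟙 (Bad? (lift x t))) + ∑ (downFrom n) (λ t → 𝟙 (¬? (Bad? (lift x t)))) ≡⟨ cong (λ l → ∑ (downFrom n) (λ t → 𝟙 (Bad? (lift x t))) + l) (length-filter≡ (λ t → ¬? (Bad? (lift x t))) (downFrom n)) ⟨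
          ∑ (downFrom n) (λ t → 𝟙 (Bad? (lift x t))) + length (good x) ∎
          where
          split : ∀ {P : Set} (P? : Dec P) → 1 ≡ 𝟙 P? + 𝟙 (¬? P?)
          split (yes _) = refl
          split (no _)  = refl
        n≤4β : length (good x) < H p → n ≤ 4 * β x
        n≤4β lt = +-cancelˡ-≤ (3 * n) _ _ (begin
          3 * n + n             ≡⟨ lem₁ n ⟩
          4 * n                 ≡⟨ cong (4 *_) total ⟩
          4 * (b + g)           ≡⟨ lem₂ b g ⟩
          4 * b + 2 * (2 * g)   ≤⟨ +-mono-≤ (hyp (here refl)) (*-monoʳ-≤ 2 2g≤n) ⟩
          n + 4 * β x + 2 * n   ≡⟨ lem₃ n (β x) ⟩
          3 * n + 4 * β x       ∎)
          where
          b = ∑ (downFrom n) (λ t → 𝟙 (Bad? (lift x t)))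
          g = length (good x)
          lem₁ : ∀ n → 3 * n + n ≡ 4 * n
          lem₁ = solve-∀
          lem₂ : ∀ b g → 4 * (b + g) ≡ 4 * b + 2 * (2 * g)
          lem₂ = solve-∀
          lem₃ : ∀ n y → n + 4 * y + 2 * n ≡ 3 * n + 4 * y
          lem₃ = solve-∀
          2g≤n : 2 * g ≤ n
          2g≤n = ≤-trans (n≤1+n _) (s≤s⁻¹ (≤-trans (≤-reflexive (sym (*-suc 2 g))) (≤-trans (*-monoʳ-≤ 2 lt) (half′ n))))
        lem₄ : ∀ a y → a * ((4 * y) * (4 * y)) ≡ 16 * a * (y * y)
        lem₄ = solve-∀
        point : H p * (n * n) ≤ n * n * length (select x) + 16 * H p * (β x * β x)
        point with H p ≤? length (good x)
        ... | yes H≤ = ≤-trans (≤-reflexive (trans (*-comm (H p) (n * n))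
              (cong (n * n *_) (sym (trans (length-map (lift x) (take (H p) (good x))) (trans (length-take (H p) (good x)) (m≤n⇒m⊓n≡m H≤)))))))
              (m≤m+n _ _)
        ... | no H≰ = begin
          H p * (n * n)                        ≤⟨ *-monoʳ-≤ (H p) (*-mono-≤ (n≤4β (≰⇒> H≰)) (n≤4β (≰⇒> H≰))) ⟩
          H p * ((4 * β x) * (4 * β x))        ≡⟨ lem₄ (H p) (β x) ⟩
          16 * H p * (β x * β x)               ≤⟨ m≤n+m _ _ ⟩
          n * n * 0 + 16 * H p * (β x * β x)   ∎

-- The sieve: its invariant, one stage and the second moment.

∈AP-+⁺ : ∀ {m} x r d → m ∣ d → x ∈AP r mod m → (x ℤ.+ ℤ.+ d) ∈AP r mod m
∈AP-+⁺ {m} x r d m∣d x∈ = ℤ.∣⇒∣ᵤ (subst (ℤ._∣_ (ℤ.+ m)) (lem x (ℤ.+ d) r)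
  (ℤ.∣m∣n⇒∣m+n (ℤ.∣ᵤ⇒∣ {k = ℤ.+ m} {i = x ℤ.- r} x∈) (ℤ.∣ᵤ⇒∣ {k = ℤ.+ m} {i = ℤ.+ d} m∣d)))
  where
  lem : ∀ x d r → (x ℤ.- r) ℤ.+ d ≡ (x ℤ.+ d) ℤ.- r
  lem = solve-∀ᶻ

^-∣ : ∀ p {a b} → a ≤ b → p ^ a ∣ p ^ b
^-∣ p {a} {b} a≤b = subst (p ^ a ∣_) (sym (^-∸-split p a≤b)) (m∣m*n (p ^ (b ∸ a)))

∏-∣ : {A : Set} (xs : List A) {f g : A → ℕ} → (∀ x → f x ∣ g x) → ∏ xs f ∣ ∏ xs g
∏-∣ []       h = ∣-refl
∏-∣ (x ∷ xs) h = *-pres-∣ (h x) (∏-∣ xs h)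

prime∤val : ∀ {p} → Prime p → (ps : List ℕ) (e : ℕ → ℕ) → (∀ {q} → q ∈ ps → Prime q × p ≢ q) → ¬ p ∣ val ps e
prime∤val pr ps e h = prime∤∏ pr ps (λ q → q ^ e q) λ {q} q∈ p∣ →
  proj₂ (h q∈) (prime∣prime⇒≡ pr (proj₁ (h q∈)) (prime∣^⇒∣ pr q (e q) p∣))

val-split : ∀ a n (e : ℕ → ℕ) {p} → p ∈ primesIn a n → ∃ λ r → val (primesIn a n) e ≡ p ^ e p * r × ¬ p ∣ r
val-split a zero    e ()
val-split a (suc n) e {p} p∈ with prime? (suc (a + n)) | p∈
... | no  _  | p∈′ = val-split a n e p∈′
... | yes pr | here refl = val (primesIn a n) e , refl , prime∤val pr (primesIn a n) e λ q∈ →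
        let qr , _ , q≤ = ∈-primesIn⁻ a n q∈ in qr , λ { refl → <-irrefl refl q≤ }
... | yes pr | there p∈′ = let r , eq , p∤r = val-split a n e p∈′ in
        t ^ e t * r , trans (cong (t ^ e t *_) eq) (lem (t ^ e t) (p ^ e p) r) , p∤ p∈′ p∤r
  where
  t = suc (a + n)
  lem : ∀ a b c → a * (b * c) ≡ b * (a * c)
  lem = solve-∀
  p∤ : ∀ {p r} → p ∈ primesIn a n → ¬ p ∣ r → ¬ p ∣ t ^ e t * r
  p∤ {p} {r} p∈ p∤r p∣ with euclidsLemma (t ^ e t) r (proj₁ (∈-primesIn⁻ a n p∈)) p∣
  ... | inj₂ p∣r = p∤r p∣r
  ... | inj₁ p∣t with ∈-primesIn⁻ a n p∈
  ...   | qr , _ , p≤ with prime∣prime⇒≡ qr pr (prime∣^⇒∣ qr t (e t) p∣t)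
  ...     | refl = <-irrefl refl p≤

module Sieve (γ : ℕ) (h : ℕ → ℕ) (R : ℕ) (x₀ : ℤ)
  (ds : List (ℕ × ℕ × ℤ)) (ds≤γ : ∀ {p a r} → (p , a , r) ∈ ds → a ≤ γ)
  {I : Set} (r : I → ℤ) (q : I → ℕ) where

  open Weights γ h public
  open Points γ h public

  -- All primes up to `R` enter from the outset, so that lifting at one prime keeps the points
  -- congruent to `x₀` at the primes still to come.
  M : ℕ
  M = val (primes R) h

  Q : ℕ → ℕ
  Q n = M * val (primes n) (λ _ → γ)

  Hit : I → ℤ → Set
  Hit i x = x ∈AP r i mod q i

  hit? : ∀ i x → Dec (Hit i x)
  hit? i x = ∈AP? x (r i) (q i)

  -- Exponents up to `h p` need no exclusion: a point congruent to `x₀` modulo `p ^ h p` avoids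
  -- those classes because `x₀` does.
  Relevant : ℕ → ℕ × ℕ × ℤ → Set
  Relevant p (p′ , a , _) = p′ ≡ p × h p < a

  relevant? : ∀ p d → Dec (Relevant p d)
  relevant? p (p′ , a , _) = p′ ≟ p ×-dec h p <? a

  Forbids : ℕ → ℤ → ℕ × ℕ × ℤ → Set
  Forbids p x d@(_ , a , s) = Relevant p d × x ∈AP s mod (p ^ a)

  forbids? : ∀ p x d → Dec (Forbids p x d)
  forbids? p x d@(_ , a , s) = relevant? p d ×-dec ∈AP? x s (p ^ a)

  Forbidden : ℕ → ℤ → Set
  Forbidden p x = Any (Forbids p x) ds

  cost : ℕ → ℕ
  cost p = ∑ ds (λ d → 𝟙 (relevant? p d) * p ^ (γ ∸ (proj₁ (proj₂ d) ∸ h p)))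

  record Inv (n : ℕ) (L : List ℤ) : Set where
    field
      spread   : Spread (primes n) L
      anchored : ∀ {x} → x ∈ L → x ∈AP x₀ mod M
      allowed  : ∀ {x p} → x ∈ L → p ∈ primes n → ¬ Forbidden p x

  -- An equation instead of a statement about prime factors: `subst` along it turns membership
  -- modulo `q i` into membership modulo a product of prime powers, as `Spread` requires.
  smooth : ℕ → I → Set
  smooth n i = val (primes n) (ν γ (q i)) ≡ q i

  smooth? : ∀ n i → Dec (smooth n i)
  smooth? n i = val (primes n) (ν γ (q i)) ≟ q i

  val∣Q : ∀ n v → Bounded v → val (primes n) v ∣ Q n
  val∣Q n v v≤ = ∣n⇒∣m*n M (∏-∣ (primes n) (λ p → ^-∣ p (v≤ p)))

  𝟙-any : {A : Set} {P : A → Set} (P? : ∀ x → Dec (P x)) (xs : List A) → 𝟙 (any? P? xs) ≤ ∑ xs (λ x → 𝟙 (P? x))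
  𝟙-any P? xs with any? P? xs
  ... | no  _ = z≤n
  ... | yes p = go xs p
    where
    go : ∀ xs → Any _ xs → 1 ≤ ∑ xs (λ x → 𝟙 (P? x))
    go (x ∷ xs) (here px)  = ≤-trans (≤-reflexive (sym (𝟙-true (P? x) px))) (m≤m+n _ _)
    go (x ∷ xs) (there p) = ≤-trans (go xs p) (m≤n+m _ _)

  𝟙-⊎ : {A B : Set} (A? : Dec A) (B? : Dec B) → 𝟙 (A? ⊎-dec B?) ≤ 𝟙 A? + 𝟙 B?
  𝟙-⊎ (yes _) _       = s≤s z≤n
  𝟙-⊎ (no _)  (yes _) = ≤-refl
  𝟙-⊎ (no _)  (no _)  = z≤n

  module Stage (n : ℕ) (pr : Prime (suc n)) (p≤R : suc n ≤ R) (pays : 4 * cost (suc n) ≤ suc n ^ γ)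
    (J : List I) (J-smooth : ∀ {i} → i ∈ J → val (suc n ∷ primes n) (ν γ (q i)) ≡ q i) where

    p : ℕ
    p = suc n

    Qsplit : ∃ λ Q′ → Q n ≡ p ^ h p * Q′ × ¬ p ∣ Q′
    Qsplit with val-split 0 R h (∈-primes⁺ R pr p≤R)
    ... | m , eq , p∤m = m * val (primes n) (λ _ → γ) , trans (cong (_* val (primes n) (λ _ → γ)) eq) (*-assoc (p ^ h p) m _) , p∤
      where
      p∤ : ¬ p ∣ m * val (primes n) (λ _ → γ)
      p∤ p∣ with euclidsLemma m _ pr p∣
      ... | inj₁ p∣m = p∤m p∣m
      ... | inj₂ p∣v = prime∤val pr (primes n) (λ _ → γ) (λ q∈ → let qr , q≤ = ∈-primes⁻ n q∈ in qr , λ { refl → <-irrefl refl q≤ }) p∣v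

    open Step pr (primes n) (proj₁ (proj₂ Qsplit)) (proj₂ (proj₂ Qsplit)) (val∣Q n) renaming (n to pᵞ)

    Bad : ℤ → Set
    Bad x = Forbidden p x ⊎ Any (λ i → Hit i x) J

    Bad? : ∀ x → Dec (Bad x)
    Bad? x = any? (forbids? p x) ds ⊎-dec any? (λ i → hit? i x) J

    open Select Bad? public using (next)
    open Select Bad? using (spread-next; ∈-next⁻; next-length)

    -- A modulus dividing `Q n` cannot tell a lift from its parent, so whatever the parent avoids at
    -- such a modulus stays avoided.
    next-hereditary : ∀ {L y} → y ∈ next L → ∃ λ x → x ∈ L × (∀ {m} s → m ∣ Q n → y ∈AP s mod m → x ∈AP s mod m)
    next-hereditary {L} y∈ with ∈-next⁻ {L} y∈
    ... | x , t , x∈ , refl , _ = x , x∈ , λ s m∣Q → ∈AP-+⁻ x s (Q n * t) (∣m⇒∣m*n t m∣Q)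

    next-avoids : ∀ {L y i} → y ∈ next L → i ∈ J → ¬ Hit i y
    next-avoids {L} y∈ i∈ hit with ∈-next⁻ {L} y∈
    ... | _ , _ , _ , _ , ¬bad = ¬bad (inj₂ (Any.map (λ { refl → hit }) i∈))

    next-inv : ∀ {L} → Inv n L → Inv (suc n) (next L)
    next-inv {L} inv = record { spread = sp ; anchored = anc ; allowed = λ y∈ p∈ → al y∈ (cases p∈) }
      where
      open Inv inv
      primes-suc : primes (suc n) ≡ suc n ∷ primes n
      primes-suc with prime? (suc n)
      ... | yes _ = refl
      ... | no ¬pr = ⊥-elim (¬pr pr)
      cases : ∀ {p′} → p′ ∈ primes (suc n) → p′ ∈ suc n ∷ primes n
      cases = subst (_ ∈_) primes-suc
      sp : Spread (primes (suc n)) (next L)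
      sp = subst (λ ps → Spread ps (next L)) (sym primes-suc) (spread-next {L} spread)
      anc : ∀ {y} → y ∈ next L → y ∈AP x₀ mod M
      anc y∈ with ∈-next⁻ {L} y∈
      ... | x , t , x∈ , refl , _ = ∈AP-+⁺ x x₀ (Q n * t) (∣m⇒∣m*n t (m∣m*n _)) (anchored x∈)
      al : ∀ {y p′} → y ∈ next L → p′ ∈ suc n ∷ primes n → ¬ Forbidden p′ y
      al y∈ (here refl) f with ∈-next⁻ {L} y∈
      ... | _ , _ , _ , _ , ¬bad = ¬bad (inj₁ f)
      al {y} {p′} y∈ (there p∈) f with next-hereditary {L} y∈
      ... | x , x∈ , back = allowed x∈ p∈ (transfer ds id f)
        where
        transfer : ∀ es → (∀ {d} → d ∈ es → d ∈ ds) → Any (Forbids p′ y) es → Any (Forbids p′ x) es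
        transfer (d ∷ es) ⊆ (here (c , y∈AP)) = here (c , back _ (∣-trans (^-∣ p′ (ds≤γ (⊆ (here refl)))) (∣-trans (∣∏ (λ p → p ^ γ) p∈) (∣n⇒∣m*n M ∣-refl))) y∈AP)
        transfer (d ∷ es) ⊆ (there f) = there (transfer es (⊆ ∘ there) f)

    -- Bounds the hits of `J` among the lifts of `x`: a progression can hit a lift only if `x`
    -- already lies in it modulo the part of `q i` made of smaller primes.
    β : ℤ → ℕ
    β x = ∑ J (λ i → 𝟙 (∈AP? x (r i) (val (primes n) (ν γ (q i)))) * p ^ (γ ∸ (ν γ (q i) p ∸ h p)))

    few-bad : ∀ x → 4 * ∑ (downFrom pᵞ) (λ t → 𝟙 (Bad? (lift x t))) ≤ pᵞ + 4 * β x
    few-bad x = begin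
      4 * ∑ (downFrom pᵞ) (λ t → 𝟙 (Bad? (lift x t)))
        ≤⟨ *-monoʳ-≤ 4 (∑-mono (downFrom pᵞ) (λ t → ≤-trans (𝟙-⊎ (any? (forbids? p (lift x t)) ds) (any? (λ i → hit? i (lift x t)) J))
             (+-mono-≤ (𝟙-any (forbids? p (lift x t)) ds) (𝟙-any (λ i → hit? i (lift x t)) J)))) ⟩
      4 * ∑ (downFrom pᵞ) (λ t → ∑ ds (λ d → 𝟙 (forbids? p (lift x t) d)) + ∑ J (λ i → 𝟙 (hit? i (lift x t))))
        ≡⟨ cong (4 *_) (trans (∑-+ (downFrom pᵞ) _ _) (cong₂ _+_ (∑-swap (downFrom pᵞ) ds _) (∑-swap (downFrom pᵞ) J _))) ⟩
      4 * (∑ ds (λ d → ∑ (downFrom pᵞ) (λ t → 𝟙 (forbids? p (lift x t) d))) + ∑ J (λ i → ∑ (downFrom pᵞ) (λ t → 𝟙 (hit? i (lift x t)))))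
        ≤⟨ *-monoʳ-≤ 4 (+-mono-≤ (∑-mono∈ ds forbidden) (∑-mono∈ J hits)) ⟩
      4 * (cost p + β x)
        ≡⟨ *-distribˡ-+ 4 (cost p) (β x) ⟩
      4 * cost p + 4 * β x
        ≤⟨ +-monoˡ-≤ (4 * β x) pays ⟩
      pᵞ + 4 * β x ∎
      where
      open ≤-Reasoning
      forbidden : ∀ {d} → d ∈ ds → ∑ (downFrom pᵞ) (λ t → 𝟙 (forbids? p (lift x t) d)) ≤
                  𝟙 (relevant? p d) * p ^ (γ ∸ (proj₁ (proj₂ d) ∸ h p))
      forbidden {d@(_ , a , s)} d∈ = begin
        ∑ (downFrom pᵞ) (λ t → 𝟙 (forbids? p (lift x t) d))
          ≡⟨ ∑-cong (downFrom pᵞ) (λ t → sym (𝟙-× (relevant? p d) (∈AP? (lift x t) s (p ^ a)))) ⟩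
        ∑ (downFrom pᵞ) (λ t → 𝟙 (relevant? p d) * 𝟙 (∈AP? (lift x t) s (p ^ a)))
          ≡⟨ ∑-*ˡ (downFrom pᵞ) (𝟙 (relevant? p d)) _ ⟩
        𝟙 (relevant? p d) * ∑ (downFrom pᵞ) (λ t → 𝟙 (∈AP? (lift x t) s (p ^ a)))
          ≤⟨ *-monoʳ-≤ (𝟙 (relevant? p d)) (count-lifts (λ t → ∈AP? (lift x t) s (p ^ a)) a (ds≤γ d∈) (λ {s′} {t′} → lifts-close x s {s′} {t′})) ⟩
        𝟙 (relevant? p d) * p ^ (γ ∸ (a ∸ h p)) ∎
      hits : ∀ {i} → i ∈ J → ∑ (downFrom pᵞ) (λ t → 𝟙 (hit? i (lift x t))) ≤ 𝟙 (∈AP? x (r i) (val (primes n) (ν γ (q i)))) * p ^ (γ ∸ (ν γ (q i) p ∸ h p))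
      hits {i} i∈ = begin
        ∑ (downFrom pᵞ) (λ t → 𝟙 (hit? i (lift x t)))
          ≤⟨ ∑-mono (downFrom pᵞ) (λ t → 𝟙-mono (hit? i (lift x t)) (inClasses? (p ∷ primes n) v v (r i) (r i) (lift x t))
               (λ hit → let hit′ = subst (lift x t ∈AP r i mod_) (sym (J-smooth i∈)) hit in hit′ , hit′)) ⟩
        ∑ (downFrom pᵞ) (λ t → 𝟙 (inClasses? (p ∷ primes n) v v (r i) (r i) (lift x t)))
          ≤⟨ lift-spread v v (ν≤ γ (q i)) (ν≤ γ (q i)) (r i) (r i) x ⟩
        𝟙 (inClasses? (primes n) v v (r i) (r i) x) * p ^ (γ ∸ ((v p ⊔ v p) ∸ h p))
          ≤⟨ *-mono-≤ (𝟙-mono (inClasses? (primes n) v v (r i) (r i) x) (∈AP? x (r i) (val (primes n) v)) proj₁)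
               (≤-reflexive (cong (λ c → p ^ (γ ∸ (c ∸ h p))) (⊔-idem (v p)))) ⟩
        𝟙 (∈AP? x (r i) (val (primes n) v)) * p ^ (γ ∸ (v p ∸ h p)) ∎
        where
        v = ν γ (q i)

    loss : ∀ L → H p * (pᵞ * pᵞ) * length L ≤ pᵞ * pᵞ * length (next L) + 16 * H p * ∑ L (λ x → β x * β x)
    loss L = next-length L β (λ {x} _ → few-bad x)

    module SecondMoment (hp≡0 : h p ≡ 0) (J-unique : Unique J) (J-injective : ∀ {i j} → i ∈ J → j ∈ J → q i ≡ q j → i ≡ j)
      (J-new : ∀ {i} → i ∈ J → 1 ≤ ν γ (q i) p) where

      open ≤-Reasoning

      -- The moduli in `J` are divisible by `p`, so exponent `0` gets weight `0`. The rest is a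
      -- geometric series with sum at most `p ^ γ / (p - 1)`, where `p - 1` is `n`; its square is
      -- the saving that makes the losses summable.
      w : ℕ → ℕ
      w zero    = 0
      w (suc c) = p ^ (γ ∸ suc c)

      w-sum : n * ∑ (downFrom (suc γ)) w ≤ pᵞ
      w-sum = ≤-trans (m≤m+n _ _) (go γ ≤-refl)
        where
        go : ∀ m → m ≤ γ → n * ∑ (downFrom (suc m)) w + p ^ (γ ∸ m) ≤ p ^ γ
        go zero    _   = ≤-reflexive (cong (_+ p ^ γ) (*-zeroʳ n))
        go (suc m) m<γ = begin
          n * (p ^ (γ ∸ suc m) + ∑ (downFrom (suc m)) w) + p ^ (γ ∸ suc m) ≡⟨ lem n (p ^ (γ ∸ suc m)) _ ⟩
          n * ∑ (downFrom (suc m)) w + p * p ^ (γ ∸ suc m) ≡⟨ cong (λ e → n * ∑ (downFrom (suc m)) w + p ^ e) (+-∸-assoc 1 m<γ) ⟨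
          n * ∑ (downFrom (suc m)) w + p ^ (γ ∸ m) ≤⟨ go m (<⇒≤ m<γ) ⟩
          p ^ γ ∎
          where
          lem : ∀ n x s → n * (x + s) + x ≡ n * s + (1 + n) * x
          lem = solve-∀

      -- One function serves both the top prime and the smaller ones, so that the terms become
      -- products over `p ∷ primes n` and `∑∏-distinct` applies.
      G : ℕ → ℕ → ℕ → ℕ
      G p′ a b with p′ ≟ p
      ... | yes _ = w a * w b
      ... | no  _ = u p′ (a ⊔ b)

      G-top : ∀ a b → G p a b ≡ w a * w b
      G-top a b with p ≟ p
      ... | yes _ = refl
      ... | no ¬p = ⊥-elim (¬p refl)

      G-below : ∀ {p′} → p′ ∈ primes n → ∀ a b → G p′ a b ≡ u p′ (a ⊔ b)
      G-below {p′} p∈ a b with p′ ≟ p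
      ... | yes refl = ⊥-elim (<-irrefl refl (proj₂ (∈-primes⁻ n p∈)))
      ... | no _     = refl

      e : I → ℕ → ℕ
      e i = ν γ (q i)

      J-separated : ∀ {i j} → i ∈ J → j ∈ J → (∀ {p′} → p′ ∈ p ∷ primes n → e i p′ ≡ e j p′) → i ≡ j
      J-separated i∈ j∈ eq = J-injective i∈ j∈ (trans (sym (J-smooth i∈)) (trans (∏-cong∈ (p ∷ primes n) (λ {p′} p∈ → cong (p′ ^_) (eq p∈))) (J-smooth j∈)))

      E = downFrom (suc γ)

      β-eq : ∀ x → β x ≤ ∑ J (λ i → 𝟙 (∈AP? x (r i) (val (primes n) (e i))) * w (e i p))
      β-eq x = ∑-mono∈ J λ {i} i∈ → *-monoʳ-≤ (𝟙 (∈AP? x (r i) (val (primes n) (e i)))) (≤-reflexive (weight (e i p) (J-new i∈)))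
        where
        weight : ∀ c → 1 ≤ c → p ^ (γ ∸ (c ∸ h p)) ≡ w c
        weight (suc c) _ rewrite hp≡0 = refl

      -- Squaring `β` produces pairs of progressions, whose joint counts `Spread` bounds by products
      -- over primes. Distinct moduli have distinct exponent vectors; summing over all vectors, for
      -- one progression and then for the other, gives a sum that factorises.
      second-moment : ∀ {L} → Spread (primes n) L → ∑ L (λ x → β x * β x) ≤ (∑ E w * ∑ E w) * ∏ (primes n) V
      second-moment {L} sp = begin
        ∑ L (λ x → β x * β x)
          ≤⟨ ∑-mono L (λ x → *-mono-≤ (β-eq x) (β-eq x)) ⟩
        ∑ L (λ x → ∑ J (λ i → hit x i * w (e i p)) * ∑ J (λ i → hit x i * w (e i p)))
          ≡⟨ ∑-cong L (λ x → trans (∑-*-∑ J (λ i → hit x i * w (e i p)))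
               (∑-cong J (λ j → ∑-cong J (λ i → lem (hit x j) (w (e j p)) (hit x i) (w (e i p)))))) ⟩
        ∑ L (λ x → ∑ J (λ j → ∑ J (λ i → (w (e i p) * w (e j p)) * (hit x i * hit x j))))
          ≡⟨ trans (∑-swap L J _) (∑-cong J (λ j → trans (∑-swap L J _) (∑-cong J (λ i → ∑-*ˡ L (w (e i p) * w (e j p)) _)))) ⟩
        ∑ J (λ j → ∑ J (λ i → (w (e i p) * w (e j p)) * ∑ L (λ x → hit x i * hit x j)))
          ≤⟨ ∑-mono J (λ j → ∑-mono J (λ i → *-monoʳ-≤ (w (e i p) * w (e j p)) (joint i j))) ⟩
        ∑ J (λ j → ∑ J (λ i → (w (e i p) * w (e j p)) * ∏ (primes n) (λ p′ → u p′ (e i p′ ⊔ e j p′))))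
          ≡⟨ ∑-cong J (λ j → ∑-cong J (λ i → sym (cong₂ _*_ (G-top (e i p) (e j p)) (∏-cong∈ (primes n) (λ {p′} p∈ → G-below p∈ (e i p′) (e j p′)))))) ⟩
        ∑ J (λ j → ∑ J (λ i → ∏ (p ∷ primes n) (λ p′ → G p′ (e i p′) (e j p′))))
          ≤⟨ ∑-mono J (λ j → ∑∏-distinct γ e (λ i → ν≤ γ (q i)) (λ p′ a → G p′ a (e j p′)) (p ∷ primes n) J J-unique J-separated) ⟩
        ∑ J (λ j → ∏ (p ∷ primes n) (λ p′ → ∑ E (λ a → G p′ a (e j p′))))
          ≤⟨ ∑∏-distinct γ e (λ i → ν≤ γ (q i)) (λ p′ b → ∑ E (λ a → G p′ a b)) (p ∷ primes n) J J-unique J-separated ⟩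
        ∑ E (λ b → ∑ E (λ a → G p a b)) * ∏ (primes n) (λ p′ → ∑ E (λ b → ∑ E (λ a → G p′ a b)))
          ≡⟨ cong₂ _*_ top (∏-cong∈ (primes n) below) ⟩
        (∑ E w * ∑ E w) * ∏ (primes n) V ∎
        where
        hit : ℤ → I → ℕ
        hit x i = 𝟙 (∈AP? x (r i) (val (primes n) (e i)))
        lem : ∀ a b c d → a * b * (c * d) ≡ (d * b) * (c * a)
        lem = solve-∀
        joint : ∀ i j → ∑ L (λ x → hit x i * hit x j) ≤ ∏ (primes n) (λ p′ → u p′ (e i p′ ⊔ e j p′))
        joint i j = ≤-trans (≤-reflexive (∑-cong L (λ x → 𝟙-× (∈AP? x (r i) (val (primes n) (e i))) (∈AP? x (r j) (val (primes n) (e j))))))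
          (sp (e i) (e j) (ν≤ γ (q i)) (ν≤ γ (q j)) (r i) (r j))
        top : ∑ E (λ b → ∑ E (λ a → G p a b)) ≡ ∑ E w * ∑ E w
        top = trans (∑-cong E (λ b → ∑-cong E (λ a → trans (G-top a b) (*-comm (w a) (w b))))) (sym (∑-*-∑ E w))
        below : ∀ {p′} → p′ ∈ primes n → ∑ E (λ b → ∑ E (λ a → G p′ a b)) ≡ V p′
        below {p′} p∈ = trans (∑-swap E E (λ b a → G p′ a b)) (∑-cong E (λ a → ∑-cong E (λ b → G-below p∈ a b)))

      loss₂ : ∀ {L} → Spread (primes n) L →
        n * n * (H p * length L) ≤ n * n * length (next L) + 16 * H p * ∏ (primes n) V
      loss₂ {L} sp = *-cancelˡ-≤ (pᵞ * pᵞ) {{>-nonZero (*-mono-< pᵞ>0 pᵞ>0)}} (begin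
        pᵞ * pᵞ * (n * n * (H p * length L))
          ≡⟨ lem₁ pᵞ n (H p) (length L) ⟩
        n * n * (H p * (pᵞ * pᵞ) * length L)
          ≤⟨ *-monoʳ-≤ (n * n) (≤-trans (loss L) (+-monoʳ-≤ (pᵞ * pᵞ * length (next L)) (*-monoʳ-≤ (16 * H p) (second-moment {L} sp)))) ⟩
        n * n * (pᵞ * pᵞ * length (next L) + 16 * H p * ((∑ E w * ∑ E w) * ∏ (primes n) V))
          ≡⟨ lem₂ n pᵞ (length (next L)) (16 * H p) (∑ E w) (∏ (primes n) V) ⟩
        pᵞ * pᵞ * (n * n * length (next L)) + (n * ∑ E w) * (n * ∑ E w) * (16 * H p * ∏ (primes n) V)
          ≤⟨ +-monoʳ-≤ (pᵞ * pᵞ * (n * n * length (next L))) (*-monoˡ-≤ (16 * H p * ∏ (primes n) V) (*-mono-≤ w-sum w-sum)) ⟩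
        pᵞ * pᵞ * (n * n * length (next L)) + pᵞ * pᵞ * (16 * H p * ∏ (primes n) V)
          ≡⟨ *-distribˡ-+ (pᵞ * pᵞ) _ _ ⟨
        pᵞ * pᵞ * (n * n * length (next L) + 16 * H p * ∏ (primes n) V) ∎)
        where
        pᵞ>0 : 0 < pᵞ
        pᵞ>0 = ^>0 γ (s≤s z≤n)
        lem₁ : ∀ m n a l → m * m * (n * n * (a * l)) ≡ n * n * (a * (m * m) * l)
        lem₁ = solve-∀
        lem₂ : ∀ n m l a s v → n * n * (m * m * l + a * ((s * s) * v)) ≡ m * m * (n * n * l) + (n * s) * (n * s) * (a * v)
        lem₂ = solve-∀

    loss₁ : (∀ {i} → ¬ i ∈ J) → ∀ L → H p * length L ≤ length (next L)
    loss₁ J-empty L = *-cancelˡ-≤ (pᵞ * pᵞ) {{>-nonZero (*-mono-< (^>0 γ (s≤s z≤n)) (^>0 γ (s≤s z≤n)))}} (begin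
      pᵞ * pᵞ * (H p * length L) ≡⟨ lem₁ (pᵞ * pᵞ) (H p) (length L) ⟩
      H p * (pᵞ * pᵞ) * length L ≤⟨ loss L ⟩
      pᵞ * pᵞ * length (next L) + 16 * H p * ∑ L (λ x → β x * β x) ≡⟨ cong (λ s → pᵞ * pᵞ * length (next L) + 16 * H p * s) (trans (∑-cong L (λ x → cong (λ s → s * s) (none J J-empty))) (∑-zero L)) ⟩
      pᵞ * pᵞ * length (next L) + 16 * H p * 0 ≡⟨ cong (λ z → pᵞ * pᵞ * length (next L) + z) (*-zeroʳ (16 * H p)) ⟩
      pᵞ * pᵞ * length (next L) + 0 ≡⟨ +-identityʳ _ ⟩
      pᵞ * pᵞ * length (next L) ∎)
      where
      open ≤-Reasoning
      none : ∀ (J : List I) {f} → (∀ {i} → ¬ i ∈ J) → ∑ J f ≡ 0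
      none []      _ = refl
      none (i ∷ J) h = ⊥-elim (h (here refl))
      lem₁ : ∀ m a l → m * (a * l) ≡ a * m * l
      lem₁ = solve-∀

  module Remove (n : ℕ) (J : List I) (J-smooth : ∀ {i} → i ∈ J → smooth n i) where

    covered? : ∀ x → Dec (Any (λ i → Hit i x) J)
    covered? x = any? (λ i → hit? i x) J

    removed : List ℤ → List ℤ
    removed = filter (λ x → ¬? (covered? x))

    removed-avoids : ∀ {L x i} → x ∈ removed L → i ∈ J → ¬ Hit i x
    removed-avoids {L} x∈ i∈ hit = proj₂ (∈-filter⁻ (λ x → ¬? (covered? x)) {xs = L} x∈) (Any.map (λ { refl → hit }) i∈)

    removed-inv : ∀ {L} → Inv n L → Inv n (removed L)
    removed-inv {L} inv = record
      { spread   = λ v w v≤ w≤ s t → ≤-trans (∑-filter≤ (λ x → ¬? (covered? x)) L _) (spread v w v≤ w≤ s t)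
      ; anchored = λ x∈ → anchored (⊆ x∈)
      ; allowed  = λ x∈ → allowed (⊆ x∈) }
      where
      open Inv inv
      ⊆ : ∀ {x} → x ∈ removed L → x ∈ L
      ⊆ x∈ = proj₁ (∈-filter⁻ (λ x → ¬? (covered? x)) {xs = L} x∈)

    -- A union bound, with `Spread` used for two equal classes.
    removed-length : ∀ {L} → Inv n L → length L ≤ length (removed L) + ∑ J (λ i → ∏ (primes n) (λ p → u p (ν γ (q i) p)))
    removed-length {L} inv = begin
      length L ≡⟨ ∑-one L ⟨
      ∑ L (λ _ → 1) ≤⟨ ∑-mono L (λ x → ≤-trans (split (covered? x)) (+-monoʳ-≤ (𝟙 (¬? (covered? x))) (𝟙-any (λ i → hit? i x) J))) ⟩
      ∑ L (λ x → 𝟙 (¬? (covered? x)) + ∑ J (λ i → 𝟙 (hit? i x))) ≡⟨ trans (∑-+ L _ _) (cong₂ _+_ (sym (length-filter≡ (λ x → ¬? (covered? x)) L)) (∑-swap L J _)) ⟩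
      length (removed L) + ∑ J (λ i → ∑ L (λ x → 𝟙 (hit? i x))) ≤⟨ +-monoʳ-≤ (length (removed L)) (∑-mono∈ J weight) ⟩
      length (removed L) + ∑ J (λ i → ∏ (primes n) (λ p → u p (ν γ (q i) p))) ∎
      where
      open ≤-Reasoning
      split : ∀ {P : Set} (P? : Dec P) → 1 ≤ 𝟙 (¬? P?) + 𝟙 P?
      split (yes _) = ≤-refl
      split (no _)  = ≤-refl
      weight : ∀ {i} → i ∈ J → ∑ L (λ x → 𝟙 (hit? i x)) ≤ ∏ (primes n) (λ p → u p (ν γ (q i) p))
      weight {i} i∈ = begin
        ∑ L (λ x → 𝟙 (hit? i x)) ≤⟨ ∑-mono L (λ x → 𝟙-mono (hit? i x) (inClasses? (primes n) v v (r i) (r i) x)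
            (λ hit → let hit′ = subst (x ∈AP r i mod_) (sym (J-smooth i∈)) hit in hit′ , hit′)) ⟩
        ∑ L (λ x → 𝟙 (inClasses? (primes n) v v (r i) (r i) x)) ≤⟨ Inv.spread inv v v (ν≤ γ (q i)) (ν≤ γ (q i)) (r i) (r i) ⟩
        ∏ (primes n) (λ p → u p (v p ⊔ v p)) ≡⟨ ∏-cong∈ (primes n) (λ {p} _ → cong (u p) (⊔-idem (v p))) ⟩
        ∏ (primes n) (λ p → u p (v p)) ∎
        where
        v = ν γ (q i)

-- From local factors to products over all primes.

primes-suc-prime : ∀ {n} → Prime (suc n) → primes (suc n) ≡ suc n ∷ primes n
primes-suc-prime {n} pr with prime? (suc n)
... | yes _  = refl
... | no ¬pr = ⊥-elim (¬pr pr)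

primes-suc-composite : ∀ {n} → ¬ Prime (suc n) → primes (suc n) ≡ primes n
primes-suc-composite {n} ¬pr with prime? (suc n)
... | yes pr = ⊥-elim (¬pr pr)
... | no _   = refl

κ : ℕ
κ = proj₁ ∏-primes-bound

∏-id>0 : ∀ a n → 0 < ∏ (primesIn a n) id
∏-id>0 a n = ∏-positive (primesIn a n) (λ q∈ → prime⇒>0 (proj₁ (∈-primesIn⁻ a n q∈)))

-- The missing primes between `n` and `4 ^ k` could only increase the quotient of the two products.
∏-primes-bound-≤ : ∀ k {n} → n ≤ 4 ^ k → ∏ (primes n) (_+ 28) ≤ κ * 2 ^ k * ∏ (primes n) id
∏-primes-bound-≤ k {n} n≤ = *-cancelʳ-≤ _ _ (∏ B id) {{>-nonZero (∏-id>0 n (4 ^ k ∸ n))}} (begin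
  ∏ (primes n) (_+ 28) * ∏ B id             ≤⟨ *-monoʳ-≤ (∏ (primes n) (_+ 28)) (∏-mono∈ B (λ {q} _ → m≤m+n q 28)) ⟩
  ∏ (primes n) (_+ 28) * ∏ B (_+ 28)        ≡⟨ trans (*-comm _ (∏ B (_+ 28))) (sym (∏-++ B (primes n) (_+ 28))) ⟩
  ∏ (B ++ primes n) (_+ 28)                 ≡⟨ cong (λ ps → ∏ ps (_+ 28)) split ⟨
  ∏ (primes (4 ^ k)) (_+ 28)                ≤⟨ proj₂ ∏-primes-bound k ⟩
  κ * 2 ^ k * ∏ (primes (4 ^ k)) id         ≡⟨ cong (λ ps → κ * 2 ^ k * ∏ ps id) split ⟩
  κ * 2 ^ k * ∏ (B ++ primes n) id          ≡⟨ cong (κ * 2 ^ k *_) (trans (∏-++ B (primes n) id) (*-comm (∏ B id) _)) ⟩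
  κ * 2 ^ k * (∏ (primes n) id * ∏ B id)    ≡⟨ *-assoc (κ * 2 ^ k) _ _ ⟨
  κ * 2 ^ k * ∏ (primes n) id * ∏ B id      ∎)
  where
  open ≤-Reasoning
  B = primesIn n (4 ^ k ∸ n)
  split : primes (4 ^ k) ≡ B ++ primes n
  split = trans (cong primes (sym (m+[n∸m]≡n n≤))) (primesIn-+ 0 n (4 ^ k ∸ n))

-- A local factor `1 + 28 / p` at every prime costs `κ * 2 ^ k` altogether. Both the second moment
-- and Rankin's sum pass through here, so `28` is chosen to serve both.
∏-compare : ∀ k {n} → n ≤ 4 ^ k → (f g : ℕ → ℕ) → (∀ {p} → p ∈ primes n → p * f p ≤ (p + 28) * g p) →
  ∏ (primes n) f ≤ κ * 2 ^ k * ∏ (primes n) g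
∏-compare k {n} n≤ f g h = *-cancelˡ-≤ (∏ (primes n) id) {{>-nonZero (∏-id>0 0 n)}} (begin
  ∏ (primes n) id * ∏ (primes n) f                    ≡⟨ ∏-* (primes n) id f ⟨
  ∏ (primes n) (λ p → p * f p)                        ≤⟨ ∏-mono∈ (primes n) h ⟩
  ∏ (primes n) (λ p → (p + 28) * g p)                 ≡⟨ ∏-* (primes n) (_+ 28) g ⟩
  ∏ (primes n) (_+ 28) * ∏ (primes n) g               ≤⟨ *-monoˡ-≤ (∏ (primes n) g) (∏-primes-bound-≤ k n≤) ⟩
  κ * 2 ^ k * ∏ (primes n) id * ∏ (primes n) g        ≡⟨ lem (κ * 2 ^ k) (∏ (primes n) id) (∏ (primes n) g) ⟩
  ∏ (primes n) id * (κ * 2 ^ k * ∏ (primes n) g)      ∎)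
  where
  open ≤-Reasoning
  lem : ∀ a b c → a * b * c ≡ b * (a * c)
  lem = solve-∀

-- Running the sieve through all primes.

module Phases (γ : ℕ) (h : ℕ → ℕ) (k₁ d : ℕ) (x₀ : ℤ)
  (ds : List (ℕ × ℕ × ℤ)) (ds≤γ : ∀ {p a r} → (p , a , r) ∈ ds → a ≤ γ)
  {I : Set} (r : I → ℤ) (q : I → ℕ)
  (q-injective : ∀ {i j} → q i ≡ q j → i ≡ j)
  (q>0 : ∀ i → 0 < q i) (q<2^γ : ∀ i → q i < 2 ^ γ) (q≤R : ∀ i → q i ≤ 4 ^ (d + k₁))
  (late : List I) (late-unique : Unique late)
  (T₀ : ℕ) (late-large : ∀ {i} → i ∈ late → (4 ^ k₁) ^ T₀ ≤ q i)
  (pays : ∀ {p} → Prime p → 4 * Sieve.cost γ h (4 ^ (d + k₁)) x₀ ds ds≤γ r q p ≤ p ^ γ)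
  (h≤γ : ∀ p → 2 + h p ≤ γ)
  (h≡0 : ∀ {p} → 4 ^ k₁ < p → h p ≡ 0)
  (1≤k₁ : 1 ≤ k₁)
  (Z t S : ℕ) (1≤Z : 1 ≤ Z) (h≤Z : ∀ p → 2 * ((h p + 6) * (h p + 6)) ≤ Z)
  (few : ∀ n → ∑ (primes n) (λ p → 𝟙 (0 <? h p)) ≤ t) (total : ∀ n → ∑ (primes n) h ≤ S)
  (cond₁ : 2 * (2 ^ T₀ * (κ * 2 ^ k₁ * 128 ^ S)) ≤ 3 ^ T₀)
  (cond₂ : 24 * (32 * (κ * Z ^ t)) ≤ 2 ^ k₁)
  where

  open ≤-Reasoning

  R : ℕ
  R = 4 ^ (d + k₁)

  open Sieve γ h R x₀ ds ds≤γ r q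

  -- The length the list would have if no point were ever dropped.
  T : ℕ → ℕ
  T n = ∏ (primes n) H

  2≤γ : 2 ≤ γ
  2≤γ = ≤-trans (m≤m+n 2 (h 0)) (h≤γ 0)

  T>0 : ∀ n → 0 < T n
  T>0 n = ∏-positive (primes n) (λ q∈ → H>0 (prime⇒>0 (proj₁ (∈-primes⁻ n q∈))))

  V-bound-prime : ∀ {p} → Prime p → p * V p ≤ (p + 28) * (Z ^ 𝟙 (0 <? h p) * H p)
  V-bound-prime {p} pr with 0 <? h p
  ... | yes _ = *-mono-≤ (m≤m+n p 28) (≤-trans (V-bound (prime⇒≥2 pr) (h≤γ p)) (*-monoˡ-≤ (H p) (≤-trans (h≤Z p) (≤-reflexive (sym (*-identityʳ Z))))))
  ... | no h≮ = ≤-trans (V-bound₀ (prime⇒≥2 pr) (n≤0⇒n≡0 (≮⇒≥ h≮)) 2≤γ) (≤-reflexive (cong ((p + 28) *_) (sym (*-identityˡ (H p)))))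

  ∏V-bound : ∀ k {n} → n ≤ 4 ^ k → ∏ (primes n) V ≤ κ * 2 ^ k * (Z ^ t * T n)
  ∏V-bound k {n} n≤ = begin
    ∏ (primes n) V ≤⟨ ∏-compare k n≤ V _ (λ p∈ → V-bound-prime (proj₁ (∈-primes⁻ n p∈))) ⟩
    κ * 2 ^ k * ∏ (primes n) (λ p → Z ^ 𝟙 (0 <? h p) * H p) ≡⟨ cong (κ * 2 ^ k *_) (trans (∏-* (primes n) _ H) (cong (_* T n) (∏-^ (primes n) Z _))) ⟩
    κ * 2 ^ k * (Z ^ ∑ (primes n) (λ p → 𝟙 (0 <? h p)) * T n) ≤⟨ *-monoʳ-≤ (κ * 2 ^ k) (*-monoˡ-≤ (T n) (^-monoʳ-≤ Z {{>-nonZero 1≤Z}} (few n))) ⟩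
    κ * 2 ^ k * (Z ^ t * T n) ∎

  rankin-bound-prime : ∀ {p} → Prime p → p * rankin-sum p ≤ (p + 28) * (128 ^ h p * (2 ^ γ * H p))
  rankin-bound-prime {p} pr with h p in eq
  ... | zero  = ≤-trans (rankin-bound₀ (prime⇒≥2 pr) eq (<⇒≤ 2≤γ)) (≤-reflexive (cong ((p + 28) *_) (sym (*-identityˡ (2 ^ γ * H p)))))
  ... | suc k = *-mono-≤ (m≤m+n p 28) (subst (λ e → rankin-sum p ≤ 128 ^ e * (2 ^ γ * H p)) eq
                  (rankin-bound₊ (prime⇒≥2 pr) (subst (0 <_) (sym eq) (s≤s z≤n)) (<⇒≤ (h≤γ p))))

  X : ℕ → ℕ
  X n = ∏ (primes n) (λ _ → 2 ^ γ)

  X>0 : ∀ n → 0 < X n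
  X>0 n = ∏-positive (primes n) (λ _ → ^>0 γ (s≤s z≤n))

  ∏rankin-bound : ∀ k {n} → n ≤ 4 ^ k → ∏ (primes n) rankin-sum ≤ κ * 2 ^ k * (128 ^ S * (X n * T n))
  ∏rankin-bound k {n} n≤ = begin
    ∏ (primes n) rankin-sum ≤⟨ ∏-compare k n≤ rankin-sum _ (λ p∈ → rankin-bound-prime (proj₁ (∈-primes⁻ n p∈))) ⟩
    κ * 2 ^ k * ∏ (primes n) (λ p → 128 ^ h p * (2 ^ γ * H p)) ≡⟨ cong (κ * 2 ^ k *_) (trans (∏-* (primes n) _ _) (cong₂ _*_ (∏-^ (primes n) 128 h) (∏-* (primes n) _ H))) ⟩
    κ * 2 ^ k * (128 ^ ∑ (primes n) h * (X n * T n)) ≤⟨ *-monoʳ-≤ (κ * 2 ^ k) (*-monoˡ-≤ (X n * T n) (^-monoʳ-≤ 128 (total n))) ⟩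
    κ * 2 ^ k * (128 ^ S * (X n * T n)) ∎

  e : I → ℕ → ℕ
  e i = ν γ (q i)

  separated : ∀ {n i j} → smooth n i → smooth n j → (∀ {p} → p ∈ primes n → e i p ≡ e j p) → i ≡ j
  separated {n} si sj eq = q-injective (trans (sym si) (trans (∏-cong∈ (primes n) (λ {p} p∈ → cong (p ^_) (eq p∈))) sj))

  inv-composite : ∀ {n L} → ¬ Prime (suc n) → Inv n L → Inv (suc n) L
  inv-composite {n} {L} ¬pr inv = record
    { spread   = subst (λ ps → Spread ps L) (sym (primes-suc-composite ¬pr)) (Inv.spread inv)
    ; anchored = Inv.anchored inv
    ; allowed  = λ x∈ p∈ → Inv.allowed inv x∈ (subst (_ ∈_) (primes-suc-composite ¬pr) p∈) }

  phase₁-step : ∀ {n} → suc n ≤ R → Dec (Prime (suc n)) →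
    (∃ λ L → Inv n L × T n ≤ length L) → ∃ λ L → Inv (suc n) L × T (suc n) ≤ length L
  phase₁-step _ (no ¬pr) (L , inv , len) =
    L , inv-composite ¬pr inv , subst (λ ps → ∏ ps H ≤ length L) (sym (primes-suc-composite ¬pr)) len
  phase₁-step {n} n<R (yes pr) (L , inv , len) = next L , next-inv inv , (begin
    T (suc n)               ≡⟨ cong (λ ps → ∏ ps H) (primes-suc-prime pr) ⟩
    H (suc n) * T n         ≤⟨ *-monoʳ-≤ (H (suc n)) len ⟩
    H (suc n) * length L    ≤⟨ loss₁ (λ ()) L ⟩
    length (next L)         ∎)
    where
    open Stage n pr n<R (pays pr) [] (λ ()) using (next; next-inv; loss₁)

  -- With no late progression in play `β` vanishes, and the forbidden prime powers alone never cause
  -- a point to be dropped.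
  phase₁ : ∀ n → n ≤ R → ∃ λ L → Inv n L × T n ≤ length L
  phase₁ zero _ = x₀ ∷ [] , record
    { spread   = λ v w _ _ r s → ≤-trans (≤-reflexive (+-identityʳ _)) (𝟙≤1 (inClasses? [] v w r s x₀))
    ; anchored = λ { (here refl) → subst (λ z → M ∣ ℤ.∣ z ∣) (sym (ℤ.+-inverseʳ x₀)) (M ∣0) }
    ; allowed  = λ _ () } , ≤-refl
  phase₁ (suc n) n<R = phase₁-step n<R (prime? (suc n)) (phase₁ n (<⇒≤ n<R))

  P : ℕ
  P = 4 ^ k₁

  2≤P : 2 ≤ P
  2≤P = ≤-trans (s≤s (s≤s z≤n)) (^-monoʳ-≤ 4 1≤k₁)

  P≤R : P ≤ R
  P≤R = ^-monoʳ-≤ 4 (m≤n+m k₁ d)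

  J₁ : List I
  J₁ = filter (smooth? P) late

  Ω : I → ℕ
  Ω i = ∑ (primes P) (e i)

  -- All primes involved are at most `P`, so a modulus of size `P ^ T₀` has at least `T₀` of them,
  -- with multiplicity.
  T₀≤Ω : ∀ {i} → i ∈ J₁ → T₀ ≤ Ω i
  T₀≤Ω {i} i∈ with ∈-filter⁻ (smooth? P) {xs = late} i∈
  ... | i∈late , sm = ≮⇒≥ λ Ω<T₀ → <⇒≱ (^-monoʳ-< P 2≤P Ω<T₀) (begin
    P ^ T₀                       ≤⟨ late-large i∈late ⟩
    q i                          ≡⟨ sm ⟨
    val (primes P) (e i)         ≤⟨ ∏-mono∈ (primes P) (λ {p} p∈ → ^-monoˡ-≤ (e i p) (proj₂ (∈-primes⁻ P p∈))) ⟩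
    ∏ (primes P) (λ p → P ^ e i p) ≡⟨ ∏-^ (primes P) P (e i) ⟩
    P ^ Ω i                      ∎)

  -- Rankin's trick: `(3 / 2) ^ (Ω i - T₀)` is at least `1`. The factor `X P` clears the
  -- denominators `2 ^ e i p`.
  rankin-weight : ∀ {i} → i ∈ J₁ → 3 ^ T₀ * X P * ∏ (primes P) (λ p → u p (e i p)) ≤ 2 ^ T₀ * ∏ (primes P) (λ p → rankin p (e i p))
  rankin-weight {i} i∈ = begin
    3 ^ T₀ * X P * U ≤⟨ *-monoˡ-≤ U key ⟩
    2 ^ T₀ * Y * U   ≡⟨ *-assoc (2 ^ T₀) Y U ⟩
    2 ^ T₀ * (Y * U) ≡⟨ cong (2 ^ T₀ *_) (∏-* (primes P) (λ p → 3 ^ e i p * 2 ^ (γ ∸ e i p)) (λ p → u p (e i p))) ⟨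
    2 ^ T₀ * ∏ (primes P) (λ p → rankin p (e i p)) ∎
    where
    U = ∏ (primes P) (λ p → u p (e i p))
    Y = ∏ (primes P) (λ p → 3 ^ e i p * 2 ^ (γ ∸ e i p))
    f = Ω i ∸ T₀
    Y-eq : 2 ^ Ω i * Y ≡ 3 ^ Ω i * X P
    Y-eq = begin-equality
      2 ^ Ω i * Y ≡⟨ cong (_* Y) (∏-^ (primes P) 2 (e i)) ⟨
      ∏ (primes P) (λ p → 2 ^ e i p) * Y ≡⟨ ∏-* (primes P) _ _ ⟨
      ∏ (primes P) (λ p → 2 ^ e i p * (3 ^ e i p * 2 ^ (γ ∸ e i p))) ≡⟨ ∏-cong∈ (primes P) (λ {p} _ → trans (lem (2 ^ e i p) (3 ^ e i p) _) (cong (3 ^ e i p *_) (sym (^-∸-split 2 (ν≤ γ (q i) p))))) ⟩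
      ∏ (primes P) (λ p → 3 ^ e i p * 2 ^ γ) ≡⟨ ∏-* (primes P) _ _ ⟩
      ∏ (primes P) (λ p → 3 ^ e i p) * X P ≡⟨ cong (_* X P) (∏-^ (primes P) 3 (e i)) ⟩
      3 ^ Ω i * X P ∎
      where
      lem : ∀ a b c → a * (b * c) ≡ b * (a * c)
      lem = solve-∀
    key : 3 ^ T₀ * X P ≤ 2 ^ T₀ * Y
    key = *-cancelˡ-≤ (2 ^ f) {{>-nonZero (^>0 f (s≤s z≤n))}} (begin
      2 ^ f * (3 ^ T₀ * X P) ≤⟨ *-monoˡ-≤ (3 ^ T₀ * X P) (^-monoˡ-≤ f (s≤s (s≤s z≤n))) ⟩
      3 ^ f * (3 ^ T₀ * X P) ≡⟨ lem (3 ^ f) (3 ^ T₀) (X P) ⟩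
      3 ^ T₀ * 3 ^ f * X P ≡⟨ cong (_* X P) (^-∸-split 3 (T₀≤Ω i∈)) ⟨
      3 ^ Ω i * X P ≡⟨ Y-eq ⟨
      2 ^ Ω i * Y ≡⟨ cong (_* Y) (^-∸-split 2 (T₀≤Ω i∈)) ⟩
      2 ^ T₀ * 2 ^ f * Y ≡⟨ lem (2 ^ f) (2 ^ T₀) Y ⟨
      2 ^ f * (2 ^ T₀ * Y) ∎)
      where
      lem : ∀ a b c → a * (b * c) ≡ b * a * c
      lem = solve-∀

  W₁ : ℕ
  W₁ = ∑ J₁ (λ i → ∏ (primes P) (λ p → u p (e i p)))

  -- By `cond₁` the gain `(3 / 2) ^ T₀` beats twice the bound for the product of Rankin's sums, so
  -- at least half of the points remain.
  2W₁≤T : 2 * W₁ ≤ T P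
  2W₁≤T = *-cancelˡ-≤ (3 ^ T₀ * X P) {{>-nonZero (*-mono-< (^>0 T₀ (s≤s z≤n)) (X>0 P))}} (begin
    3 ^ T₀ * X P * (2 * W₁)
      ≡⟨ lem₁ (3 ^ T₀ * X P) W₁ ⟩
    2 * (3 ^ T₀ * X P * W₁)
      ≡⟨ cong (2 *_) (∑-*ˡ J₁ (3 ^ T₀ * X P) _) ⟨
    2 * ∑ J₁ (λ i → 3 ^ T₀ * X P * ∏ (primes P) (λ p → u p (e i p)))
      ≤⟨ *-monoʳ-≤ 2 (∑-mono∈ J₁ rankin-weight) ⟩
    2 * ∑ J₁ (λ i → 2 ^ T₀ * ∏ (primes P) (λ p → rankin p (e i p)))
      ≡⟨ cong (2 *_) (∑-*ˡ J₁ (2 ^ T₀) _) ⟩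
    2 * (2 ^ T₀ * ∑ J₁ (λ i → ∏ (primes P) (λ p → rankin p (e i p))))
      ≤⟨ *-monoʳ-≤ 2 (*-monoʳ-≤ (2 ^ T₀) (∑∏-distinct γ e (λ i → ν≤ γ (q i)) rankin (primes P) J₁ (filter⁺ (smooth? P) late-unique)
           (λ i∈ j∈ → separated {P} (proj₂ (∈-filter⁻ (smooth? P) {xs = late} i∈)) (proj₂ (∈-filter⁻ (smooth? P) {xs = late} j∈))))) ⟩
    2 * (2 ^ T₀ * ∏ (primes P) rankin-sum)
      ≤⟨ *-monoʳ-≤ 2 (*-monoʳ-≤ (2 ^ T₀) (∏rankin-bound k₁ ≤-refl)) ⟩
    2 * (2 ^ T₀ * (κ * 2 ^ k₁ * (128 ^ S * (X P * T P))))
      ≡⟨ lem₂ (2 ^ T₀) (κ * 2 ^ k₁) (128 ^ S) (X P) (T P) ⟩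
    2 * (2 ^ T₀ * (κ * 2 ^ k₁ * 128 ^ S)) * (X P * T P)
      ≤⟨ *-monoˡ-≤ (X P * T P) cond₁ ⟩
    3 ^ T₀ * (X P * T P)
      ≡⟨ *-assoc (3 ^ T₀) (X P) (T P) ⟨
    3 ^ T₀ * X P * T P ∎)
    where
    lem₁ : ∀ a b → a * (2 * b) ≡ 2 * (a * b)
    lem₁ = solve-∀
    lem₂ : ∀ a b c x y → 2 * (a * (b * (c * (x * y)))) ≡ 2 * (a * (b * c)) * (x * y)
    lem₂ = solve-∀

  record State (n : ℕ) (L : List ℤ) : Set where
    field
      inv    : Inv n L
      avoids : ∀ {x i} → x ∈ L → i ∈ late → smooth n i → ¬ Hit i x

  phase-middle : ∃ λ L → State P L × T P ≤ 2 * length L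
  phase-middle with phase₁ P P≤R
  ... | L , inv , len = removed L
      , record { inv = removed-inv inv ; avoids = λ x∈ i∈ sm → removed-avoids {L} x∈ (∈-filter⁺ (smooth? P) i∈ sm) }
      , +-cancelʳ-≤ (T P) _ _ (begin
          T P + T P                           ≡⟨ cong (T P +_) (+-identityʳ (T P)) ⟨
          2 * T P                             ≤⟨ *-monoʳ-≤ 2 len ⟩
          2 * length L                        ≤⟨ *-monoʳ-≤ 2 (removed-length inv) ⟩
          2 * (length (removed L) + W₁)       ≡⟨ *-distribˡ-+ 2 (length (removed L)) W₁ ⟩
          2 * length (removed L) + 2 * W₁     ≤⟨ +-monoʳ-≤ (2 * length (removed L)) 2W₁≤T ⟩
          2 * length (removed L) + T P        ∎)
    where
    open Remove P J₁ (λ i∈ → proj₂ (∈-filter⁻ (smooth? P) {xs = late} i∈))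

  -- `32` is `16` from `loss₂` times `2` from `2 ^ suc k`: the primes of block `k` reach up to
  -- `4 ^ suc k`.
  E : ℕ
  E = 32 * (κ * Z ^ t)

  -- The hypothesis amounts to `a * (x - y) ≤ c`, where `a` may be decreased. It allows replacing
  -- `n * n` by `16 ^ k` throughout a block.
  cancel-factor : ∀ {a b x y c} → b ≤ a → a * x ≤ a * y + c → b * x ≤ b * y + c
  cancel-factor {a} {b} {x} {y} {c} b≤a h with ≤-total x y
  ... | inj₁ x≤y = ≤-trans (*-monoʳ-≤ b x≤y) (m≤m+n _ c)
  ... | inj₂ y≤x = begin
    b * x                    ≡⟨ cong (b *_) (m+[n∸m]≡n y≤x) ⟨
    b * (y + (x ∸ y))        ≡⟨ *-distribˡ-+ b y (x ∸ y) ⟩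
    b * y + b * (x ∸ y)      ≤⟨ +-monoʳ-≤ (b * y) (*-monoˡ-≤ (x ∸ y) b≤a) ⟩
    b * y + a * (x ∸ y)      ≤⟨ +-monoʳ-≤ (b * y) (+-cancelˡ-≤ (a * y) _ _ (begin
      a * y + a * (x ∸ y)    ≡⟨ *-distribˡ-+ a y (x ∸ y) ⟨
      a * (y + (x ∸ y))      ≡⟨ cong (a *_) (m+[n∸m]≡n y≤x) ⟩
      a * x                  ≤⟨ h ⟩
      a * y + c              ∎)) ⟩
    b * y + c                ∎

  -- Only moduli whose largest prime is `suc n` are new; smoother ones are already avoided by the
  -- parents of the points. Relative to `T (suc n)` the loss is `E * 2 ^ k / 16 ^ k = E / 8 ^ k`.
  phase₂-step : ∀ k {n L} → k₁ ≤ k → 4 ^ k ≤ n → suc n ≤ 4 ^ suc k → suc n ≤ R → (pr : Prime (suc n)) → State n L →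
    ∃ λ L′ → State (suc n) L′ × 8 ^ k * (H (suc n) * length L) ≤ 8 ^ k * length L′ + T (suc n) * E
  phase₂-step k {n} {L} k₁≤k 4^k≤n n<4^ n<R pr st = next L
      , record { inv = next-inv (State.inv st) ; avoids = avoids′ }
      , *-cancelˡ-≤ (2 ^ k) {{>-nonZero (^>0 k (s≤s z≤n))}} (begin
          2 ^ k * (8 ^ k * (H p * length L))    ≡⟨ trans (sym (*-assoc (2 ^ k) (8 ^ k) _)) (cong (_* (H p * length L)) (16^ k)) ⟩
          4 ^ k * 4 ^ k * (H p * length L)      ≤⟨ cancel-factor (*-mono-≤ 4^k≤n 4^k≤n) (≤-trans (loss₂ {L} (Inv.spread (State.inv st))) (+-monoʳ-≤ (n * n * length (next L)) bound)) ⟩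
          4 ^ k * 4 ^ k * length (next L) + 2 ^ k * (T (suc n) * E) ≡⟨ cong (_+ 2 ^ k * (T (suc n) * E)) (trans (sym (cong (_* length (next L)) (16^ k))) (*-assoc (2 ^ k) (8 ^ k) _)) ⟩
          2 ^ k * (8 ^ k * length (next L)) + 2 ^ k * (T (suc n) * E) ≡⟨ *-distribˡ-+ (2 ^ k) _ _ ⟨
          2 ^ k * (8 ^ k * length (next L) + T (suc n) * E) ∎)
    where
    p = suc n
    new? : ∀ i → Dec (smooth p i × ¬ smooth n i)
    new? i = smooth? p i ×-dec ¬? (smooth? n i)
    new : List I
    new = filter new? late
    J-smooth : ∀ {i} → i ∈ new → smooth p i
    J-smooth i∈ = proj₁ (proj₂ (∈-filter⁻ new? {xs = late} i∈))
    smooth-∷ : ∀ {i} → smooth p i → val (p ∷ primes n) (e i) ≡ q i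
    smooth-∷ {i} = subst (λ ps → val ps (e i) ≡ q i) (primes-suc-prime pr)
    open Stage n pr n<R (pays pr) new (smooth-∷ ∘ J-smooth) using (next; next-inv; next-hereditary; next-avoids; module SecondMoment)
    J-new : ∀ {i} → i ∈ new → 1 ≤ e i p
    J-new {i} i∈ = n≢0⇒n>0 λ e≡0 → proj₂ (proj₂ (∈-filter⁻ new? {xs = late} i∈))
      (trans (sym (trans (cong (λ a → p ^ a * val (primes n) (e i)) e≡0) (*-identityˡ _))) (smooth-∷ (J-smooth i∈)))
    open SecondMoment (h≡0 (s≤s (≤-trans (^-monoʳ-≤ 4 k₁≤k) 4^k≤n))) (filter⁺ new? late-unique) (λ _ _ → q-injective) J-new using (loss₂)
    16^ : ∀ k → 2 ^ k * 8 ^ k ≡ 4 ^ k * 4 ^ k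
    16^ k = trans (sym (^-distribʳ-* 2 8 k)) (^-distribʳ-* 4 4 k)
    bound : 16 * H p * ∏ (primes n) V ≤ 2 ^ k * (T (suc n) * E)
    bound = begin
      16 * H p * ∏ (primes n) V ≤⟨ *-monoʳ-≤ (16 * H p) (∏V-bound (suc k) (<⇒≤ n<4^)) ⟩
      16 * H p * (κ * 2 ^ suc k * (Z ^ t * T n)) ≡⟨ lem (H p) κ (2 ^ k) (Z ^ t) (T n) ⟩
      2 ^ k * (H p * T n * E) ≡⟨ cong (λ ps → 2 ^ k * (∏ ps H * E)) (primes-suc-prime pr) ⟨
      2 ^ k * (T (suc n) * E) ∎
      where
      lem : ∀ h a x z t → 16 * h * (a * (2 * x) * (z * t)) ≡ x * (h * t * (32 * (a * z)))
      lem = solve-∀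
    avoids′ : ∀ {y i} → y ∈ next L → i ∈ late → smooth p i → ¬ Hit i y
    avoids′ {y} {i} y∈ i∈ sm hit = cases (smooth? n i) (next-hereditary {L} y∈)
      where
      cases : Dec (smooth n i) → (∃ λ x → x ∈ L × (∀ {m} s → m ∣ Q n → y ∈AP s mod m → x ∈AP s mod m)) → ⊥
      cases (no ¬sm) _               = next-avoids {L} y∈ (∈-filter⁺ new? i∈ (sm , ¬sm)) hit
      cases (yes sm′) (x , x∈ , back) = State.avoids st x∈ i∈ sm′ (back (r i) (subst (_∣ Q n) sm′ (val∣Q n (e i) (ν≤ γ (q i)))) hit)

  -- In fractions: `length L / T n ≥ 1 / 4 + 6 * E / 2 ^ k - i * E / 8 ^ k`. Each of the `3 * 4 ^ k`
  -- integers of the block, prime or not, is charged `E / 8 ^ k`. This consumes half of the reserve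
  -- `6 * E / 2 ^ k` and leaves exactly the reserve of block `suc k`.
  Large : ℕ → ℕ → ℕ → List ℤ → Set
  Large k i n L = T n * (8 ^ k + 24 * E * 4 ^ k) ≤ 4 * (8 ^ k * length L) + 4 * (T n * E * i)

  phase₂-inner-step : ∀ k → k₁ ≤ k → suc k ≤ d + k₁ → ∀ {i} → suc i ≤ 3 * 4 ^ k → Dec (Prime (suc (4 ^ k + i))) →
    (∃ λ L → State (4 ^ k + i) L × Large k i (4 ^ k + i) L) →
    ∃ λ L → State (suc (4 ^ k + i)) L × Large k (suc i) (suc (4 ^ k + i)) L
  phase₂-inner-step k k₁≤k k<K {i} i< (no ¬pr) (L , st , large) = L , st′ , (begin
    T (suc n) * c                                  ≡⟨ cong (λ ps → ∏ ps H * c) (primes-suc-composite ¬pr) ⟩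
    T n * c                                        ≤⟨ large ⟩
    4 * (8 ^ k * length L) + 4 * (T n * E * i)     ≡⟨ cong (λ ps → 4 * (8 ^ k * length L) + 4 * (∏ ps H * E * i)) (primes-suc-composite ¬pr) ⟨
    4 * (8 ^ k * length L) + 4 * (T (suc n) * E * i) ≤⟨ +-monoʳ-≤ (4 * (8 ^ k * length L)) (*-monoʳ-≤ 4 (*-monoʳ-≤ (T (suc n) * E) (n≤1+n i))) ⟩
    4 * (8 ^ k * length L) + 4 * (T (suc n) * E * suc i) ∎)
    where
    n = 4 ^ k + i
    c = 8 ^ k + 24 * E * 4 ^ k
    st′ : State (suc n) L
    st′ = record
      { inv    = inv-composite ¬pr (State.inv st)
      ; avoids = λ {x} {j} x∈ j∈ sm → State.avoids st x∈ j∈ (subst (λ ps → val ps (e j) ≡ q j) (primes-suc-composite ¬pr) sm) }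
  phase₂-inner-step k k₁≤k k<K {i} i< (yes pr) (L , st , large) = L′ , proj₁ (proj₂ result) , (begin
    T (suc n) * c ≡⟨ cong (λ ps → ∏ ps H * c) (primes-suc-prime pr) ⟩
    H p * T n * c ≡⟨ *-assoc (H p) (T n) c ⟩
    H p * (T n * c) ≤⟨ *-monoʳ-≤ (H p) large ⟩
    H p * (4 * (8 ^ k * length L) + 4 * (T n * E * i)) ≡⟨ lem₁ (H p) (8 ^ k) (length L) (T n) E i ⟩
    4 * (8 ^ k * (H p * length L)) + 4 * (H p * T n * E * i) ≡⟨ cong (λ ps → 4 * (8 ^ k * (H p * length L)) + 4 * (∏ ps H * E * i)) (primes-suc-prime pr) ⟨
    4 * (8 ^ k * (H p * length L)) + 4 * (T (suc n) * E * i) ≤⟨ +-monoˡ-≤ (4 * (T (suc n) * E * i)) (*-monoʳ-≤ 4 (proj₂ (proj₂ result))) ⟩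
    4 * (8 ^ k * length L′ + T (suc n) * E) + 4 * (T (suc n) * E * i) ≡⟨ lem₂ (8 ^ k * length L′) (T (suc n) * E) i ⟩
    4 * (8 ^ k * length L′) + 4 * (T (suc n) * E * suc i) ∎)
    where
    n = 4 ^ k + i
    p = suc n
    c = 8 ^ k + 24 * E * 4 ^ k
    n<4^ : suc n ≤ 4 ^ suc k
    n<4^ = ≤-trans (≤-reflexive (sym (+-suc (4 ^ k) i))) (+-monoʳ-≤ (4 ^ k) i<)
    result = phase₂-step k k₁≤k (m≤m+n (4 ^ k) i) n<4^ (≤-trans n<4^ (^-monoʳ-≤ 4 k<K)) pr st
    L′ = proj₁ result
    lem₁ : ∀ h x l t e i → h * (4 * (x * l) + 4 * (t * e * i)) ≡ 4 * (x * (h * l)) + 4 * (h * t * e * i)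
    lem₁ = solve-∀
    lem₂ : ∀ a b i → 4 * (a + b) + 4 * (b * i) ≡ 4 * a + 4 * (b * suc i)
    lem₂ = solve-∀

  phase₂-inner : ∀ k → k₁ ≤ k → suc k ≤ d + k₁ → (∃ λ L → State (4 ^ k) L × Large k 0 (4 ^ k) L) →
    ∀ i → i ≤ 3 * 4 ^ k → ∃ λ L → State (4 ^ k + i) L × Large k i (4 ^ k + i) L
  phase₂-inner k k₁≤k k<K start zero i≤ =
    subst (λ n → ∃ λ L → State n L × Large k 0 n L) (sym (+-identityʳ (4 ^ k))) start
  phase₂-inner k k₁≤k k<K start (suc i) i≤ =
    subst (λ n → ∃ λ L → State n L × Large k (suc i) n L) (sym (+-suc (4 ^ k) i))
      (phase₂-inner-step k k₁≤k k<K i≤ (prime? (suc (4 ^ k + i))) (phase₂-inner k k₁≤k k<K start i (<⇒≤ i≤)))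

  -- The list has at least half of `T P` points, and `cond₂` bounds the initial reserve
  -- `6 * E / 2 ^ k₁` by `1 / 4`.
  phase₂-start : (∃ λ L → State P L × T P ≤ 2 * length L) → ∃ λ L → State P L × Large k₁ 0 P L
  phase₂-start (L , st , len) = L , st , (begin
    T P * (8 ^ k₁ + 24 * E * 4 ^ k₁)              ≤⟨ *-monoʳ-≤ (T P) (+-monoʳ-≤ (8 ^ k₁) (*-monoˡ-≤ (4 ^ k₁) cond₂)) ⟩
    T P * (8 ^ k₁ + 2 ^ k₁ * 4 ^ k₁)              ≡⟨ cong (λ x → T P * (8 ^ k₁ + x)) (8^ k₁) ⟩
    T P * (8 ^ k₁ + 8 ^ k₁)                       ≤⟨ *-monoˡ-≤ (8 ^ k₁ + 8 ^ k₁) len ⟩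
    2 * length L * (8 ^ k₁ + 8 ^ k₁)              ≡⟨ lem (length L) (8 ^ k₁) ⟩
    4 * (8 ^ k₁ * length L)                       ≤⟨ m≤m+n _ _ ⟩
    4 * (8 ^ k₁ * length L) + 4 * (T P * E * 0)   ∎)
    where
    8^ : ∀ k → 2 ^ k * 4 ^ k ≡ 8 ^ k
    8^ zero    = refl
    8^ (suc k) = trans (lem (2 ^ k) (4 ^ k)) (cong (8 *_) (8^ k))
      where
      lem : ∀ a b → 2 * a * (4 * b) ≡ 8 * (a * b)
      lem = solve-∀
    lem : ∀ l x → 2 * l * (x + x) ≡ 4 * (x * l)
    lem = solve-∀
  phase₂-block : ∀ k → (∃ λ L → State (4 ^ k + 3 * 4 ^ k) L × Large k (3 * 4 ^ k) (4 ^ k + 3 * 4 ^ k) L) →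
    ∃ λ L → State (4 ^ suc k) L × Large (suc k) 0 (4 ^ suc k) L
  phase₂-block k (L , st , large) = L , subst (λ n → State n L) block st , subst (λ n → Large (suc k) 0 n L) block (begin
    τ * (8 * 8 ^ k + 24 * E * (4 * 4 ^ k))     ≤⟨ +-cancelʳ-≤ (96 * (τ * E * 4 ^ k)) _ _ (begin
      τ * (8 * 8 ^ k + 24 * E * (4 * 4 ^ k)) + 96 * (τ * E * 4 ^ k)   ≡⟨ lem₁ τ (8 ^ k) E (4 ^ k) ⟩
      8 * (τ * (8 ^ k + 24 * E * 4 ^ k))       ≤⟨ *-monoʳ-≤ 8 large ⟩
      8 * (4 * (8 ^ k * length L) + 4 * (τ * E * (3 * 4 ^ k))) ≡⟨ lem₂ (8 ^ k) (length L) τ E (4 ^ k) ⟩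
      4 * (8 * 8 ^ k * length L) + 96 * (τ * E * 4 ^ k) ∎) ⟩
    4 * (8 * 8 ^ k * length L)                  ≤⟨ m≤m+n _ _ ⟩
    4 * (8 * 8 ^ k * length L) + 4 * (τ * E * 0) ∎)
    where
    τ = T (4 ^ k + 3 * 4 ^ k)
    block : 4 ^ k + 3 * 4 ^ k ≡ 4 ^ suc k
    block = lem (4 ^ k)
      where
      lem : ∀ x → x + 3 * x ≡ 4 * x
      lem = solve-∀
    lem₁ : ∀ t a e b → t * (8 * a + 24 * e * (4 * b)) + 96 * (t * e * b) ≡ 8 * (t * (a + 24 * e * b))
    lem₁ = solve-∀
    lem₂ : ∀ a l t e b → 8 * (4 * (a * l) + 4 * (t * e * (3 * b))) ≡ 4 * (8 * a * l) + 96 * (t * e * b)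
    lem₂ = solve-∀

  phase₂ : ∀ i → i ≤ d → ∃ λ L → State (4 ^ (i + k₁)) L × Large (i + k₁) 0 (4 ^ (i + k₁)) L
  phase₂ zero    _   = phase₂-start phase-middle
  phase₂ (suc i) i<d = phase₂-block (i + k₁)
    (phase₂-inner (i + k₁) (m≤n+m k₁ i) (+-monoˡ-≤ k₁ i<d) (phase₂ i (<⇒≤ i<d)) (3 * 4 ^ (i + k₁)) ≤-refl)

  -- `Large` excludes the empty list, and any of its points will do: `R` is at least every modulus,
  -- so by `val-ν` all late moduli are smooth and have been dealt with.
  survivor-of : (∃ λ L → State R L × Large (d + k₁) 0 R L) →
    ∃ λ x → x ∈AP x₀ mod val (primes (4 ^ (d + k₁))) h ×
      (∀ {p a s} → p ∈ primes (4 ^ (d + k₁)) → (p , a , s) ∈ ds → h p < a → ¬ x ∈AP s mod (p ^ a)) ×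
      (∀ {i} → i ∈ late → ¬ x ∈AP r i mod q i)
  survivor-of (x ∷ _ , st , _) = x , Inv.anchored (State.inv st) (here refl) , (λ p∈ d∈ h<a x∈ → Inv.allowed (State.inv st) (here refl) p∈ (lose d∈ ((refl , h<a) , x∈)))
        , λ {i} i∈ → State.avoids st (here refl) i∈ (val-ν γ R (q i) (q>0 i) (q≤R i) (q<2^γ i))
  survivor-of ([] , st , large) = ⊥-elim (<⇒≱ (*-mono-< (T>0 R) (≤-trans (^>0 (d + k₁) (s≤s z≤n)) (m≤m+n (8 ^ (d + k₁)) _))) (≤-trans large (≤-reflexive (lem (8 ^ (d + k₁)) (T R * E)))))
    where
    lem : ∀ a b → 4 * (a * 0) + 4 * (b * 0) ≡ 0
    lem = solve-∀

  abstract

    survivor : ∃ λ x → x ∈AP x₀ mod val (primes (4 ^ (d + k₁))) h ×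
      (∀ {p a s} → p ∈ primes (4 ^ (d + k₁)) → (p , a , s) ∈ ds → h p < a → ¬ x ∈AP s mod (p ^ a)) ×
      (∀ {i} → i ∈ late → ¬ x ∈AP r i mod q i)
    survivor = survivor-of (phase₂ d ≤-refl)

-- Choice of the forbidden prime powers and of the exponents `h p`.

primes-unique : ∀ n → Unique (primes n)
primes-unique n = filter⁺ prime? (applyDownFrom⁺₁ suc n (λ j<i _ eq → <⇒≢ j<i (sym (suc-injective eq))))

module _ {X : Set} (f : X → ℕ) (f-injective : ∀ {x y} → f x ≡ f y → x ≡ y) where

  count-value : (xs : List X) → Unique xs → ∀ y → ∑ xs (λ x → 𝟙 (f x ≟ y)) ≤ 1
  count-value []       _ y = z≤n
  count-value (x ∷ xs) (x∉ AllPairs.∷ u) y with f x ≟ y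
  ... | no  _    = count-value xs u y
  ... | yes refl = s≤s (≤-reflexive (none xs x∉))
    where
    none : ∀ xs → All (x ≢_) xs → ∑ xs (λ x′ → 𝟙 (f x′ ≟ f x)) ≡ 0
    none []        _ = refl
    none (x′ ∷ xs) (x≢ All.∷ x∉) = cong₂ _+_ (𝟙-false (f x′ ≟ f x) (x≢ ∘ sym ∘ f-injective)) (none xs x∉)

  count-below : (xs : List X) → Unique xs → ∀ n → ∑ xs (λ x → 𝟙 (f x <? n)) ≤ n
  count-below xs u n = begin
    ∑ xs (λ x → 𝟙 (f x <? n))                           ≤⟨ ∑-mono xs locate ⟩
    ∑ xs (λ x → ∑ (downFrom n) (λ y → 𝟙 (f x ≟ y)))     ≡⟨ ∑-swap xs (downFrom n) _ ⟩
    ∑ (downFrom n) (λ y → ∑ xs (λ x → 𝟙 (f x ≟ y)))     ≤⟨ ∑-bound (downFrom n) (λ {y} _ → count-value xs u y) ⟩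
    length (downFrom n) * 1                              ≡⟨ trans (*-identityʳ _) (length-downFrom n) ⟩
    n                                                    ∎
    where
    open ≤-Reasoning
    locate : ∀ x → 𝟙 (f x <? n) ≤ ∑ (downFrom n) (λ y → 𝟙 (f x ≟ y))
    locate x with f x <? n
    ... | no  _   = z≤n
    ... | yes fx< = ≤-trans (≤-reflexive (sym (𝟙-true (f x ≟ f x) refl))) (∑-member (λ y → 𝟙 (f x ≟ y)) (∈-downFrom⁺ fx<))

abstract

  -- If some exponent lies in the window of length `g` above the current level, moving up by `g`
  -- leaves it behind for good; this can happen at most `n` times.
  gap : ∀ g n (as : List ℕ) → length as ≤ n → ∀ h₀ →
    ∃ λ h → h₀ ≤ h × h ≤ h₀ + n * g × (∀ {a} → a ∈ as → h < a → h + g < a)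
  gap g zero    []       _  h₀ = h₀ , ≤-refl , m≤m+n h₀ 0 , λ ()
  gap g (suc n) as       ≤n h₀ with any? (λ a → h₀ <? a ×-dec a ≤? h₀ + g) as
  ... | no none = h₀ , ≤-refl , m≤m+n h₀ _ , λ a∈ h₀<a → ≰⇒> λ a≤ → none (lose a∈ (h₀<a , a≤))
  ... | yes some with find some
  ...   | a₀ , a₀∈ , _ , a₀≤ with ∈-∃++ a₀∈
  ...     | l , r , refl with gap g n (l ++ r) shorter (h₀ + g)
    where
    shorter : length (l ++ r) ≤ n
    shorter = s≤s⁻¹ (≤-trans (≤-reflexive (trans (cong suc (length-++ l)) (trans (sym (+-suc (length l) (length r))) (sym (length-++ l))))) ≤n)
  ...       | h , ≤h , h≤ , empty = h , ≤-trans (m≤m+n h₀ g) ≤h , ≤-trans h≤ (≤-reflexive (+-assoc h₀ g (n * g))) , λ a∈ → cases (∈-++⁻ l a∈)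
    where
    cases : ∀ {a} → a ∈ l ⊎ a ∈ a₀ ∷ r → h < a → h + g < a
    cases (inj₁ a∈l)         = empty (∈-++⁺ˡ a∈l)
    cases (inj₂ (here refl)) = λ h<a → ⊥-elim (<⇒≱ h<a (≤-trans a₀≤ ≤h))
    cases (inj₂ (there a∈r)) = empty (∈-++⁺ʳ l a∈r)

n<2^n : ∀ n → n < 2 ^ n
n<2^n zero    = s≤s z≤n
n<2^n (suc n) = begin
  suc (suc n)      ≤⟨ +-mono-≤ (^>0 n (s≤s z≤n)) (n<2^n n) ⟩
  2 ^ n + 2 ^ n    ≡⟨ cong (2 ^ n +_) (+-identityʳ (2 ^ n)) ⟨
  2 ^ suc n        ∎
  where open ≤-Reasoning

abstract

  -- When q ∣ z the pair (p , a) is a junk value.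
  prime-power-witness : ∀ γ q z → 0 < q → q < 2 ^ γ → ∃ λ p → ∃ λ a → a ≤ γ × (¬ q ∣ z → Prime p × p ^ a ∣ q × ¬ p ^ a ∣ z)
  prime-power-witness γ q z 0<q q<2^γ with any? (λ p → ¬? (p ^ ν γ q p ∣? z)) (primes q)
  ... | yes some = let p , p∈ , ∤z = find some in
        p , ν γ q p , ν≤ γ q p , λ _ → proj₁ (∈-primes⁻ q p∈) , ^ν∣ γ q p , ∤z
  ... | no none = 0 , 0 , z≤n , λ q∤z → ⊥-elim (q∤z (subst (_∣ z) (val-ν γ q q 0<q ≤-refl q<2^γ)
        (∏-primesIn-∣ 0 q z (ν γ q) (λ {p} p∈ → decidable-stable (p ^ ν γ q p ∣? z) (λ ∤z → none (lose p∈ ∤z))))))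

∈AP-trans : ∀ {m} x y r → x ∈AP y mod m → x ∈AP r mod m → y ∈AP r mod m
∈AP-trans {m} x y r x∈y x∈r = ℤ.∣⇒∣ᵤ (subst (ℤ._∣_ (ℤ.+ m)) (lem x y r)
  (ℤ.∣m∣n⇒∣m-n (ℤ.∣ᵤ⇒∣ {k = ℤ.+ m} {i = x ℤ.- r} x∈r) (ℤ.∣ᵤ⇒∣ {k = ℤ.+ m} {i = x ℤ.- y} x∈y)))
  where
  lem : ∀ x y r → (x ℤ.- r) ℤ.- (x ℤ.- y) ≡ y ℤ.- r
  lem = solve-∀ᶻ

module Choice {K : ℕ} (r : Fin K → ℤ) (q : Fin K → ℕ) (q>0 : ∀ i → 0 < q i)
  (q-injective : ∀ {i j} → q i ≡ q j → i ≡ j)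
  (J : ℕ) (x₀ : ℤ) (early-avoids : ∀ i → toℕ i < J → ¬ x₀ ∈AP r i mod q i)
  (g Y k₁ T₀ : ℕ) (4J≤2^g : 4 * J ≤ 2 ^ g) (1≤Y : 1 ≤ Y) (J≤Y² : J ≤ 4 * (Y * Y)) (4J≤4^k₁ : 4 * J ≤ 4 ^ k₁)
  (1≤k₁ : 1 ≤ k₁)
  (late-large : ∀ i → J ≤ toℕ i → (4 ^ k₁) ^ T₀ ≤ q i)
  (cond₁ : 2 * (2 ^ T₀ * (κ * 2 ^ k₁ * 128 ^ (J * g))) ≤ 3 ^ T₀)
  (cond₂ : 24 * (32 * (κ * (2 * ((J * g + 6) * (J * g + 6))) ^ (17 * Y))) ≤ 2 ^ k₁)
  where

  open ≤-Reasoning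

  -- In `γ` the summand `2 + S` provides for `2 + h p ≤ γ`, `g` for the windows, and `B`, which
  -- bounds every modulus, for `q i < 2 ^ γ`.
  S B γ : ℕ
  S = J * g
  B = ∑ (allFin K) q
  γ = 2 + S + (g + B)

  q≤B : ∀ i → q i ≤ B
  q≤B i = ∑-member q (∈-allFin i)

  q<2^γ : ∀ i → q i < 2 ^ γ
  q<2^γ i = <-≤-trans (n<2^n (q i)) (^-monoʳ-≤ 2 (≤-trans (q≤B i) (≤-trans (m≤n+m B g) (m≤n+m (g + B) (2 + S)))))

  witness : ∀ i → ∃ λ p → ∃ λ a → a ≤ γ × (¬ x₀ ∈AP r i mod q i → Prime p × p ^ a ∣ q i × ¬ x₀ ∈AP r i mod (p ^ a))
  witness i = prime-power-witness γ (q i) ℤ.∣ x₀ ℤ.- r i ∣ (q>0 i) (q<2^γ i)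

  Datum : Set
  Datum = ℕ × ℕ × ℤ

  datum : Fin K → Datum
  datum i = proj₁ (witness i) , proj₁ (proj₂ (witness i)) , r i

  early late : List (Fin K)
  early = filter (λ i → toℕ i <? J) (allFin K)
  late  = filter (λ i → J ≤? toℕ i) (allFin K)

  ds : List Datum
  ds = map datum early

  ds≤γ : ∀ {p a s} → (p , a , s) ∈ ds → a ≤ γ
  ds≤γ d∈ with ∈-map⁻ datum d∈
  ... | i , _ , refl = proj₁ (proj₂ (proj₂ (witness i)))

  ds-length : length ds ≤ J
  ds-length = begin
    length ds                                     ≡⟨ trans (length-map datum early) (length-filter≡ (λ i → toℕ i <? J) (allFin K)) ⟩
    ∑ (allFin K) (λ i → 𝟙 (toℕ i <? J))           ≤⟨ count-below toℕ Fin.toℕ-injective (allFin K) (allFin⁺ K) J ⟩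
    J                                             ∎

  has-prime? : ∀ p (d : Datum) → Dec (proj₁ d ≡ p)
  has-prime? p d = proj₁ d ≟ p

  exponents : ℕ → List ℕ
  exponents p = map (proj₁ ∘ proj₂) (filter (has-prime? p) ds)

  N : ℕ → ℕ
  N p = length (exponents p)

  N≡ : ∀ p → N p ≡ ∑ ds (λ d → 𝟙 (has-prime? p d))
  N≡ p = trans (length-map _ (filter (has-prime? p) ds)) (length-filter≡ (has-prime? p) ds)

  N≤J : ∀ p → N p ≤ J
  N≤J p = ≤-trans (≤-reflexive (N≡ p)) (≤-trans (∑-mono ds (λ d → 𝟙≤1 (has-prime? p d))) (≤-trans (≤-reflexive (∑-one ds)) ds-length))

  ∑N≤J : ∀ n → ∑ (primes n) N ≤ J
  ∑N≤J n = begin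
    ∑ (primes n) N                                              ≡⟨ ∑-cong (primes n) N≡ ⟩
    ∑ (primes n) (λ p → ∑ ds (λ d → 𝟙 (has-prime? p d)))        ≡⟨ ∑-swap (primes n) ds _ ⟩
    ∑ ds (λ d → ∑ (primes n) (λ p → 𝟙 (has-prime? p d)))        ≤⟨ ∑-bound ds (λ {d} _ → ≤-trans (∑-mono (primes n) (λ p → 𝟙-mono (has-prime? p d) (p ≟ proj₁ d) sym)) (count-value id id (primes n) (primes-unique n) (proj₁ d))) ⟩
    length ds * 1                                               ≡⟨ *-identityʳ _ ⟩
    length ds                                                   ≤⟨ ds-length ⟩
    J                                                           ∎

  -- Either way the forbidden classes take at most a quarter of the lifts. In the first case each
  -- takes at most a share `1 / p`, and there are at most `p / 4`. In the second the empty window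
  -- reduces each share to at most `1 / p ^ g`, which is at most `1 / (4 * J)`.
  Suits : ℕ → ℕ → Set
  Suits p h = 4 * N p ≤ p × h ≡ 0 ⊎ p < 4 * N p × (∀ {a} → a ∈ exponents p → h < a → h + g < a)

  abstract

    choose : ∀ p → ∃ λ h → h ≤ N p * g × Suits p h
    choose p = cases (4 * N p ≤? p)
      where
      cases : Dec (4 * N p ≤ p) → ∃ λ h → h ≤ N p * g × Suits p h
      cases (yes 4N≤p) = 0 , z≤n , inj₁ (4N≤p , refl)
      cases (no  4N≰p) = let h , _ , h≤ , empty = gap g (N p) (exponents p) ≤-refl 0 in h , h≤ , inj₂ (≰⇒> 4N≰p , empty)

  h : ℕ → ℕ
  h p = proj₁ (choose p)

  h≤S : ∀ p → h p ≤ S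
  h≤S p = ≤-trans (proj₁ (proj₂ (choose p))) (*-monoˡ-≤ g (N≤J p))

  h>0⇒ : ∀ p → 0 < h p → p < 4 * N p
  h>0⇒ p 0<h = cases (proj₂ (proj₂ (choose p)))
    where
    cases : Suits p (h p) → p < 4 * N p
    cases (inj₁ (_ , h≡0)) = ⊥-elim (<⇒≢ 0<h (sym h≡0))
    cases (inj₂ (p< , _))  = p<

  pays : ∀ {p} → Prime p → 4 * Sieve.cost γ h (4 ^ (B + k₁)) x₀ ds ds≤γ r q p ≤ p ^ γ
  pays {p} pr = bound (proj₂ (proj₂ (choose p)))
    where
    open Sieve γ h (4 ^ (B + k₁)) x₀ ds ds≤γ r q using (relevant?; cost)
    cost≤ : ∀ b → (∀ {d} → d ∈ ds → proj₁ d ≡ p → h p < proj₁ (proj₂ d) → p ^ (γ ∸ (proj₁ (proj₂ d) ∸ h p)) ≤ b) → cost p ≤ N p * b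
    cost≤ b each = begin
      cost p ≤⟨ ∑-mono∈ ds (λ {d} d∈ → term d∈ (relevant? p d)) ⟩
      ∑ ds (λ d → 𝟙 (has-prime? p d) * b) ≡⟨ trans (∑-*ʳ ds b _) (cong (_* b) (sym (N≡ p))) ⟩
      N p * b ∎
      where
      term : ∀ {d} → d ∈ ds → (D : Dec (proj₁ d ≡ p × h p < proj₁ (proj₂ d))) → 𝟙 D * p ^ (γ ∸ (proj₁ (proj₂ d) ∸ h p)) ≤ 𝟙 (has-prime? p d) * b
      term     d∈ (no _)            = z≤n
      term {d} d∈ (yes (p≡ , h<a)) = *-mono-≤ (≤-reflexive (sym (𝟙-true (has-prime? p d) p≡))) (each d∈ p≡ h<a)
    finish : ∀ c → c ≤ γ → 4 * N p ≤ p ^ c → (∀ {d} → d ∈ ds → proj₁ d ≡ p → h p < proj₁ (proj₂ d) → c ≤ proj₁ (proj₂ d) ∸ h p) → 4 * cost p ≤ p ^ γ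
    finish c c≤γ 4N≤ far = begin
      4 * cost p                   ≤⟨ *-monoʳ-≤ 4 (cost≤ (p ^ (γ ∸ c)) (λ d∈ p≡ h<a → ^-monoʳ-≤ p {{prime⇒nonZero pr}} (∸-monoʳ-≤ γ (far d∈ p≡ h<a)))) ⟩
      4 * (N p * p ^ (γ ∸ c))      ≡⟨ *-assoc 4 (N p) _ ⟨
      4 * N p * p ^ (γ ∸ c)        ≤⟨ *-monoˡ-≤ (p ^ (γ ∸ c)) 4N≤ ⟩
      p ^ c * p ^ (γ ∸ c)          ≡⟨ ^-∸-split p c≤γ ⟨
      p ^ γ                        ∎
    bound : Suits p (h p) → 4 * cost p ≤ p ^ γ
    bound (inj₁ (4N≤p , h≡0)) = finish 1 (s≤s z≤n) (≤-trans 4N≤p (≤-reflexive (sym (*-identityʳ p)))) (λ _ _ h<a → m<n⇒0<n∸m h<a)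
    bound (inj₂ (_ , empty)) = finish g (≤-trans (m≤m+n g B) (m≤n+m (g + B) (2 + S)))
      (≤-trans (*-monoʳ-≤ 4 (N≤J p)) (≤-trans 4J≤2^g (^-monoˡ-≤ g (prime⇒≥2 pr))))
      (λ {d} d∈ p≡ h<a → m+n≤o⇒m≤o∸n g (≤-trans (≤-reflexive (+-comm g (h p))) (<⇒≤ (empty (∈-map⁺ (proj₁ ∘ proj₂) (∈-filter⁺ (has-prime? p) d∈ p≡)) h<a))))

  -- At most `Y` special primes are below `Y`. Any other one has `Y ≤ p < 4 * N p`, and since the
  -- `N p` add up to at most `J ≤ 4 * (Y * Y)`, there are at most `16 * Y` of those.
  few : ∀ n → ∑ (primes n) (λ p → 𝟙 (0 <? h p)) ≤ 17 * Y
  few n = *-cancelˡ-≤ Y {{>-nonZero 1≤Y}} (begin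
    Y * ∑ (primes n) (λ p → 𝟙 (0 <? h p))                       ≡⟨ ∑-*ˡ (primes n) Y _ ⟨
    ∑ (primes n) (λ p → Y * 𝟙 (0 <? h p))                       ≤⟨ ∑-mono (primes n) each ⟩
    ∑ (primes n) (λ p → Y * 𝟙 (p <? Y) + 4 * N p)               ≡⟨ trans (∑-+ (primes n) _ _) (cong₂ _+_ (∑-*ˡ (primes n) Y _) (∑-*ˡ (primes n) 4 N)) ⟩
    Y * ∑ (primes n) (λ p → 𝟙 (p <? Y)) + 4 * ∑ (primes n) N    ≤⟨ +-mono-≤ (*-monoʳ-≤ Y (count-below id id (primes n) (primes-unique n) Y)) (*-monoʳ-≤ 4 (≤-trans (∑N≤J n) J≤Y²)) ⟩
    Y * Y + 4 * (4 * (Y * Y))                                   ≡⟨ lem Y ⟩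
    Y * (17 * Y)                                                ∎)
    where
    lem : ∀ y → y * y + 4 * (4 * (y * y)) ≡ y * (17 * y)
    lem = solve-∀
    each : ∀ p → Y * 𝟙 (0 <? h p) ≤ Y * 𝟙 (p <? Y) + 4 * N p
    each p = cases (0 <? h p) (p <? Y)
      where
      cases : (B? : Dec (0 < h p)) (C? : Dec (p < Y)) → Y * 𝟙 B? ≤ Y * 𝟙 C? + 4 * N p
      cases (no _)    _        = ≤-trans (≤-reflexive (*-zeroʳ Y)) z≤n
      cases (yes _)   (yes _)  = m≤m+n _ _
      cases (yes 0<h) (no p≮Y) = ≤-trans (≤-trans (≤-reflexive (*-identityʳ Y)) (≤-trans (≮⇒≥ p≮Y) (<⇒≤ (h>0⇒ p 0<h)))) (m≤n+m (4 * N p) (Y * 0))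

  total : ∀ n → ∑ (primes n) h ≤ S
  total n = begin
    ∑ (primes n) h                  ≤⟨ ∑-mono (primes n) (λ p → proj₁ (proj₂ (choose p))) ⟩
    ∑ (primes n) (λ p → N p * g)    ≡⟨ ∑-*ʳ (primes n) g N ⟩
    ∑ (primes n) N * g              ≤⟨ *-monoˡ-≤ g (∑N≤J n) ⟩
    J * g                           ∎

  Z : ℕ
  Z = 2 * ((S + 6) * (S + 6))

  q≤4^ : ∀ i → q i ≤ 4 ^ (B + k₁)
  q≤4^ i = ≤-trans (q≤B i) (≤-trans (<⇒≤ (n<2^n B)) (≤-trans (^-monoˡ-≤ B (s≤s (s≤s z≤n))) (^-monoʳ-≤ 4 (m≤m+n B k₁))))

  late-unique : Unique late
  late-unique = filter⁺ (λ i → J ≤? toℕ i) (allFin⁺ K)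

  late-large′ : ∀ {i} → i ∈ late → (4 ^ k₁) ^ T₀ ≤ q i
  late-large′ {i} i∈ = late-large i (proj₂ (∈-filter⁻ (λ i → J ≤? toℕ i) {xs = allFin K} i∈))

  h≤γ : ∀ p → 2 + h p ≤ γ
  h≤γ p = ≤-trans (+-monoʳ-≤ 2 (h≤S p)) (m≤m+n (2 + S) (g + B))

  h≡0 : ∀ {p} → 4 ^ k₁ < p → h p ≡ 0
  h≡0 {p} P<p = n≤0⇒n≡0 (≮⇒≥ λ 0<h → <⇒≱ (h>0⇒ p 0<h) (≤-trans (≤-trans (*-monoʳ-≤ 4 (N≤J p)) 4J≤4^k₁) (<⇒≤ P<p)))

  1≤Z : 1 ≤ Z
  1≤Z = ≤-trans (s≤s z≤n) (*-monoʳ-≤ 2 (*-mono-≤ {6} {S + 6} {6} {S + 6} (m≤n+m 6 S) (m≤n+m 6 S)))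

  h≤Z : ∀ p → 2 * ((h p + 6) * (h p + 6)) ≤ Z
  h≤Z p = *-monoʳ-≤ 2 (*-mono-≤ (+-monoˡ-≤ 6 (h≤S p)) (+-monoˡ-≤ 6 (h≤S p)))

  R : ℕ
  R = 4 ^ (B + k₁)

  survivor : ∃ λ x → x ∈AP x₀ mod val (primes R) h ×
    (∀ {p a s} → p ∈ primes R → (p , a , s) ∈ ds → h p < a → ¬ x ∈AP s mod (p ^ a)) ×
    (∀ {i} → i ∈ late → ¬ x ∈AP r i mod q i)
  survivor = Phases.survivor γ h k₁ B x₀ ds ds≤γ r q q-injective q>0 q<2^γ q≤4^ late late-unique T₀ late-large′ pays
    h≤γ h≡0 1≤k₁ Z (17 * Y) S 1≤Z h≤Z few total cond₁ cond₂

  module _ (x : ℤ) (anchored : x ∈AP x₀ mod val (primes R) h)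
    (allowed : ∀ {p a s} → p ∈ primes R → (p , a , s) ∈ ds → h p < a → ¬ x ∈AP s mod (p ^ a)) where

    -- For `a` above `h p` the sieve has excluded the class. For smaller `a` the points `x` and `x₀`
    -- agree modulo `p ^ a`, and `x₀` is outside.
    avoids-early′ : ∀ i p a → Prime p → p ^ a ∣ q i → ¬ x₀ ∈AP r i mod (p ^ a) → (p , a , r i) ∈ ds → ¬ x ∈AP r i mod q i
    avoids-early′ i p a pr p^a∣q x₀∉ d∈ hit = cases (h p <? a)
      where
      x∈ : x ∈AP r i mod (p ^ a)
      x∈ = ∈AP-∣ {p ^ a} {q i} x (r i) p^a∣q hit
      -- The exponent is not `0`, since every integer lies in every class modulo `1`.
      p∣p^ : ∀ b → ¬ x₀ ∈AP r i mod (p ^ b) → p ∣ p ^ b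
      p∣p^ zero    ∉ = ⊥-elim (∉ (1∣ _))
      p∣p^ (suc b) _ = m∣m*n (p ^ b)
      p∈ : p ∈ primes R
      p∈ = ∈-primes⁺ R pr (≤-trans (∣⇒≤ {{>-nonZero (q>0 i)}} (∣-trans (p∣p^ a x₀∉) p^a∣q)) (q≤4^ i))
      cases : Dec (h p < a) → ⊥
      cases (yes h<a) = allowed p∈ d∈ h<a x∈
      cases (no h≮a)  = x₀∉ (∈AP-trans {p ^ a} x x₀ (r i)
        (∈AP-∣ {p ^ a} {val (primes R) h} x x₀ (∣-trans (^-∣ p (≮⇒≥ h≮a)) (∣∏ (λ p → p ^ h p) p∈)) anchored) x∈)

    avoids-early : ∀ i → toℕ i < J → ¬ x ∈AP r i mod q i
    avoids-early i i<J = let pr , p^a∣q , x₀∉ = proj₂ (proj₂ (proj₂ (witness i))) (early-avoids i i<J) in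
      avoids-early′ i (proj₁ (witness i)) (proj₁ (proj₂ (witness i))) pr p^a∣q x₀∉
        (∈-map⁺ datum (∈-filter⁺ (λ i → toℕ i <? J) (∈-allFin i) i<J))

    avoids-all : (∀ {i} → i ∈ late → ¬ x ∈AP r i mod q i) → ∀ i → ¬ x ∈AP r i mod q i
    avoids-all avoids i = cases (toℕ i <? J)
      where
      cases : Dec (toℕ i < J) → ¬ x ∈AP r i mod q i
      cases (yes i<J) = avoids-early i i<J
      cases (no  i≮J) = avoids (∈-filter⁺ (λ i → J ≤? toℕ i) (∈-allFin i) (≮⇒≥ i≮J))

  uncovered : ∃ λ x → ∀ i → ¬ x ∈AP r i mod q i
  uncovered = let x , anchored , allowed , avoids = survivor in x , avoids-all x anchored allowed avoids

-- Numerical choice of the parameters.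

base-4-digits : ∀ n → 1 ≤ n → ∃ λ l → 4 ^ l ≤ n × n < 4 ^ suc l
base-4-digits (suc zero)    _ = 0 , ≤-refl , s≤s (s≤s z≤n)
base-4-digits (suc (suc n)) _ with base-4-digits (suc n) (s≤s z≤n)
... | l , ≤n , n< with suc (suc n) <? 4 ^ suc l
...   | yes n′< = l , m≤n⇒m≤1+n ≤n , n′<
...   | no  n′≮ = suc l , ≮⇒≥ n′≮ , ≤-<-trans n< (^-monoʳ-< 4 (s≤s (s≤s z≤n)) {suc l} {suc (suc l)} ≤-refl)

-- The lower-order terms are chosen so that twice the polynomial at `λ′` exceeds its value at
-- `suc λ′` by exactly the cube of `λ′`; `26` is its value at `1`.
cubic≤exponential : ∀ l → let λ′ = suc l in λ′ * λ′ * λ′ + 3 * (λ′ * λ′) + 9 * λ′ + 13 ≤ 26 * 2 ^ l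
cubic≤exponential zero    = ≤-refl
cubic≤exponential (suc l) = begin
  suc (suc l) * suc (suc l) * suc (suc l) + 3 * (suc (suc l) * suc (suc l)) + 9 * suc (suc l) + 13 ≤⟨ m≤m+n _ _ ⟩
  suc (suc l) * suc (suc l) * suc (suc l) + 3 * (suc (suc l) * suc (suc l)) + 9 * suc (suc l) + 13 + suc l * suc l * suc l ≡⟨ lem (suc l) ⟩
  2 * (suc l * suc l * suc l + 3 * (suc l * suc l) + 9 * suc l + 13) ≤⟨ *-monoʳ-≤ 2 (cubic≤exponential l) ⟩
  2 * (26 * 2 ^ l) ≡⟨ lem₂ (2 ^ l) ⟩
  26 * (2 * 2 ^ l) ∎
  where
  open ≤-Reasoning
  lem : ∀ x → suc x * suc x * suc x + 3 * (suc x * suc x) + 9 * suc x + 13 + x * x * x ≡ 2 * (x * x * x + 3 * (x * x) + 9 * x + 13)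
  lem = solve-∀
  lem₂ : ∀ x → 2 * (26 * x) ≡ 26 * (2 * x)
  lem₂ = solve-∀

cube≤ : ∀ l → suc l * suc l * suc l ≤ 26 * 2 ^ l
cube≤ l = ≤-trans (≤-trans (m≤m+n _ _) (≤-trans (m≤m+n _ _) (m≤m+n _ _))) (cubic≤exponential l)

-- `197 = 10 + 11 * 17` stems from `k₁` and `113 = 1 + 7 * 16` from `m`. In `832 = 8 * 26 * 4` the
-- `26` is that of `cube≤`, and the `4` comes from squaring `Y * Y ≤ 2 * suc J`.
α β c₀ : ℕ
α = 197 + κ
β = 113 + κ + α
c₀ = 832 * (α * β)

module Parameters (J l : ℕ) (4^l≤ : 4 ^ l ≤ 2 + J) (<4^ : 2 + J < 4 ^ suc l) where

  open ≤-Reasoning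

  -- `Y` is about the square root of `J`, and `2 ^ g = 4 ^ (2 + l)` exceeds `4 * J`. In `2 ^ k₁` the
  -- factor `2 ^ 10` absorbs `24 * 32`, `2 ^ κ` absorbs `κ`, and `2 ^ (11 + 6 * l)` bounds the cost
  -- of one of the `17 * Y` special primes. `2 ^ m` bounds the factor besides `2 ^ T₀` in `cond₁`,
  -- and `T₀` is `2 * m` because `9 / 4` exceeds `2`.
  Y g S k₁ m T₀ : ℕ
  Y  = 2 ^ l
  g  = 2 * l + 4
  S  = J * g
  k₁ = 10 + κ + (11 + 6 * l) * (17 * Y)
  m  = 1 + κ + k₁ + 7 * S
  T₀ = 2 * m

  1≤Y : 1 ≤ Y
  1≤Y = ^>0 l (s≤s z≤n)

  Y²≡ : Y * Y ≡ 4 ^ l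
  Y²≡ = sym (^-distribʳ-* 2 2 l)

  J≤Y² : J ≤ 4 * (Y * Y)
  J≤Y² = ≤-trans (≤-trans (m≤n+m J 2) (<⇒≤ <4^)) (≤-reflexive (cong (4 *_) (sym Y²≡)))

  4J≤4^ : 4 * J ≤ 4 ^ (2 + l)
  4J≤4^ = *-monoʳ-≤ 4 (≤-trans (m≤n+m J 2) (<⇒≤ <4^))

  4J≤2^g : 4 * J ≤ 2 ^ g
  4J≤2^g = ≤-trans 4J≤4^ (≤-reflexive (trans (^-*-assoc 2 2 (2 + l)) (cong (2 ^_) (lem l))))
    where
    lem : ∀ l → 2 * (2 + l) ≡ 2 * l + 4
    lem = solve-∀

  11+6l≤ : 11 + 6 * l ≤ (11 + 6 * l) * (17 * Y)
  11+6l≤ = m≤m*n (11 + 6 * l) (17 * Y) {{>-nonZero (*-mono-< {0} {17} (s≤s z≤n) 1≤Y)}}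

  4J≤4^k₁ : 4 * J ≤ 4 ^ k₁
  4J≤4^k₁ = ≤-trans 4J≤4^ (^-monoʳ-≤ 4 (≤-trans (+-mono-≤ {2} {11} (s≤s (s≤s z≤n)) (m≤m+n l (5 * l))) (≤-trans 11+6l≤ (m≤n+m _ (10 + κ)))))

  1≤k₁ : 1 ≤ k₁
  1≤k₁ = s≤s z≤n

  l+1≤Y : suc l ≤ Y
  l+1≤Y = n<2^n l

  g≤ : g ≤ 4 * suc l
  g≤ = ≤-trans (m≤m+n _ (2 * l)) (≤-reflexive (lem l))
    where
    lem : ∀ l → 2 * l + 4 + 2 * l ≡ 4 * suc l
    lem = solve-∀

  S≤ : S ≤ 16 * (suc l * (Y * Y))
  S≤ = ≤-trans (*-mono-≤ J≤Y² g≤) (≤-reflexive (lem (Y * Y) (suc l)))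
    where
    lem : ∀ a b → 4 * a * (4 * b) ≡ 16 * (b * a)
    lem = solve-∀

  S+6≤ : S + 6 ≤ 2 ^ (5 + 3 * l)
  S+6≤ = begin
    S + 6                             ≤⟨ +-mono-≤ S≤ (*-monoʳ-≤ 6 (*-mono-≤ {1} {suc l} (s≤s z≤n) (*-mono-≤ 1≤Y 1≤Y))) ⟩
    16 * (suc l * (Y * Y)) + 6 * (suc l * (Y * Y)) ≤⟨ m≤m+n _ (10 * (suc l * (Y * Y))) ⟩
    16 * (suc l * (Y * Y)) + 6 * (suc l * (Y * Y)) + 10 * (suc l * (Y * Y)) ≡⟨ lem (suc l * (Y * Y)) ⟩
    2 ^ 5 * (suc l * (Y * Y))         ≤⟨ *-monoʳ-≤ (2 ^ 5) (*-monoˡ-≤ (Y * Y) l+1≤Y) ⟩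
    2 ^ 5 * (Y * (Y * Y))             ≡⟨ cong (2 ^ 5 *_) cube ⟩
    2 ^ 5 * 2 ^ (3 * l)               ≡⟨ ^-distribˡ-+-* 2 5 (3 * l) ⟨
    2 ^ (5 + 3 * l)                   ∎
    where
    lem : ∀ a → 16 * a + 6 * a + 10 * a ≡ 32 * a
    lem = solve-∀
    cube : Y * (Y * Y) ≡ 2 ^ (3 * l)
    cube = trans (cong (Y *_) (sym (^-distribˡ-+-* 2 l l))) (trans (sym (^-distribˡ-+-* 2 l (l + l))) (cong (2 ^_) (lem₁ l)))
      where
      lem₁ : ∀ l → l + (l + l) ≡ 3 * l
      lem₁ = solve-∀

  Z≤ : 2 * ((S + 6) * (S + 6)) ≤ 2 ^ (11 + 6 * l)
  Z≤ = ≤-trans (*-monoʳ-≤ 2 (*-mono-≤ S+6≤ S+6≤)) (≤-reflexive (trans (cong (2 *_) (sym (^-distribˡ-+-* 2 (5 + 3 * l) (5 + 3 * l)))) (cong (2 ^_) (lem l))))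
    where
    lem : ∀ l → suc ((5 + 3 * l) + (5 + 3 * l)) ≡ 11 + 6 * l
    lem = solve-∀

  κ≤2^κ : κ ≤ 2 ^ κ
  κ≤2^κ = <⇒≤ (n<2^n κ)

  cond₂ : 24 * (32 * (κ * (2 * ((S + 6) * (S + 6))) ^ (17 * Y))) ≤ 2 ^ k₁
  cond₂ = begin
    24 * (32 * (κ * (2 * ((S + 6) * (S + 6))) ^ (17 * Y)))    ≡⟨ lem κ ((2 * ((S + 6) * (S + 6))) ^ (17 * Y)) ⟩
    24 * 32 * κ * (2 * ((S + 6) * (S + 6))) ^ (17 * Y)        ≤⟨ *-mono-≤ (*-mono-≤ (≤ᵇ⇒≤ 768 (2 ^ 10) _) κ≤2^κ) (^-monoˡ-≤ (17 * Y) Z≤) ⟩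
    2 ^ 10 * 2 ^ κ * (2 ^ (11 + 6 * l)) ^ (17 * Y)            ≡⟨ cong₂ _*_ (sym (^-distribˡ-+-* 2 10 κ)) (^-*-assoc 2 (11 + 6 * l) (17 * Y)) ⟩
    2 ^ (10 + κ) * 2 ^ ((11 + 6 * l) * (17 * Y))              ≡⟨ ^-distribˡ-+-* 2 (10 + κ) _ ⟨
    2 ^ k₁                                                    ∎
    where
    lem : ∀ a z → 24 * (32 * (a * z)) ≡ 24 * 32 * a * z
    lem = solve-∀

  cond₁ : 2 * (2 ^ T₀ * (κ * 2 ^ k₁ * 128 ^ S)) ≤ 3 ^ T₀
  cond₁ = begin
    2 * (2 ^ T₀ * (κ * 2 ^ k₁ * 128 ^ S))                ≤⟨ *-monoʳ-≤ 2 (*-monoʳ-≤ (2 ^ T₀) (*-monoˡ-≤ (128 ^ S) (*-monoˡ-≤ (2 ^ k₁) κ≤2^κ))) ⟩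
    2 * (2 ^ T₀ * (2 ^ κ * 2 ^ k₁ * 128 ^ S))            ≡⟨ cong (λ x → 2 * (2 ^ T₀ * (2 ^ κ * 2 ^ k₁ * x))) (^-*-assoc 2 7 S) ⟩
    2 * (2 ^ T₀ * (2 ^ κ * 2 ^ k₁ * 2 ^ (7 * S)))        ≡⟨ lem (2 ^ T₀) (2 ^ κ) (2 ^ k₁) (2 ^ (7 * S)) ⟩
    2 ^ T₀ * (2 ^ 1 * 2 ^ κ * 2 ^ k₁ * 2 ^ (7 * S))      ≡⟨ cong (2 ^ T₀ *_) collect ⟩
    2 ^ T₀ * 2 ^ m                                       ≡⟨ cong (_* 2 ^ m) (^-*-assoc 2 2 m) ⟨
    4 ^ m * 2 ^ m                                        ≡⟨ ^-distribʳ-* 4 2 m ⟨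
    8 ^ m                                                ≤⟨ ^-monoˡ-≤ m (n≤1+n 8) ⟩
    9 ^ m                                                ≡⟨ ^-*-assoc 3 2 m ⟩
    3 ^ T₀                                               ∎
    where
    lem : ∀ t a b c → 2 * (t * (a * b * c)) ≡ t * (2 * 1 * a * b * c)
    lem = solve-∀
    collect : 2 ^ 1 * 2 ^ κ * 2 ^ k₁ * 2 ^ (7 * S) ≡ 2 ^ m
    collect = trans (cong (λ x → x * 2 ^ k₁ * 2 ^ (7 * S)) (sym (^-distribˡ-+-* 2 1 κ)))
      (trans (cong (_* 2 ^ (7 * S)) (sym (^-distribˡ-+-* 2 (1 + κ) k₁))) (sym (^-distribˡ-+-* 2 (1 + κ + k₁) (7 * S))))

  weaken : ∀ x {y} → 1 ≤ y → x ≤ x * y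
  weaken x 1≤y = m≤m*n x _ {{>-nonZero 1≤y}}

  k₁≤ : k₁ ≤ α * (suc l * Y)
  k₁≤ = begin
    10 + κ + (11 + 6 * l) * (17 * Y)            ≤⟨ +-mono-≤ (weaken (10 + κ) (*-mono-≤ {1} {suc l} (s≤s z≤n) 1≤Y)) (*-monoˡ-≤ (17 * Y) (m≤m+n (11 + 6 * l) (5 * l))) ⟩
    (10 + κ) * (suc l * Y) + (11 + 6 * l + 5 * l) * (17 * Y) ≡⟨ lem κ l Y ⟩
    (187 + (10 + κ)) * (suc l * Y)              ≡⟨⟩
    α * (suc l * Y)                             ∎
    where
    lem : ∀ a l y → (10 + a) * (suc l * y) + (11 + 6 * l + 5 * l) * (17 * y) ≡ (187 + (10 + a)) * (suc l * y)
    lem = solve-∀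

  m≤ : m ≤ β * (suc l * (Y * Y))
  m≤ = begin
    1 + κ + k₁ + 7 * S                ≤⟨ +-mono-≤ (+-mono-≤ (weaken (1 + κ) 1≤w) k₁≤′) (*-monoʳ-≤ 7 S≤) ⟩
    (1 + κ) * w + α * w + 7 * (16 * w) ≡⟨ lem κ α w ⟩
    (112 + (1 + κ) + α) * w           ≡⟨⟩
    β * w                             ∎
    where
    w = suc l * (Y * Y)
    1≤w : 1 ≤ w
    1≤w = *-mono-≤ {1} {suc l} (s≤s z≤n) (*-mono-≤ 1≤Y 1≤Y)
    k₁≤′ : k₁ ≤ α * w
    k₁≤′ = ≤-trans k₁≤ (*-monoʳ-≤ α (*-monoʳ-≤ (suc l) (weaken Y 1≤Y)))
    lem : ∀ a b w → (1 + a) * w + b * w + 7 * (16 * w) ≡ (112 + (1 + a) + b) * w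
    lem = solve-∀

  -- The left side is of order `suc l` cubed times `Y` cubed. The cube of the logarithm is absorbed
  -- by one more factor `Y`, and `Y ^ 4` is of order `J` squared.
  final : 2 * (k₁ * T₀) * (2 * suc l) ≤ c₀ * (suc J * suc J)
  final = begin
    2 * (k₁ * (2 * m)) * (2 * suc l)                                        ≤⟨ *-monoˡ-≤ (2 * suc l) (*-monoʳ-≤ 2 (*-mono-≤ k₁≤ (*-monoʳ-≤ 2 m≤))) ⟩
    2 * (α * (suc l * Y) * (2 * (β * (suc l * (Y * Y))))) * (2 * suc l)     ≡⟨ lem₁ α β (suc l) Y ⟩
    8 * (α * β) * ((suc l * suc l * suc l) * (Y * (Y * Y)))                 ≤⟨ *-monoʳ-≤ (8 * (α * β)) (*-monoˡ-≤ (Y * (Y * Y)) (cube≤ l)) ⟩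
    8 * (α * β) * (26 * Y * (Y * (Y * Y)))                                  ≡⟨ lem₂ (α * β) Y ⟩
    208 * (α * β) * ((Y * Y) * (Y * Y))                                     ≤⟨ *-monoʳ-≤ (208 * (α * β)) (*-mono-≤ Y²≤ Y²≤) ⟩
    208 * (α * β) * ((2 * suc J) * (2 * suc J))                             ≡⟨ lem₃ (α * β) (suc J) ⟩
    c₀ * (suc J * suc J)                                                    ∎
    where
    Y²≤ : Y * Y ≤ 2 * suc J
    Y²≤ = ≤-trans (≤-reflexive Y²≡) (≤-trans 4^l≤ (≤-trans (m≤m+n (2 + J) J) (≤-reflexive (lem J))))
      where
      lem : ∀ j → 2 + j + j ≡ 2 * suc j
      lem = solve-∀
    lem₁ : ∀ a b l y → 2 * (a * (l * y) * (2 * (b * (l * (y * y))))) * (2 * l) ≡ 8 * (a * b) * ((l * l * l) * (y * (y * y)))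
    lem₁ = solve-∀
    lem₂ : ∀ a y → 8 * a * (26 * y * (y * (y * y))) ≡ 208 * a * ((y * y) * (y * y))
    lem₂ = solve-∀
    lem₃ : ∀ a j → 208 * a * ((2 * j) * (2 * j)) ≡ 832 * a * (j * j)
    lem₃ = solve-∀

-- From minimality to the bound.

module System {K : ℕ} (r : Fin K → ℤ) (q : Fin K → ℕ) (minimal : IsMinimalCoveringSystem r q)
  (increasing : ∀ (i j : Fin K) → toℕ i < toℕ j → q i < q j) (j : Fin K) where

  J : ℕ
  J = toℕ j

  private
    digits = base-4-digits (2 + J) (s≤s z≤n)

  l : ℕ
  l = proj₁ digits

  open Parameters J l (proj₁ (proj₂ digits)) (proj₂ (proj₂ digits))

  q>0 : ∀ i → 0 < q i
  q>0 = proj₁ (proj₁ minimal)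

  q-injective : ∀ {i i′} → q i ≡ q i′ → i ≡ i′
  q-injective {i} {i′} eq with <-cmp (toℕ i) (toℕ i′)
  ... | tri< lt _ _ = ⊥-elim (<⇒≢ (increasing i i′ lt) eq)
  ... | tri≈ _ e _  = Fin.toℕ-injective e
  ... | tri> _ _ gt = ⊥-elim (<⇒≢ (increasing i′ i gt) (sym eq))

  q-monotone : ∀ i → J ≤ toℕ i → q j ≤ q i
  q-monotone i J≤i with m≤n⇒m<n∨m≡n J≤i
  ... | inj₁ J<i = <⇒≤ (increasing j i J<i)
  ... | inj₂ J≡i = ≤-reflexive (cong q (Fin.toℕ-injective J≡i))

  before : Subset K
  before = tabulate (λ i → does (toℕ i <? J))

  ∈-before⁺ : ∀ i → toℕ i < J → i ∈ₛ before
  ∈-before⁺ i i<J = lookup⇒[]= i before (trans (lookup∘tabulate _ i) (dec-true (toℕ i <? J) i<J))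

  before⊂⊤ : before ⊂ ⊤
  before⊂⊤ = (λ _ → ∈⊤) , j , ∈⊤ , λ j∈ → case-false (trans (sym (dec-false (J <? J) (<-irrefl refl)))
    (trans (sym (lookup∘tabulate _ j)) ([]=⇒lookup j∈)))
    where
    case-false : false ≡ true → ⊥
    case-false ()

  small : ¬ (4 ^ k₁) ^ T₀ < q j
  -- If `q j` were too large, the progressions before `j` would already cover: an integer `x` missed
  -- by them could serve as `x₀`, and the sieve would produce an integer missed by the whole system.
  -- So `x₀` is never constructed from minimality.
  small large = proj₂ minimal before before⊂⊤ λ x → covered x (Fin.any? (λ i → toℕ i <? J ×-dec ∈AP? x (r i) (q i)))
    where
    covered : ∀ x → Dec (∃ λ i → toℕ i < J × x ∈AP r i mod q i) → ∃ λ i → i ∈ₛ before × x ∈AP r i mod q i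
    covered x (yes (i , i<J , x∈)) = i , ∈-before⁺ i i<J , x∈
    covered x (no none) = ⊥-elim (proj₂ escape (proj₁ hit) (proj₂ (proj₂ hit)))
      where
      escape : ∃ λ y → ∀ i → ¬ y ∈AP r i mod q i
      escape = Choice.uncovered r q q>0 q-injective J x (λ i i<J x∈ → none (i , i<J , x∈)) g Y k₁ T₀
        4J≤2^g 1≤Y J≤Y² 4J≤4^k₁ 1≤k₁ (λ i J≤i → ≤-trans (<⇒≤ large) (q-monotone i J≤i)) cond₁ cond₂
      hit = proj₂ (proj₁ minimal) (proj₁ escape)

  bound : ⌈log₂ q j ⌉ * ⌊log₂ (suc (suc J)) ⌋ ≤ c₀ * (suc J * suc J)
  bound = ≤-trans (*-mono-≤ ceil floor) final
    where
    open ≤-Reasoning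
    ceil : ⌈log₂ q j ⌉ ≤ 2 * (k₁ * T₀)
    ceil = begin
      ⌈log₂ q j ⌉                    ≤⟨ ⌈log₂⌉-mono-≤ (≮⇒≥ small) ⟩
      ⌈log₂ (4 ^ k₁) ^ T₀ ⌉          ≡⟨ cong ⌈log₂_⌉ (trans (^-*-assoc 4 k₁ T₀) (^-*-assoc 2 2 (k₁ * T₀))) ⟩
      ⌈log₂ 2 ^ (2 * (k₁ * T₀)) ⌉    ≡⟨ ⌈log₂2^n⌉≡n (2 * (k₁ * T₀)) ⟩
      2 * (k₁ * T₀)                  ∎
    floor : ⌊log₂ (suc (suc J)) ⌋ ≤ 2 * suc l
    floor = begin
      ⌊log₂ (suc (suc J)) ⌋          ≤⟨ ⌊log₂⌋-mono-≤ (<⇒≤ (proj₂ (proj₂ digits))) ⟩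
      ⌊log₂ (4 ^ suc l) ⌋            ≡⟨ cong ⌊log₂_⌋ (^-*-assoc 2 2 (suc l)) ⟩
      ⌊log₂ (2 ^ (2 * suc l)) ⌋      ≡⟨ ⌊log₂[2^n]⌋≡n (2 * suc l) ⟩
      2 * suc l                      ∎

c₀≥1 : c₀ ≥ 1
c₀≥1 = *-mono-≤ {1} {832} (s≤s z≤n) (*-mono-≤ {1} {α} {1} {β} (s≤s z≤n) (s≤s z≤n))

theorem1 : ∃ λ (c : ℕ) → c ≥ 1 ×
    (∀ (k : ℕ) (r : Fin k → ℤ) (q : Fin k → ℕ) →
    IsMinimalCoveringSystem r q →
    (∀ (i j : Fin k) → toℕ i < toℕ j → q i < q j) →
    ∀ (j : Fin k) →
    ⌈log₂ q j ⌉ * ⌊log₂ (suc (suc (toℕ j))) ⌋ ≤ c * (suc (toℕ j) * suc (toℕ j)))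
theorem1 = c₀ , c₀≥1 , λ k r q minimal increasing j → System.bound r q minimal increasing j
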